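{- Let $d\ge1$, let $a(0)=1,a(1),a(2),\dots$ and $a^*(0)=1,a^*(1),\dots$ be sequences, and let $s,t$ be indeterminates. For $\pi\in\mathrm{NC}^d_{dk+1}$ define $$\mathrm{wt}(\pi)=\prod_{B\in\pi}a\!\left(\tfrac{|B|-1}{d}\right)\prod_{C'\in\pi'}a^*\!\left(\tfrac{|C'|-1}{d}\right)s^{(|\pi|-1)/d}\,t^{(|\pi'|-1)/d}.$$ Let $A(x)=\sum_{k\ge0}a(k)x^k$, $A^*(x)=\sum_{k\ge0}a^*(k)x^k$, $B(x)=\sum_{k\ge0}b(k)x^k$ with $b(k)=\sum_{\pi\in\mathrm{NC}^d_{dk+1}}\mathrm{wt}(\pi)$, $C(x)=\sum_{k\ge0}c(k)x^k$ with $c(k)=\sum_{\pi\in\mathrm{NC}^d_{dk+1},\,\{1\}\in\pi}\mathrm{wt}(\pi)$, and $C^*(x)=\sum_{k\ge0}c^*(k)x^k$ with $c^*(k)=\sum_{\pi\in\mathrm{NC}^d_{dk+1},\,\{1'\}\in\pi'}\mathrm{wt}(\pi)$. Then $$C(x)=A^*\!\left(x\cdot s\cdot C^*(x)^d\right),\qquad C^*(x)=A\!\left(x\cdot t\cdot C(x)^d\right),\qquad B(x)=C(x)\cdot C^*(x).$$ Furthermore, the first two equations uniquely determine the formal power series $C(x)$ and $C^*(x)$.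
   Context: A partition of $[n]$ is noncrossing if there are no $i<j<k<\ell$ with $i,k$ in one block and $j,\ell$ in a different block. The Kreweras dual $\pi'$ of a noncrossing partition $\pi$ of $[n]$: place $1,1',2,2',\dots,n,n'$ on a circle in this cyclic order; $\pi'$ is the coarsest partition of $\{1',\dots,n'\}$ such that the blocks of $\pi$ and of $\pi'$ together form a noncrossing partition of these $2n$ points. $\mathrm{NC}^d_n$ is the set of noncrossing partitions $\pi$ of $[n]$ such that every block of $\pi$ and every block of $\pi'$ has cardinality congruent to $1$ modulo $d$. $|\pi|$ denotes the number of blocks of $\pi$. -}

module Defs where

open import Algebra.Bundles using (CommutativeRing)
open import Data.Nat as ℕ using (ℕ; zero; suc; NonZero; _∸_)
open import Data.Nat.DivMod using (_/_; _%_)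
open import Data.Fin using (Fin; toℕ)
open import Data.Fin.Properties using (_≟_)
open import Data.Bool using (Bool; true; false; _∧_; _∨_; not; if_then_else_)
open import Data.List using (List; []; _∷_; _++_; map; concatMap; foldr; length; allFin; upTo; cartesianProduct)
open import Data.Product using (_×_; _,_; proj₁; proj₂)
open import Data.Sum using (_⊎_; inj₁; inj₂)
open import Relation.Nullary using (does)

-- Set partitions of [n] = Fin n (0-based: point i stands for i+1).
-- A partition is encoded by a labelling f : Fin n → Fin n assigning to
-- each point the label of its block; i and j lie in the same block iff
-- f i = f j.  A labelling is *canonical* when every point is labelled
-- by the minimum of its block (f (f i) = f i and f i ≤ i); canonical
-- labellings are in bijection with set partitions of [n].

Labelling : ℕ → Set
Labelling n = Fin n → Fin n

allFuns : (n m : ℕ) → List (Fin n → Fin m)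
allFuns zero    m = (λ ()) ∷ []
allFuns (suc n) m =
  concatMap (λ x → map (λ f → cons x f) (allFuns n m)) (allFin m)
  where
  cons : ∀ {n m} → Fin m → (Fin n → Fin m) → Fin (suc n) → Fin m
  cons x f Fin.zero    = x
  cons x f (Fin.suc i) = f i

allB : ∀ {A : Set} → (A → Bool) → List A → Bool
allB p = foldr (λ x b → p x ∧ b) true

keep : ∀ {A : Set} → (A → Bool) → List A → List A
keep p = concatMap (λ x → if p x then x ∷ [] else [])

sameBlock : ∀ {n} → Labelling n → Fin n → Fin n → Bool
sameBlock f i j = does (f i ≟ f j)

isCanonical : ∀ {n} → Labelling n → Bool
isCanonical {n} f =
  allB (λ i → does (f (f i) ≟ f i) ∧ (toℕ (f i) ℕ.≤ᵇ toℕ i)) (allFin n)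

noncrossingRel : ∀ {P : Set} → List P → (P → ℕ) → (P → P → Bool) → Bool
noncrossingRel pts pos same =
  allB (λ p → allB (λ q → allB (λ r → allB (λ u →
    not ( (pos p ℕ.<ᵇ pos q) ∧ (pos q ℕ.<ᵇ pos r) ∧ (pos r ℕ.<ᵇ pos u)
        ∧ same p r ∧ same q u ∧ not (same p q)))
    pts) pts) pts) pts

isNoncrossing : ∀ {n} → Labelling n → Bool
isNoncrossing {n} f = noncrossingRel (allFin n) toℕ (sameBlock f)

-- The 2n points 1,1',2,2',...,n,n' : inj₁ i is the point i+1, inj₂ i is (i+1)'.
jointPos : ∀ {n} → Fin n ⊎ Fin n → ℕ
jointPos (inj₁ i) = 2 ℕ.* toℕ i
jointPos (inj₂ i) = suc (2 ℕ.* toℕ i)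

jointSame : ∀ {n} → Labelling n → Labelling n → Fin n ⊎ Fin n → Fin n ⊎ Fin n → Bool
jointSame π σ (inj₁ i) (inj₁ j) = sameBlock π i j
jointSame π σ (inj₂ i) (inj₂ j) = sameBlock σ i j
jointSame π σ (inj₁ i) (inj₂ j) = false
jointSame π σ (inj₂ i) (inj₁ j) = false

jointNoncrossing : ∀ {n} → Labelling n → Labelling n → Bool
jointNoncrossing {n} π σ =
  noncrossingRel (map inj₁ (allFin n) ++ map inj₂ (allFin n)) jointPos (jointSame π σ)

refines : ∀ {n} → Labelling n → Labelling n → Bool
refines {n} τ σ =
  allB (λ i → allB (λ j → not (sameBlock τ i j) ∨ sameBlock σ i j) (allFin n)) (allFin n)

isKrewerasDual : ∀ {n} → Labelling n → Labelling n → Bool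
isKrewerasDual {n} π σ =
  isCanonical σ ∧ jointNoncrossing π σ ∧
  allB (λ τ → not (isCanonical τ ∧ jointNoncrossing π τ) ∨ refines τ σ) (allFuns n n)

blockSize : ∀ {n} → Labelling n → Fin n → ℕ
blockSize {n} f i = length (keep (sameBlock f i) (allFin n))

reps : ∀ {n} → Labelling n → List (Fin n)
reps {n} f = keep (λ i → does (f i ≟ i)) (allFin n)

numBlocks : ∀ {n} → Labelling n → ℕ
numBlocks f = length (reps f)

-- every block has size ≡ 1 (mod d)  (block sizes are ≥ 1)
sizesOK : ∀ {n} (d : ℕ) .{{_ : NonZero d}} → Labelling n → Bool
sizesOK {n} d f = allB (λ i → ((blockSize f i ∸ 1) % d) ℕ.≡ᵇ 0) (allFin n)

isNCdPair : ∀ {n} (d : ℕ) .{{_ : NonZero d}} → Labelling n × Labelling n → Bool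
isNCdPair d (π , σ) =
  isCanonical π ∧ isNoncrossing π ∧ isKrewerasDual π σ ∧ sizesOK d π ∧ sizesOK d σ

-- the list of allB (π , π') with π ∈ NC^d_n (each π occurs exactly once)
NCdPairs : (d : ℕ) .{{_ : NonZero d}} (n : ℕ) → List (Labelling n × Labelling n)
NCdPairs d n = keep (isNCdPair d) (cartesianProduct (allFuns n n) (allFuns n n))

-- Ring-valued part: weights, and formal power series as coefficient
-- sequences ℕ → Carrier (equality of series = coefficientwise ≈).

module WithRing {c ℓ} (R : CommutativeRing c ℓ) where
  open CommutativeRing R

  sumR : List Carrier → Carrier
  sumR = foldr _+_ 0#

  prodR : List Carrier → Carrier
  prodR = foldr _*_ 1#

  pow : Carrier → ℕ → Carrier
  pow x zero    = 1#
  pow x (suc n) = x * pow x n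

  wt : ∀ {n} (d : ℕ) .{{_ : NonZero d}} (a a* : ℕ → Carrier) (s t : Carrier) →
       Labelling n × Labelling n → Carrier
  wt d a a* s t (π , σ) =
    prodR (map (λ i → a ((blockSize π i ∸ 1) / d)) (reps π)) *
    prodR (map (λ i → a* ((blockSize σ i ∸ 1) / d)) (reps σ)) *
    pow s ((numBlocks π ∸ 1) / d) *
    pow t ((numBlocks σ ∸ 1) / d)

  bSeq : (d : ℕ) .{{_ : NonZero d}} (a a* : ℕ → Carrier) (s t : Carrier) → ℕ → Carrier
  bSeq d a a* s t k = sumR (map (wt d a a* s t) (NCdPairs d (suc (d ℕ.* k))))

  cSeq : (d : ℕ) .{{_ : NonZero d}} (a a* : ℕ → Carrier) (s t : Carrier) → ℕ → Carrier
  cSeq d a a* s t k =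
    sumR (map (wt d a a* s t)
      (keep (λ p → blockSize (proj₁ p) Fin.zero ℕ.≡ᵇ 1) (NCdPairs d (suc (d ℕ.* k)))))

  c*Seq : (d : ℕ) .{{_ : NonZero d}} (a a* : ℕ → Carrier) (s t : Carrier) → ℕ → Carrier
  c*Seq d a a* s t k =
    sumR (map (wt d a a* s t)
      (keep (λ p → blockSize (proj₂ p) Fin.zero ℕ.≡ᵇ 1) (NCdPairs d (suc (d ℕ.* k)))))

  Series : Set c
  Series = ℕ → Carrier

  Σ≤ : ℕ → (ℕ → Carrier) → Carrier
  Σ≤ n f = sumR (map f (upTo (suc n)))

  _⊛_ : Series → Series → Series
  (f ⊛ g) n = Σ≤ n (λ i → f i * g (n ∸ i))

  oneS : Series
  oneS zero    = 1#
  oneS (suc n) = 0#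

  _^ₛ_ : Series → ℕ → Series
  f ^ₛ zero  = oneS
  f ^ₛ suc m = f ⊛ (f ^ₛ m)

  xTimes : Series → Series
  xTimes f zero    = 0#
  xTimes f (suc n) = f n

  scale : Carrier → Series → Series
  scale s f n = s * f n

  -- A(h(x)) for h with zero constant term:  [x^n] = Σ_{j ≤ n} A_j [x^n] h^j
  compose : Series → Series → Series
  compose A h n = Σ≤ n (λ j → A j * (h ^ₛ j) n)

{-# OPTIONS --safe #-}

-- Join i and i′ by an edge for every i.  This turns (π , π′) into a plane tree
-- whose black vertices are the blocks of π and whose white vertices are the
-- blocks of π′, the degree of a vertex being the size of its block.  Cutting
-- the tree at the edge 1–1′ gives B = C C*, because c and c* count the trees in
-- which the black, respectively white, end of that edge is a leaf.  The root of
-- a planted tree with white root carries dj planted trees with black root, for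
-- some j, and conversely; this gives the two functional equations.  They
-- determine coefficient n from the coefficients below n.
--
-- On the side of the set partitions everything rests on one characterisation:
-- for i < j, i′ and j′ lie in the same block of π′ iff (i , j] is a union of
-- blocks of π.
module Submission where

open import Defs
open import Algebra.Bundles using (CommutativeMonoid; CommutativeRing)
import Algebra.Properties.CommutativeSemigroup as CommutativeSemigroupProperties
open import Data.Nat using (ℕ; zero; suc; _+_; _*_; _∸_; _≤_; _<_; _<ᵇ_; _≡ᵇ_; z≤n; s≤s; NonZero)
open import Data.Nat.Properties
open import Data.Nat.DivMod using (_/_; _%_; m*n/n≡m)
open import Data.Nat.Divisibility using (_∣_; divides; m%n≡0⇒n∣m; n∣m⇒m%n≡0)
open import Data.Nat.Solver using (module +-*-Solver)
open import Data.Fin using (Fin; toℕ; fromℕ<)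
import Data.Fin.Properties as Fin
open import Data.Bool using (Bool; true; false; _∧_; _∨_; not; if_then_else_; T)
open import Data.Bool.Properties using (T-∧; T?; ∧-commutativeMonoid)
open import Data.List using (List; []; _∷_; _++_; length; map; foldr; tabulate; allFin; filter; cartesianProduct)
open import Data.List.Properties using (map-tabulate; map-∘; map-applyUpTo)
open import Data.List.Membership.Propositional using (_∈_)
open import Data.List.Membership.Propositional.Properties
  using (∈-allFin; ∈-map⁺; ∈-map⁻; ∈-++⁺ˡ; ∈-++⁺ʳ; ∈-++⁻; ∈-concatMap⁺; ∈-cartesianProduct⁺; ∈-cartesianProduct⁻)
open import Data.List.Relation.Unary.Any as Any using (here; there; _─_)
open import Data.List.Relation.Unary.All as All using ([]; _∷_)
import Data.List.Relation.Unary.All.Properties as All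
open import Data.List.Relation.Unary.AllPairs as AllPairs using (AllPairs; []; _∷_)
import Data.List.Relation.Unary.AllPairs.Properties as AllPairs
open import Data.List.Relation.Unary.Unique.Propositional using (Unique)
import Data.List.Relation.Unary.Unique.Propositional.Properties as Unique
import Data.List.Relation.Unary.Unique.Setoid as SetoidUnique
import Data.List.Relation.Unary.Unique.Setoid.Properties as UniqueSetoid
open import Data.Product using (_×_; _,_; proj₁; proj₂; ∃; uncurry)
open import Data.Product.Relation.Binary.Pointwise.NonDependent using (×-setoid)
open import Data.Sum using (_⊎_; inj₁; inj₂; [_,_]′)
open import Data.Unit using (tt)
open import Data.Empty using (⊥; ⊥-elim)
open import Function using (Equivalence; _∘_; id; mk⇔)
open import Relation.Nullary using (¬_; Dec; does; yes; no)
open import Relation.Nullary.Decidable using (dec-true; dec-false; does-⇔)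
open import Relation.Binary.Definitions using (tri<; tri≈; tri>)
open import Relation.Binary.PropositionalEquality as ≡
  using (_≡_; _≢_; _≗_; _→-setoid_; refl; sym; trans; cong; cong₂; subst)
import Relation.Binary.Reasoning.Setoid as SetoidReasoning
open Equivalence using (to; from)

-- Plane trees on intervals

-- The exponent (|π| - 1)/d of s is a global number, whereas the recursion on trees needs local
-- factors. Every black vertex other than the root is a child of a white vertex, and a white vertex
-- of degree 1 + jd has jd children; so the exponent is the sum of the j over the white vertices,
-- and s^j can be charged to a white vertex together with a*(j). This is why s accompanies A* and t
-- accompanies A. The link with trees is a relation between two label functions and a forest. Labels
-- are functions on ℕ, so that a subtree is a restriction to an interval and nothing is renumbered.
-- Labellings can be compared only pointwise, so that sums are compared along a relation instead of
-- a function. Since i′ comes after i, a saturated interval (i , j] contains its right end and not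
-- its left one. This fixes the numbering of the edges: the parent edge of a black vertex closes the
-- interval of its subtree, that of a white vertex opens it.

data Tree : Set where
  node : List Tree → Tree

-- Each tree is counted with the edge that plants it, so this is the number of points that the
-- forest occupies.
size : List Tree → ℕ
size []             = 0
size (node us ∷ ts) = suc (size us + size ts)

-- WhiteForest p q b l h ts: the points l , … , h-1, labelled by p (blocks of π) and q (blocks of π′), carry
-- the planted trees ts, which have white roots and hang from the black vertex b.  The edge joining a white
-- vertex to its black parent is numbered before all edges below it, the edge joining a black vertex to its
-- white parent after them.  A vertex is named by the least element of its block.
mutual
  data WhiteForest (p q : ℕ → ℕ) (b : ℕ) : ℕ → ℕ → List Tree → Set where
    []   : ∀ {l} → WhiteForest p q b l l []
    cons : ∀ {l r h us ts} → p l ≡ b → q l ≡ l →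
           BlackForest p q l (suc l) r us → WhiteForest p q b r h ts →
           WhiteForest p q b l h (node us ∷ ts)

  data BlackForest (p q : ℕ → ℕ) (w : ℕ) : ℕ → ℕ → List Tree → Set where
    []   : ∀ {l} → BlackForest p q w l l []
    cons : ∀ {l m h us ts} → WhiteForest p q l l m us → p m ≡ l → q m ≡ w →
           BlackForest p q w (suc m) h ts →
           BlackForest p q w l h (node us ∷ ts)

module _ {p q : ℕ → ℕ} where
  private
    WF = WhiteForest p q
    BF = BlackForest p q

  mutual
    white-end : ∀ {b l h ts} → WF b l h ts → h ≡ l + size ts
    white-end {l = l} [] = sym (+-identityʳ l)
    white-end {l = l} (cons {us = us} {ts = ts} _ _ B W) =
      trans (white-end W) (trans (cong (_+ size ts) (black-end B))
        (trans (+-assoc (suc l) (size us) (size ts)) (sym (+-suc l _))))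

    black-end : ∀ {w l h ts} → BF w l h ts → h ≡ l + size ts
    black-end {l = l} [] = sym (+-identityʳ l)
    black-end {l = l} (cons {us = us} {ts = ts} W _ _ B) =
      trans (black-end B) (trans (cong (λ z → suc z + size ts) (white-end W))
        (trans (cong suc (+-assoc l (size us) (size ts))) (sym (+-suc l _))))

  white-≤ : ∀ {b l h ts} → WF b l h ts → l ≤ h
  white-≤ {l = l} W = subst (l ≤_) (sym (white-end W)) (m≤m+n _ _)

  black-≤ : ∀ {w l h ts} → BF w l h ts → l ≤ h
  black-≤ {l = l} B = subst (l ≤_) (sym (black-end B)) (m≤m+n _ _)

  white-first : ∀ {b l h ts} → WF b l h ts → l < h → p l ≡ b
  white-first [] l<l = ⊥-elim (<-irrefl refl l<l)
  white-first (cons pl _ _ _) _ = pl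

  -- A black vertex with children has `l` as the edge to its first child; a black leaf has only its
  -- parent edge, and then `m` is `l`.
  white-closed-first : ∀ {l m ts} → WF l l m ts → p m ≡ l → p l ≡ l
  white-closed-first [] pm = pm
  white-closed-first (cons pl _ _ _) _ = pl

  mutual
    -- The bound `l < p x` is strict because `l` itself bears the label `b`. With `b ≤ l` it
    -- separates the block of the parent from the blocks that begin inside the forest.
    white-label : ∀ {b l h ts} → WF b l h ts → b ≤ l → ∀ {x} → l ≤ x → x < h →
                  p x ≡ b ⊎ (l < p x × p x ≤ x × p (p x) ≡ p x)
    white-label [] _ l≤x x<l = ⊥-elim (<⇒≱ x<l l≤x)
    white-label {l = l} (cons {r = r} pl _ B W) b≤l {x} l≤x x<h with <-≤-connex x r
    ... | inj₂ r≤x with white-label W (≤-trans b≤l (<⇒≤ (black-≤ B))) r≤x x<h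
    ...   | inj₁ e = inj₁ e
    ...   | inj₂ (r<px , rest) = inj₂ (<-trans (black-≤ B) r<px , rest)
    white-label {l = l} (cons {r = r} pl _ B W) b≤l {x} l≤x x<h | inj₁ x<r with m≤n⇒m<n∨m≡n l≤x
    ... | inj₂ refl = inj₁ pl
    ... | inj₁ l<x  = inj₂ (black-label B l<x x<r)

    black-label : ∀ {w l h ts} → BF w l h ts → ∀ {x} → l ≤ x → x < h →
                  l ≤ p x × p x ≤ x × p (p x) ≡ p x
    black-label [] l≤x x<l = ⊥-elim (<⇒≱ x<l l≤x)
    black-label {l = l} (cons {m = m} W pm _ B) {x} l≤x x<h with <-cmp x m
    ... | tri> _ _ m<x with black-label B m<x x<h
    ...   | (m<px , rest) = ≤-trans (white-≤ W) (<⇒≤ m<px) , rest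
    black-label {l = l} (cons {m = m} W pm _ B) {x} l≤x x<h | tri≈ _ refl _
      rewrite pm = ≤-refl , l≤x , white-closed-first W pm
    black-label {l = l} (cons {m = m} W pm _ B) {x} l≤x x<h | tri< x<m _ _
      with white-label W ≤-refl l≤x x<m
    ... | inj₁ e rewrite e = ≤-refl , l≤x , white-closed-first W pm
    ... | inj₂ (l<px , rest) = <⇒≤ l<px , rest

  mutual
    -- For π′ the roles are exchanged: a white vertex opens its block with its parent edge, so every
    -- block of π′ met by a white forest begins in it, whereas a black forest may also meet the
    -- block of its parent `w`.
    white-dual-label : ∀ {b l h ts} → WF b l h ts → ∀ {x} → l ≤ x → x < h →
                       l ≤ q x × q x ≤ x × q (q x) ≡ q x
    white-dual-label [] l≤x x<l = ⊥-elim (<⇒≱ x<l l≤x)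
    white-dual-label {l = l} (cons {r = r} _ ql B W) {x} l≤x x<h with <-≤-connex x r
    ... | inj₂ r≤x with white-dual-label W r≤x x<h
    ...   | (r≤qx , rest) = ≤-trans (<⇒≤ (black-≤ B)) r≤qx , rest
    white-dual-label {l = l} (cons {r = r} _ ql B W) {x} l≤x x<h | inj₁ x<r with m≤n⇒m<n∨m≡n l≤x
    ... | inj₂ refl = ≤-reflexive (sym ql) , ≤-reflexive ql , cong q ql
    ... | inj₁ l<x with black-dual-label B l<x x<r
    ...   | inj₁ e rewrite e = ≤-refl , l≤x , ql
    ...   | inj₂ (l<qx , rest) = <⇒≤ l<qx , rest

    black-dual-label : ∀ {w l h ts} → BF w l h ts → ∀ {x} → l ≤ x → x < h →
                       q x ≡ w ⊎ (l ≤ q x × q x ≤ x × q (q x) ≡ q x)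
    black-dual-label [] l≤x x<l = ⊥-elim (<⇒≱ x<l l≤x)
    black-dual-label {l = l} (cons {m = m} W _ qm B) {x} l≤x x<h with <-cmp x m
    ... | tri< x<m _ _ = inj₂ (white-dual-label W l≤x x<m)
    ... | tri≈ _ refl _ = inj₁ qm
    ... | tri> _ _ m<x with black-dual-label B m<x x<h
    ...   | inj₁ e = inj₁ e
    ...   | inj₂ (m<qx , rest) = inj₂ (≤-trans (white-≤ W) (<⇒≤ m<qx) , rest)

  mutual
    white-unique : ∀ {b l h ts ts′} → b ≤ l → WF b l h ts → WF b l h ts′ → ts ≡ ts′
    white-unique b≤l [] [] = refl
    white-unique b≤l [] (cons _ _ B W) = ⊥-elim (<-irrefl refl (<-≤-trans (black-≤ B) (white-≤ W)))
    white-unique b≤l (cons _ _ B W) [] = ⊥-elim (<-irrefl refl (<-≤-trans (black-≤ B) (white-≤ W)))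
    white-unique {b} b≤l (cons {r = r} _ _ B W) (cons {r = r′} _ _ B′ W′) with <-cmp r r′
    ... | tri≈ _ refl _ =
          cong₂ (λ us ts → node us ∷ ts) (black-unique ≤-refl B B′)
            (white-unique (≤-trans b≤l (<⇒≤ (black-≤ B))) W W′)
    ... | tri< r<r′ _ _ = ⊥-elim (first-not-inside b≤l B W B′ W′ r<r′)
    ... | tri> _ _ r′<r = ⊥-elim (first-not-inside b≤l B′ W′ B W r′<r)

    -- As the start of the next tree, `r` would bear the label `b ≤ l`; as a point strictly inside
    -- the first tree of the other forest, it would bear a label beyond `l`.
    first-not-inside : ∀ {b l r r′ h us us′ ts ts′} → b ≤ l →
      BF l (suc l) r us → WF b r h ts → BF l (suc l) r′ us′ → WF b r′ h ts′ → ¬ (r < r′)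
    first-not-inside {b} b≤l B W B′ W′ r<r′ =
      <⇒≱ (proj₁ (black-label B′ (black-≤ B) r<r′))
        (subst (_≤ _) (sym (white-first W (<-≤-trans r<r′ (white-≤ W′)))) b≤l)

    -- The first tree ends at the first point with dual label `w`, because the white forest before
    -- that point has only dual labels from `l` on, and `w < l`.
    black-unique : ∀ {w l h ts ts′} → w < l → BF w l h ts → BF w l h ts′ → ts ≡ ts′
    black-unique _ [] [] = refl
    black-unique _ [] (cons W _ _ B) = ⊥-elim (<-irrefl refl (≤-trans (s≤s (white-≤ W)) (black-≤ B)))
    black-unique _ (cons W _ _ B) [] = ⊥-elim (<-irrefl refl (≤-trans (s≤s (white-≤ W)) (black-≤ B)))
    black-unique w<l (cons {m = m} W _ qm B) (cons {m = m′} W′ _ qm′ B′) with <-cmp m m′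
    ... | tri≈ _ refl _ =
          cong₂ (λ us ts → node us ∷ ts) (white-unique ≤-refl W W′)
            (black-unique (m≤n⇒m≤1+n (≤-trans w<l (white-≤ W))) B B′)
    ... | tri< m<m′ _ _ = ⊥-elim (<⇒≱ w<l
            (subst (_ ≤_) qm (proj₁ (white-dual-label W′ (white-≤ W) m<m′))))
    ... | tri> _ _ m′<m = ⊥-elim (<⇒≱ w<l
            (subst (_ ≤_) qm′ (proj₁ (white-dual-label W (white-≤ W′) m′<m))))

-- Within [l , h), the interval (i , j] is a union of blocks of p.
Saturated : (ℕ → ℕ) → (l h i j : ℕ) → Set
Saturated p l h i j = ∀ {x y} → i < x → x ≤ j → l ≤ y → y < h → p x ≡ p y → i < y × y ≤ j

module _ {p q : ℕ → ℕ} where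
  private
    WF = WhiteForest p q
    BF = BlackForest p q

  white-label-≤ : ∀ {b l h ts} → WF b l h ts → b ≤ l → ∀ {x} → l ≤ x → x < h → p x ≤ x
  white-label-≤ W b≤l l≤x x<h with white-label W b≤l l≤x x<h
  ... | inj₁ refl = ≤-trans b≤l l≤x
  ... | inj₂ (_ , px≤x , _) = px≤x

  white-small-label : ∀ {b r h ts} → WF b r h ts → b ≤ r → ∀ {x} → r ≤ x → x < h → p x < r → p x ≡ b
  white-small-label W b≤r r≤x x<h px<r with white-label W b≤r r≤x x<h
  ... | inj₁ e = e
  ... | inj₂ (r<px , _) = ⊥-elim (<-asym px<r r<px)

  mutual
    -- Only the block of `b` can meet both the first tree and the rest. So a crossing lies in one of
    -- the two parts or satisfies `i < r ≤ j`; then `p i ≡ b`, and `r`, which has the label `b` too,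
    -- can replace `i`, which leads to a crossing in the rest.
    white-noncrossing : ∀ {b l h ts} → WF b l h ts → b ≤ l → ∀ {i j k m} →
      l ≤ i → i < j → j < k → k < m → m < h → p i ≡ p k → p j ≡ p m → p i ≡ p j
    white-noncrossing [] _ l≤i i<j j<k k<m m<h _ _ =
      ⊥-elim (<⇒≱ (<-trans i<j (<-trans j<k (<-trans k<m m<h))) l≤i)
    white-noncrossing {b} {l} W@(cons {r = r} pl ql B W′) b≤l {i} {j} {k} {m} l≤i i<j j<k k<m m<h ik jm
      with <-≤-connex j r
    ... | inj₁ j<r with black-label B (≤-trans (s≤s l≤i) i<j) j<r
    ...   | (l<pj , pj≤j , _) with <-≤-connex m r
    ...     | inj₂ r≤m = ⊥-elim (<⇒≱ (subst (l <_) (trans jm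
                (white-small-label W′ (≤-trans b≤l (<⇒≤ (black-≤ B))) r≤m m<h
                  (subst (_< r) jm (≤-<-trans pj≤j j<r)))) l<pj) b≤l)
    ...     | inj₁ m<r with m≤n⇒m<n∨m≡n l≤i
    ...       | inj₁ l<i = black-noncrossing B l<i i<j j<k k<m m<r ik jm
    ...       | inj₂ refl = ⊥-elim (<⇒≱ (proj₁ (black-label B (<-trans i<j j<k) (<-trans k<m m<r)))
                    (subst (_≤ l) (trans (sym pl) ik) b≤l))
    white-noncrossing {b} {l} W@(cons {r = r} pl ql B W′) b≤l {i} {j} {k} {m} l≤i i<j j<k k<m m<h ik jm
      | inj₂ r≤j with <-≤-connex i r
    ... | inj₂ r≤i = white-noncrossing W′ (≤-trans b≤l (<⇒≤ (black-≤ B))) r≤i i<j j<k k<m m<h ik jm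
    ... | inj₁ i<r = helper (m≤n⇒m<n∨m≡n r≤j)
      where
      j<h = <-trans j<k (<-trans k<m m<h)
      r<h = ≤-<-trans r≤j j<h
      b≤r = ≤-trans b≤l (<⇒≤ (black-≤ B))
      pk≡b : p k ≡ b
      pk≡b = white-small-label W′ b≤r (≤-trans r≤j (<⇒≤ j<k)) (<-trans k<m m<h)
               (subst (_< r) ik (≤-<-trans (white-label-≤ W b≤l l≤i (<-trans i<j j<h)) i<r))
      pr≡b = white-first W′ r<h
      helper : r < j ⊎ r ≡ j → p i ≡ p j
      helper (inj₂ refl) = trans ik (trans pk≡b (sym pr≡b))
      helper (inj₁ r<j) = trans ik (trans pk≡b (trans (sym pr≡b)
        (white-noncrossing W′ b≤r ≤-refl r<j j<k k<m m<h (trans pr≡b (sym pk≡b)) jm)))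

    -- No block of π passes over `c`, the parent edge of the first black root: labels of points up
    -- to `c` are at most `c`, those of later points are larger. If `m` is `c` itself, then
    -- `p j ≡ l`, and `l`, `i`, `j`, `k` form a crossing within the white forest below that root.
    black-noncrossing : ∀ {w l h ts} → BF w l h ts → ∀ {i j k m} →
      l ≤ i → i < j → j < k → k < m → m < h → p i ≡ p k → p j ≡ p m → p i ≡ p j
    black-noncrossing [] l≤i i<j j<k k<m m<h _ _ =
      ⊥-elim (<⇒≱ (<-trans i<j (<-trans j<k (<-trans k<m m<h))) l≤i)
    black-noncrossing {w} {l} {h} B₀@(cons {m = c} W pc qc B) {i} {j} {k} {m} l≤i i<j j<k k<m m<h ik jm
      with <-≤-connex c i
    ... | inj₁ c<i = black-noncrossing B c<i i<j j<k k<m m<h ik jm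
    ... | inj₂ i≤c = helper (<-cmp m c)
      where
      k<h = <-trans k<m m<h
      j<h = <-trans j<k k<h
      l≤j = ≤-trans l≤i (<⇒≤ i<j)
      label-≤ : ∀ {x} → l ≤ x → x < h → p x ≤ x
      label-≤ l≤x x<h = proj₁ (proj₂ (black-label B₀ l≤x x<h))
      k≤c : k ≤ c
      k≤c with <-≤-connex c k
      ... | inj₂ k≤c = k≤c
      ... | inj₁ c<k = ⊥-elim (<⇒≱ (proj₁ (black-label B c<k k<h))
              (subst (_≤ c) ik (≤-trans (label-≤ l≤i (<-trans i<j j<h)) i≤c)))
      helper : _ → p i ≡ p j
      helper (tri< m<c _ _) = white-noncrossing W ≤-refl l≤i i<j j<k k<m m<c ik jm
      helper (tri> _ _ c<m) = ⊥-elim (<⇒≱ (proj₁ (black-label B c<m m<h))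
        (subst (_≤ c) jm (≤-trans (label-≤ l≤j j<h) (≤-trans (<⇒≤ j<k) k≤c))))
      helper (tri≈ _ refl _) with m≤n⇒m<n∨m≡n l≤i
      ... | inj₂ refl = trans (white-closed-first W pc) (sym (trans jm pc))
      ... | inj₁ l<i = trans (sym (white-noncrossing W ≤-refl ≤-refl l<i i<j j<k k<m pl≡pj ik)) pl≡pj
        where
        pl≡pj : p l ≡ p j
        pl≡pj = trans (white-closed-first W pc) (sym (trans jm pc))

  mutual
    -- Saturation is relative to [l , h), but the block of `b` continues outside. The induction
    -- therefore carries along that (i , j] misses this block.
    white-saturated : ∀ {b l h ts} → WF b l h ts → b ≤ l → ∀ {i j} →
      l ≤ i → i < j → j < h → q i ≡ q j →
      (∀ {x} → i < x → x ≤ j → p x ≢ b) × Saturated p l h i j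
    white-saturated [] _ l≤i i<j j<h _ = ⊥-elim (<⇒≱ (<-trans i<j j<h) l≤i)
    white-saturated {b} {l} {h} W₀@(cons {r = r} pl ql B W) b≤l {i} {j} l≤i i<j j<h qij
      with <-≤-connex j r
    ... | inj₁ j<r = avoids , saturated
      where
      b≤r = ≤-trans b≤l (<⇒≤ (black-≤ B))
      label : ∀ {x} → i < x → x ≤ j → l < p x × p x ≤ x × p (p x) ≡ p x
      label i<x x≤j = black-label B (≤-<-trans l≤i i<x) (≤-<-trans x≤j j<r)
      avoids : ∀ {x} → i < x → x ≤ j → p x ≢ b
      avoids i<x x≤j e = <⇒≱ (subst (l <_) e (proj₁ (label i<x x≤j))) b≤l
      saturated : Saturated p l h i j
      saturated {x} {y} i<x x≤j l≤y y<h xy with <-≤-connex y r | m≤n⇒m<n∨m≡n l≤y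
      ... | inj₁ y<r | inj₁ l<y = black-saturated B ≤-refl ql l≤i i<j j<r qij i<x x≤j l<y y<r xy
      ... | inj₁ y<r | inj₂ refl = ⊥-elim (avoids i<x x≤j (trans xy pl))
      ... | inj₂ r≤y | _ = ⊥-elim (avoids i<x x≤j (trans xy
              (white-small-label W b≤r r≤y y<h
                (subst (_< r) xy (≤-<-trans (proj₁ (proj₂ (label i<x x≤j))) (≤-<-trans x≤j j<r))))))
    ... | inj₂ r≤j with <-≤-connex i r
    ...   | inj₁ i<r = ⊥-elim (<⇒≱ (≤-<-trans (proj₁ (proj₂ (white-dual-label W₀ l≤i (<-trans i<j j<h)))) i<r)
                (subst (r ≤_) (sym qij) (proj₁ (white-dual-label W r≤j j<h))))
    ...   | inj₂ r≤i with white-saturated W (≤-trans b≤l (<⇒≤ (black-≤ B))) r≤i i<j j<h qij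
    ...     | (avoids , saturated) = avoids , λ {x} {y} → saturated′ {x} {y}
      where
      b≤r = ≤-trans b≤l (<⇒≤ (black-≤ B))
      saturated′ : Saturated p l h i j
      saturated′ {x} {y} i<x x≤j l≤y y<h xy with <-≤-connex y r
      ... | inj₂ r≤y = saturated i<x x≤j r≤y y<h xy
      ... | inj₁ y<r = ⊥-elim (avoids i<x x≤j
              (white-small-label W b≤r (≤-trans r≤i (<⇒≤ i<x)) (≤-<-trans x≤j j<h)
                (subst (_< r) (sym xy) (≤-<-trans (white-label-≤ W₀ b≤l l≤y y<h) y<r))))

    black-saturated : ∀ {w o h ts} → BF w (suc o) h ts → w < suc o → q o ≡ w → ∀ {i j} →
      o ≤ i → i < j → j < h → q i ≡ q j → Saturated p (suc o) h i j
    black-saturated [] _ _ o≤i i<j j<h _ = ⊥-elim (<⇒≱ (≤-<-trans o≤i i<j) (≤-pred j<h))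
    black-saturated {w} {o} {h} B₀@(cons {m = c} W pc qc B) w<l qo {i} {j} o≤i i<j j<h qij =
      helper (<-cmp j c) (m≤n⇒m<n∨m≡n o≤i)
      where
      label-≤ : ∀ {x} → suc o ≤ x → x < h → p x ≤ x
      label-≤ l≤x x<h = proj₁ (proj₂ (black-label B₀ l≤x x<h))
      separate : ∀ {x y} → suc o ≤ x → x ≤ c → c < y → y < h → p x ≢ p y
      separate l≤x x≤c c<y y<h e = <⇒≱ (proj₁ (black-label B c<y y<h))
        (subst (_≤ c) e (≤-trans (label-≤ l≤x (≤-<-trans x≤c (<-trans c<y y<h))) x≤c))
      w<q : ∀ {x} → suc o ≤ x → x < c → w < q x
      w<q l≤x x<c = <-≤-trans w<l (proj₁ (white-dual-label W l≤x x<c))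
      helper : _ → o < i ⊎ o ≡ i → Saturated p (suc o) h i j
      helper (tri< j<c _ _) (inj₂ refl) = ⊥-elim (<-irrefl (trans (sym qo) qij) (w<q i<j j<c))
      helper (tri< j<c _ _) (inj₁ o<i) {x} {y} i<x x≤j l≤y y<h xy
        with white-saturated W ≤-refl o<i i<j j<c qij | <-cmp y c
      ... | _ , saturated | tri< y<c _ _ = saturated i<x x≤j l≤y y<c xy
      ... | avoids , _    | tri≈ _ refl _ = ⊥-elim (avoids i<x x≤j (trans xy pc))
      ... | _ , _         | tri> _ _ c<y =
            ⊥-elim (separate (<-trans o<i i<x) (≤-trans x≤j (<⇒≤ j<c)) c<y y<h xy)
      helper (tri≈ _ refl _) (inj₁ o<i) = ⊥-elim (<-irrefl (sym (trans qij qc)) (w<q o<i i<j))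
      helper (tri≈ _ refl _) (inj₂ refl) {x} {y} o<x x≤c o<y y<h xy with <-≤-connex c y
      ... | inj₂ y≤c = o<y , y≤c
      ... | inj₁ c<y = ⊥-elim (separate o<x x≤c c<y y<h xy)
      helper (tri> _ _ c<j) o≤i {x} {y} i<x x≤j o<y y<h xy with <-≤-connex i c | o≤i
      ... | inj₂ c≤i | _ with <-≤-connex c y
      ...   | inj₁ c<y = black-saturated B (m≤n⇒m≤1+n (≤-trans w<l (white-≤ W))) qc c≤i i<j j<h qij i<x x≤j c<y y<h xy
      ...   | inj₂ y≤c = ⊥-elim (separate o<y y≤c (≤-<-trans c≤i i<x) (≤-<-trans x≤j j<h) (sym xy))
      helper (tri> _ _ c<j) o≤i {x} {y} i<x x≤j o<y y<h xy | inj₁ i<c | inj₁ o<i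
        with black-dual-label B c<j j<h
      ... | inj₁ e = ⊥-elim (<-irrefl (sym (trans qij e)) (w<q o<i i<c))
      ... | inj₂ (c<qj , _) = ⊥-elim (<⇒≱ c<qj (subst (_≤ c) qij
              (≤-trans (proj₁ (proj₂ (white-dual-label W o<i i<c))) (<⇒≤ i<c))))
      helper (tri> _ _ c<j) o≤i {x} {y} i<x x≤j o<y y<h xy | inj₁ i<c | inj₂ refl
        with <-≤-connex c y | <-≤-connex c x
      ... | inj₂ y≤c | _ = o<y , ≤-trans y≤c (<⇒≤ c<j)
      ... | inj₁ c<y | inj₂ x≤c = ⊥-elim (separate i<x x≤c c<y y<h xy)
      -- Both points lie beyond `c`, and `c` belongs to the block of `w` as `o` does; so (c , j]
      -- takes the place of (o , j].
      ... | inj₁ c<y | inj₁ c<x = o<y ,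
            proj₂ (black-saturated B (m≤n⇒m≤1+n (≤-trans w<l (white-≤ W))) qc ≤-refl c<j j<h
              (trans qc (trans (sym qo) qij)) c<x x≤j c<y y<h xy)

  mutual
    -- Each further tree begins with a point of the block of `b`. As (i , j] avoids this block, `i`
    -- and `j` lie in the same tree.
    white-dual-same : ∀ {b l h ts} → WF b l h ts → ∀ {i j} → l ≤ i → i < j → j < h →
      (∀ {x} → i < x → x ≤ j → p x ≢ b) → Saturated p l h i j → q i ≡ q j
    white-dual-same [] l≤i i<j j<h _ _ = ⊥-elim (<⇒≱ (<-trans i<j j<h) l≤i)
    white-dual-same (cons {r = r} pl ql B W) {i} {j} l≤i i<j j<h avoids saturated
      with <-≤-connex j r
    ... | inj₁ j<r = black-dual-same B ql l≤i i<j j<r λ {x} {y} i<x x≤j l<y y<r →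
            saturated i<x x≤j (<⇒≤ l<y) (<-≤-trans y<r (white-≤ W))
    ... | inj₂ r≤j with <-≤-connex i r
    ...   | inj₁ i<r = ⊥-elim (avoids i<r r≤j (white-first W (≤-<-trans r≤j j<h)))
    ...   | inj₂ r≤i = white-dual-same W r≤i i<j j<h avoids λ {x} {y} i<x x≤j r≤y y<h →
              saturated i<x x≤j (≤-trans (<⇒≤ (black-≤ B)) r≤y) y<h

    -- The least point `suc o` and the last point `c` of the first black block lie both in (i , j]
    -- or both outside. So the interval stays within the forest below that block, or starts at `o`
    -- and reaches at least `c`, or starts at or after `c`.
    black-dual-same : ∀ {w o h ts} → BF w (suc o) h ts → q o ≡ w → ∀ {i j} →
      o ≤ i → i < j → j < h → Saturated p (suc o) h i j → q i ≡ q j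
    black-dual-same [] _ o≤i i<j j<h _ = ⊥-elim (<⇒≱ (≤-<-trans o≤i i<j) (≤-pred j<h))
    black-dual-same {w} {o} {h} (cons {m = c} W pc qc B) qo {i} {j} o≤i i<j j<h saturated =
      helper (<-cmp j c) (m≤n⇒m<n∨m≡n o≤i)
      where
      c<h : c < h
      c<h = black-≤ B
      l≤c : suc o ≤ c
      l≤c = white-≤ W
      pl≡l = white-closed-first W pc
      pl≡pc = trans pl≡l (sym pc)
      open-at-c : o < i → i < c → c ≤ j → ⊥
      open-at-c o<i i<c c≤j =
        <⇒≱ (proj₁ (saturated i<c c≤j ≤-refl (≤-<-trans l≤c c<h) (sym pl≡pc))) o<i
      tail-saturated : (∀ {x} → c < x → i < x) → Saturated p (suc c) h c j
      tail-saturated i<_ c<x x≤j c<y y<h xy =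
        c<y , proj₂ (saturated (i< c<x) x≤j (≤-trans l≤c (<⇒≤ c<y)) y<h xy)
      helper : _ → o < i ⊎ o ≡ i → q i ≡ q j
      helper (tri< j<c _ _) (inj₁ o<i) = white-dual-same W o<i i<j j<c
        (λ i<x x≤j e → <⇒≱ j<c (proj₂ (saturated i<x x≤j l≤c c<h (trans e (sym pc)))))
        (λ i<x x≤j l≤y y<c → saturated i<x x≤j l≤y (<-trans y<c c<h))
      helper (tri< j<c _ _) (inj₂ refl) = ⊥-elim (<⇒≱ j<c (proj₂ (saturated ≤-refl i<j l≤c c<h pl≡pc)))
      helper (tri≈ _ refl _) (inj₂ refl) = trans qo (sym qc)
      helper (tri≈ _ refl _) (inj₁ o<i) = ⊥-elim (open-at-c o<i i<j ≤-refl)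
      helper (tri> _ _ c<j) (inj₂ refl) = trans qo (trans (sym qc)
        (black-dual-same B qc ≤-refl c<j j<h (tail-saturated (<-trans l≤c))))
      helper (tri> _ _ c<j) (inj₁ o<i) with <-≤-connex i c
      ... | inj₁ i<c = ⊥-elim (open-at-c o<i i<c (<⇒≤ c<j))
      ... | inj₂ c≤i = black-dual-same B qc c≤i i<j j<h λ {x} {y} i<x x≤j c<y y<h →
              saturated i<x x≤j (≤-trans l≤c (<⇒≤ c<y)) y<h

-- A noncrossing partition with its Kreweras dual, without reference to competing partitions: the
-- last two fields are the two halves of the characterisation by saturated intervals. Only the
-- labels of points below `n` are constrained.
record DualPair (n : ℕ) (p q : ℕ → ℕ) : Set where
  field
    label-≤        : ∀ {x} → x < n → p x ≤ x
    label-idem     : ∀ {x} → x < n → p (p x) ≡ p x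
    dual-≤         : ∀ {x} → x < n → q x ≤ x
    dual-idem      : ∀ {x} → x < n → q (q x) ≡ q x
    noncrossing    : ∀ {i j k m} → i < j → j < k → k < m → m < n → p i ≡ p k → p j ≡ p m → p i ≡ p j
    dual-saturated : ∀ {i j} → i < j → j < n → q i ≡ q j → Saturated p 0 n i j
    dual-same      : ∀ {i j} → i < j → j < n → Saturated p 0 n i j → q i ≡ q j

forest⇒dualPair : ∀ {n p q ts} → WhiteForest p q 0 0 n ts → DualPair n p q
forest⇒dualPair {n} {p} {q} W = record
  { label-≤        = white-label-≤ W z≤n z≤n
  ; label-idem     = idem
  ; dual-≤         = λ x<n → proj₁ (proj₂ (white-dual-label W z≤n x<n))
  ; dual-idem      = λ x<n → proj₂ (proj₂ (white-dual-label W z≤n x<n))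
  ; noncrossing    = white-noncrossing W z≤n z≤n
  ; dual-saturated = λ i<j j<n e → proj₂ (white-saturated W z≤n z≤n i<j j<n e)
  ; dual-same      = λ {i} {j} i<j j<n saturated → white-dual-same W z≤n i<j j<n
      -- The root block contains the point 0, which lies in no interval (i , j]; hence a saturated
      -- interval misses this block.
      (λ {x} i<x x≤j e →
        let 0<n = ≤-<-trans z≤n j<n in
        n≮0 (proj₁ (saturated {x} {0} i<x x≤j z≤n 0<n (trans e (sym (white-first W 0<n))))))
      saturated
  }
  where
  idem : ∀ {x} → x < n → p (p x) ≡ p x
  idem {x} x<n with white-label W z≤n z≤n x<n
  ... | inj₁ e rewrite e = white-first W (≤-<-trans z≤n x<n)
  ... | inj₂ (_ , _ , e) = e

-- Labellings and trees determine each other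

mutual
  white-cong : ∀ {p q p′ q′ b l h ts} → (∀ {x} → l ≤ x → x < h → p x ≡ p′ x × q x ≡ q′ x) →
               WhiteForest p q b l h ts → WhiteForest p′ q′ b l h ts
  white-cong _ [] = []
  white-cong agree (cons pl ql B W) =
    cons (trans (sym (proj₁ at-l)) pl) (trans (sym (proj₂ at-l)) ql)
      (black-cong (λ l<x x<r → agree (<⇒≤ l<x) (<-≤-trans x<r (white-≤ W))) B)
      (white-cong (λ r≤x x<h → agree (≤-trans (<⇒≤ (black-≤ B)) r≤x) x<h) W)
    where at-l = agree ≤-refl (<-≤-trans (black-≤ B) (white-≤ W))

  black-cong : ∀ {p q p′ q′ w l h ts} → (∀ {x} → l ≤ x → x < h → p x ≡ p′ x × q x ≡ q′ x) →
               BlackForest p q w l h ts → BlackForest p′ q′ w l h ts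
  black-cong _ [] = []
  black-cong agree (cons W pm qm B) =
    cons (white-cong (λ l≤x x<m → agree l≤x (<-trans x<m (black-≤ B))) W)
      (trans (sym (proj₁ at-m)) pm) (trans (sym (proj₂ at-m)) qm)
      (black-cong (λ m<x x<h → agree (≤-trans (white-≤ W) (<⇒≤ m<x)) x<h) B)
    where at-m = agree (white-≤ W) (black-≤ B)

mutual
  white-determines : ∀ {p q p′ q′ b l h h′ ts} → WhiteForest p q b l h ts → WhiteForest p′ q′ b l h′ ts →
                     ∀ {x} → l ≤ x → x < h → p x ≡ p′ x × q x ≡ q′ x
  white-determines [] [] l≤x x<l = ⊥-elim (<⇒≱ x<l l≤x)
  white-determines (cons {r = r} pl ql B W) (cons pl′ ql′ B′ W′) {x} l≤x x<h
    with trans (black-end B) (sym (black-end B′)) | <-≤-connex x r | m≤n⇒m<n∨m≡n l≤x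
  ... | refl | inj₂ r≤x | _         = white-determines W W′ r≤x x<h
  ... | refl | inj₁ x<r | inj₁ l<x  = black-determines B B′ l<x x<r
  ... | refl | inj₁ x<r | inj₂ refl = trans pl (sym pl′) , trans ql (sym ql′)

  black-determines : ∀ {p q p′ q′ w l h h′ ts} → BlackForest p q w l h ts → BlackForest p′ q′ w l h′ ts →
                     ∀ {x} → l ≤ x → x < h → p x ≡ p′ x × q x ≡ q′ x
  black-determines [] [] l≤x x<l = ⊥-elim (<⇒≱ x<l l≤x)
  black-determines (cons {m = m} W pm qm B) (cons W′ pm′ qm′ B′) {x} l≤x x<h
    with trans (white-end W) (sym (white-end W′)) | <-cmp x m
  ... | refl | tri< x<m _ _  = white-determines W W′ l≤x x<m
  ... | refl | tri≈ _ refl _ = trans pm (sym pm′) , trans qm (sym qm′)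
  ... | refl | tri> _ _ m<x  = black-determines B B′ m<x x<h

opaque
  glue : ℕ → (f g : ℕ → ℕ) → ℕ → ℕ
  glue r f g x with x <? r
  ... | yes _ = f x
  ... | no _  = g x

  glue-< : ∀ {r f g x} → x < r → glue r f g x ≡ f x
  glue-< {r} {x = x} x<r with x <? r
  ... | yes _  = refl
  ... | no x≮r = ⊥-elim (x≮r x<r)

  glue-≥ : ∀ {r f g x} → r ≤ x → glue r f g x ≡ g x
  glue-≥ {r} {x = x} r≤x with x <? r
  ... | yes x<r = ⊥-elim (<⇒≱ x<r r≤x)
  ... | no _    = refl

private
  glue-mid : ∀ {r s f g h x} → r ≤ x → x < s → glue r f (glue s g h) x ≡ g x
  glue-mid r≤x x<s = trans (glue-≥ r≤x) (glue-< x<s)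

  glue-last : ∀ {r s f g h x} → r ≤ s → s ≤ x → glue r f (glue s g h) x ≡ h x
  glue-last r≤s s≤x = trans (glue-≥ (≤-trans r≤s s≤x)) (glue-≥ s≤x)

mutual
  -- The right end comes out of the construction: the labels of the first tree fix where the next
  -- one starts. The identity serves as labelling of an empty interval.
  white-realize : ∀ b l ts → ∃ λ p → ∃ λ q → ∃ λ h → WhiteForest p q b l h ts
  white-realize b l [] = (λ x → x) , (λ x → x) , l , []
  white-realize b l (node us ∷ ts) with black-realize l (suc l) us
  ... | p₁ , q₁ , r , B with white-realize b r ts
  ...   | p₂ , q₂ , h , W =
    glue (suc l) (λ _ → b) (glue r p₁ p₂) , glue (suc l) (λ _ → l) (glue r q₁ q₂) , h ,
    cons (glue-< ≤-refl) (glue-< ≤-refl)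
      (black-cong (λ l<x x<r → sym (glue-mid l<x x<r) , sym (glue-mid l<x x<r)) B)
      (white-cong (λ r≤x _ → sym (glue-last (black-≤ B) r≤x) , sym (glue-last (black-≤ B) r≤x)) W)

  black-realize : ∀ w l ts → ∃ λ p → ∃ λ q → ∃ λ h → BlackForest p q w l h ts
  black-realize w l [] = (λ x → x) , (λ x → x) , l , []
  black-realize w l (node us ∷ ts) with white-realize l l us
  ... | p₁ , q₁ , m , W with black-realize w (suc m) ts
  ...   | p₂ , q₂ , h , B =
    glue m p₁ (glue (suc m) (λ _ → l) p₂) , glue m q₁ (glue (suc m) (λ _ → w) q₂) , h ,
    cons (white-cong (λ _ x<m → sym (glue-< x<m) , sym (glue-< x<m)) W)
      (glue-mid ≤-refl ≤-refl) (glue-mid ≤-refl ≤-refl)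
      (black-cong (λ m<x _ → sym (glue-last (n≤1+n m) m<x) , sym (glue-last (n≤1+n m) m<x)) B)

-- Reading the tree off a dual pair

module _ {P : ℕ → Set} (P? : ∀ x → Dec (P x)) where

  -- The end `h` is the default answer when no point of [l , h) has the property; this matches a
  -- forest whose last tree reaches up to `h`.
  first : ∀ {l h} → l ≤ h → ∃ λ r → l ≤ r × r ≤ h × (r < h → P r) × (∀ {x} → l ≤ x → x < r → ¬ P x)
  first {l} {h} l≤h with m≤n⇒m<n∨m≡n l≤h
  first {l} {h} l≤h | inj₂ refl = l , ≤-refl , ≤-refl , (λ l<l → ⊥-elim (<-irrefl refl l<l)) , λ l≤x x<l → ⊥-elim (<⇒≱ x<l l≤x)
  first {l} {suc h} _ | inj₁ (s≤s l≤h) with first l≤h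
  ... | r , l≤r , r≤h , at-r , before with m≤n⇒m<n∨m≡n r≤h
  ...   | inj₁ r<h = r , l≤r , m≤n⇒m≤1+n r≤h , (λ _ → at-r r<h) , before
  ...   | inj₂ refl with P? h
  ...     | yes ph = h , l≤h , n≤1+n h , (λ _ → ph) , before
  ...     | no ¬ph = suc h , m≤n⇒m≤1+n l≤h , ≤-refl , (λ h<h → ⊥-elim (<-irrefl refl h<h)) , before′
    where
    before′ : ∀ {x} → l ≤ x → x < suc h → ¬ P x
    before′ l≤x (s≤s x≤h) with m≤n⇒m<n∨m≡n x≤h
    ... | inj₁ x<h  = before l≤x x<h
    ... | inj₂ refl = ¬ph

  last : ∀ {l h} → l < h → P l → ∃ λ m → l ≤ m × m < h × P m × (∀ {x} → m < x → x < h → ¬ P x)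
  last {l} {suc h} (s≤s l≤h) pl with P? h
  ... | yes ph = h , l≤h , ≤-refl , ph , λ h<x x<1+h → ⊥-elim (<⇒≱ h<x (≤-pred x<1+h))
  ... | no ¬ph with m≤n⇒m<n∨m≡n l≤h
  ...   | inj₂ refl = ⊥-elim (¬ph pl)
  ...   | inj₁ l<h with last l<h pl
  ...     | m , l≤m , m<h , pm , after = m , l≤m , m<n⇒m<1+n m<h , pm , after′
    where
    after′ : ∀ {x} → m < x → x < suc h → ¬ P x
    after′ m<x (s≤s x≤h) with m≤n⇒m<n∨m≡n x≤h
    ... | inj₁ x<h  = after m<x x<h
    ... | inj₂ refl = ¬ph

module Decompose {n p q} (D : DualPair n p q) where
  open DualPair D

  saturated-first : ∀ {o h} → suc o < n → suc o < h →
    (∀ {x z} → o < x → x < h → z < n → p x ≡ p z → o < z × z < h) → p (suc o) ≡ suc o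
  saturated-first l<n l<h saturated = ≤-antisym (label-≤ l<n)
    (proj₁ (saturated ≤-refl l<h (≤-<-trans (label-≤ l<n) l<n) (sym (label-idem l<n))))

  mutual
    -- The witness y certifies that block b is not contained in any (j , l], so that l is minimal in its block of q.
    white-decompose : ∀ f {b l h y} → h ≤ l + f → l ≤ h → h ≤ n → (l < h → p l ≡ b) →
      y < n → p y ≡ b → h ≤ y ⊎ y ≡ 0 →
      (∀ {x z} → l ≤ x → x < h → p x ≢ b → z < n → p x ≡ p z → l ≤ z × z < h) →
      ∃ λ ts → WhiteForest p q b l h ts
    white-decompose f {b} {l} {h} {y} h≤l+f l≤h h≤n pl y<n py outside saturated with m≤n⇒m<n∨m≡n l≤h
    white-decompose f h≤l+f l≤h h≤n pl y<n py outside saturated | inj₂ refl = [] , []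
    white-decompose zero {l = l} {h} h≤l+f _ h≤n pl y<n py outside saturated | inj₁ l<h =
      ⊥-elim (<⇒≱ l<h (subst (h ≤_) (+-identityʳ l) h≤l+f))
    white-decompose (suc f) {b} {l} {h} {y} h≤l+f _ h≤n pl y<n py outside saturated | inj₁ l<h
      -- The edge that plants the next tree is the next point of the block of `b`; without one, the
      -- first tree is also the last.
      with first (λ x → p x ≟ b) l<h
    ... | r , l<r , r≤h , pr , before =
      let us , B = black-decompose f (≤-trans r≤h h≤) l<r (≤-trans r≤h h≤n) ql inner
          ts , W = white-decompose f (≤-trans h≤ (+-monoˡ-≤ f l<r)) r≤h h≤n pr y<n py outside outer
      in node us ∷ ts , cons (pl l<h) ql B W
      where
      h≤ : h ≤ suc l + f
      h≤ = subst (h ≤_) (+-suc l f) h≤l+f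
      l<n = <-≤-trans l<h h≤n
      ql : q l ≡ l
      ql with m≤n⇒m<n∨m≡n (dual-≤ l<n)
      ... | inj₂ e = e
      ... | inj₁ ql<l = ⊥-elim ([ (λ h≤y → <⇒≱ l<h (≤-trans h≤y (proj₂ y∈))) , (λ y≡0 → n≮0 (subst (q l <_) y≡0 (proj₁ y∈))) ]′ outside)
        where
        y∈ : q l < y × y ≤ l
        y∈ = dual-saturated ql<l l<n (dual-idem l<n) ql<l ≤-refl z≤n y<n (trans (pl l<h) (sym py))
      inner : ∀ {x z} → l < x → x < r → z < n → p x ≡ p z → l < z × z < r
      inner {x} {z} l<x x<r z<n xz with saturated (<⇒≤ l<x) (<-≤-trans x<r r≤h) (before l<x x<r) z<n xz
      ... | l≤z , z<h with m≤n⇒m<n∨m≡n l≤z | <-cmp z r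
      ...   | inj₂ refl | _              = ⊥-elim (before l<x x<r (trans xz (pl l<h)))
      ...   | inj₁ l<z  | tri< z<r _ _   = l<z , z<r
      ...   | inj₁ l<z  | tri≈ _ refl _  = ⊥-elim (before l<x x<r (trans xz (pr z<h)))
      -- Here `l` and `r` belong to the block of `b`, so a block with points on both sides of `r`
      -- would cross it.
      ...   | inj₁ l<z  | tri> _ _ r<z   = ⊥-elim (before l<x x<r (trans
              (sym (noncrossing l<x x<r r<z z<n (trans (pl l<h) (sym (pr (<-trans r<z z<h)))) xz)) (pl l<h)))
      outer : ∀ {x z} → r ≤ x → x < h → p x ≢ b → z < n → p x ≡ p z → r ≤ z × z < h
      outer {x} {z} r≤x x<h px≢b z<n xz with saturated (≤-trans (<⇒≤ l<r) r≤x) x<h px≢b z<n xz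
      ... | l≤z , z<h with m≤n⇒m<n∨m≡n l≤z | <-≤-connex z r
      ...   | inj₂ refl | _        = ⊥-elim (px≢b (trans xz (pl l<h)))
      ...   | inj₁ l<z  | inj₂ r≤z = r≤z , z<h
      ...   | inj₁ l<z  | inj₁ z<r = ⊥-elim (<⇒≱ (proj₂ (inner l<z z<r (<-≤-trans x<h h≤n) (sym xz))) r≤x)

    -- By saturation, (o , h) is a union of blocks of π, so the block of `suc o` starts there. Its
    -- last point is the parent edge of the first black root, and the points before it form the
    -- white forest below that root. The number `f` bounds the length that remains and makes the
    -- recursion structural.
    black-decompose : ∀ f {w o h} → h ≤ suc o + f → o < h → h ≤ n → q o ≡ w →
      (∀ {x z} → o < x → x < h → z < n → p x ≡ p z → o < z × z < h) →
      ∃ λ ts → BlackForest p q w (suc o) h ts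
    black-decompose f {w} {o} {h} h≤ o<h h≤n qo saturated with m≤n⇒m<n∨m≡n o<h
    black-decompose f h≤ o<h h≤n qo saturated | inj₂ refl = [] , []
    black-decompose zero {o = o} {h} h≤ o<h h≤n qo saturated | inj₁ l<h =
      ⊥-elim (<⇒≱ l<h (subst (h ≤_) (+-identityʳ (suc o)) h≤))
    black-decompose (suc f) {w} {o} {h} h≤ o<h h≤n qo saturated | inj₁ l<h
      with last (λ x → p x ≟ suc o) l<h (saturated-first (<-≤-trans l<h h≤n) l<h saturated)
    ... | m , l≤m , m<h , pm , after =
      -- The parent edge `m` of this black vertex lies just beyond the forest of its children and is
      -- their witness.
      let us , W = white-decompose f (≤-pred (<-≤-trans m<h h≤′)) l≤m (<⇒≤ m<n) (λ _ → pl)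
                     m<n pm (inj₁ ≤-refl) inner
          ts , B = black-decompose f (≤-trans h≤′ (+-monoˡ-≤ f (s≤s l≤m))) m<h h≤n qm outer
      in node us ∷ ts , cons W pm qm B
      where
      m<n = <-≤-trans m<h h≤n
      h≤′ : h ≤ suc (suc o) + f
      h≤′ = subst (h ≤_) (+-suc (suc o) f) h≤
      pl : p (suc o) ≡ suc o
      pl = saturated-first (<-≤-trans l<h h≤n) l<h saturated
      inner : ∀ {x z} → suc o ≤ x → x < m → p x ≢ suc o → z < n → p x ≡ p z → suc o ≤ z × z < m
      inner {x} {z} l≤x x<m px≢l z<n xz with saturated l≤x (<-trans x<m m<h) z<n xz
      ... | l≤z , z<h with <-cmp z m | m≤n⇒m<n∨m≡n l≤x
      ...   | tri< z<m _ _  | _         = l≤z , z<m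
      ...   | tri≈ _ refl _ | _         = ⊥-elim (px≢l (trans xz pm))
      ...   | tri> _ _ m<z  | inj₂ refl = ⊥-elim (px≢l pl)
      ...   | tri> _ _ m<z  | inj₁ l<x  = ⊥-elim (px≢l (trans
              (sym (noncrossing l<x x<m m<z z<n (trans pl (sym pm)) xz)) pl))
      closed : ∀ {x z} → suc o ≤ x → x ≤ m → z < n → p x ≡ p z → suc o ≤ z × z ≤ m
      closed {x} {z} l≤x x≤m z<n xz with p x ≟ suc o
      ... | no px≢l with m≤n⇒m<n∨m≡n x≤m
      ...   | inj₂ refl = ⊥-elim (px≢l pm)
      ...   | inj₁ x<m  = proj₁ r , <⇒≤ (proj₂ r) where r = inner l≤x x<m px≢l z<n xz
      closed {x} {z} l≤x x≤m z<n xz | yes px≡l with saturated l≤x (≤-<-trans x≤m m<h) z<n xz | <-≤-connex m z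
      ... | l≤z , z<h | inj₂ z≤m = l≤z , z≤m
      ... | l≤z , z<h | inj₁ m<z = ⊥-elim (after m<z z<h (trans (sym xz) px≡l))
      -- The interval (o , m] is a union of blocks, so that `o` and `m` have the same dual label.
      qm : q m ≡ w
      qm = trans (sym (dual-same l≤m m<n λ {x} {y} o<x x≤m _ y<n xy → closed o<x x≤m y<n xy)) qo
      outer : ∀ {x z} → m < x → x < h → z < n → p x ≡ p z → m < z × z < h
      outer {x} {z} m<x x<h z<n xz with saturated (<-trans l≤m m<x) x<h z<n xz | <-≤-connex m z
      ... | l≤z , z<h | inj₁ m<z = m<z , z<h
      ... | l≤z , z<h | inj₂ z≤m =
            ⊥-elim (<⇒≱ m<x (proj₂ (closed l≤z z≤m (<-≤-trans x<h h≤n) (sym xz))))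

dualPair⇒forest : ∀ {n p q} → 0 < n → DualPair n p q → ∃ λ ts → WhiteForest p q 0 0 n ts
dualPair⇒forest {n} 0<n D =
  -- The root has no parent edge. The point 0 is the witness instead: it has the label of the root
  -- and lies in no interval (j , l].
  white-decompose n ≤-refl z≤n ≤-refl (λ _ → p0) 0<n p0 (inj₂ refl) (λ _ _ _ z<n _ → z≤n , z<n)
  where
  open DualPair D
  open Decompose D
  p0 = n≤0⇒n≡0 (label-≤ 0<n)

-- Kreweras duality via saturated intervals

module _ {A : Set} {P : A → Bool} where

  allB-elim : ∀ {xs} → T (allB P xs) → ∀ {x} → x ∈ xs → T (P x)
  allB-elim t (here refl) = proj₁ (to T-∧ t)
  allB-elim {y ∷ ys} t (there x∈) = allB-elim (proj₂ (to (T-∧ {P y}) t)) x∈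

  allB-intro : ∀ xs → (∀ {x} → x ∈ xs → T (P x)) → T (allB P xs)
  allB-intro [] _ = tt
  allB-intro (x ∷ xs) f = from T-∧ (f (here refl) , allB-intro xs (f ∘ there))

T-does : ∀ {A : Set} (d : Dec A) → T (does d) → A
T-does (yes a) _ = a

does-T : ∀ {A : Set} (d : Dec A) → A → T (does d)
does-T (yes _) _ = tt
does-T (no ¬a) a = ¬a a

T-not-∨ : ∀ {a b} → T (not a ∨ b) → T a → T b
T-not-∨ {true} t _ = t

not-∨-T : ∀ {a b} → (T a → T b) → T (not a ∨ b)
not-∨-T {true}  f = f tt
not-∨-T {false} f = tt

NoncrossingRel : ∀ {P : Set} → (P → ℕ) → (P → P → Bool) → Set
NoncrossingRel pos same = ∀ p q r u → pos p < pos q → pos q < pos r → pos r < pos u →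
  T (same p r) → T (same q u) → T (same p q)

module _ {P : Set} {pts : List P} {pos : P → ℕ} {same : P → P → Bool} (complete : ∀ p → p ∈ pts) where

  private
    split : ∀ {a b c e f g} → T (not (a ∧ b ∧ c ∧ e ∧ f ∧ not g)) → T a → T b → T c → T e → T f → T g
    split {true} {true} {true} {true} {true} {true} _ _ _ _ _ _ = tt

    join : ∀ {a b c e f g} → (T a → T b → T c → T e → T f → T g) → T (not (a ∧ b ∧ c ∧ e ∧ f ∧ not g))
    join {false} _ = tt
    join {true} {false} _ = tt
    join {true} {true} {false} _ = tt
    join {true} {true} {true} {false} _ = tt
    join {true} {true} {true} {true} {false} _ = tt
    join {true} {true} {true} {true} {true} {true} _ = tt
    join {true} {true} {true} {true} {true} {false} f = f tt tt tt tt tt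

  noncrossingRel-elim : T (noncrossingRel pts pos same) → NoncrossingRel pos same
  noncrossingRel-elim t p q r u pq qr ru =
    split {pos p <ᵇ pos q} {pos q <ᵇ pos r} {pos r <ᵇ pos u} {same p r} {same q u} {same p q}
      (allB-elim (allB-elim (allB-elim (allB-elim t (complete p)) (complete q)) (complete r)) (complete u))
      (<⇒<ᵇ pq) (<⇒<ᵇ qr) (<⇒<ᵇ ru)

  noncrossingRel-intro : NoncrossingRel pos same → T (noncrossingRel pts pos same)
  noncrossingRel-intro nc =
    allB-intro pts λ {p} _ → allB-intro pts λ {q} _ → allB-intro pts λ {r} _ → allB-intro pts λ {u} _ →
      join {pos p <ᵇ pos q} {pos q <ᵇ pos r} {pos r <ᵇ pos u} {same p r} {same q u} {same p q}
        (λ pq qr ru → nc p q r u (<ᵇ⇒< _ _ pq) (<ᵇ⇒< _ _ qr) (<ᵇ⇒< _ _ ru))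

-- Functions with the same values need not be equal, so the list contains `f` only up to pointwise
-- agreement.
allFuns-complete : ∀ n {m} (f : Fin n → Fin m) → ∃ λ g → g ∈ allFuns n m × (∀ i → g i ≡ f i)
allFuns-complete zero f = _ , here refl , λ ()
allFuns-complete (suc n) {m} f with allFuns-complete n (f ∘ Fin.suc)
... | g , g∈ , g≗f =
  _ , ∈-concatMap⁺ _ (Any.map (λ { refl → ∈-map⁺ _ g∈ }) (∈-allFin (f Fin.zero))) ,
  λ { Fin.zero → refl ; (Fin.suc i) → g≗f i }

module _ {n : ℕ} where

  sameBlock-elim : ∀ (f : Labelling n) {i j} → T (sameBlock f i j) → f i ≡ f j
  sameBlock-elim f = T-does (f _ Fin.≟ f _)

  sameBlock-intro : ∀ (f : Labelling n) {i j} → f i ≡ f j → T (sameBlock f i j)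
  sameBlock-intro f = does-T (f _ Fin.≟ f _)

  Canonical : Labelling n → Set
  Canonical f = ∀ i → f (f i) ≡ f i × toℕ (f i) ≤ toℕ i

  canonical-elim : ∀ f → T (isCanonical f) → Canonical f
  canonical-elim f t i with to T-∧ (allB-elim t (∈-allFin i))
  ... | e , le = T-does (f (f i) Fin.≟ f i) e , ≤ᵇ⇒≤ _ _ le

  canonical-intro : ∀ f → Canonical f → T (isCanonical f)
  canonical-intro f c = allB-intro (allFin n) λ {i} _ →
    from T-∧ (does-T (f (f i) Fin.≟ f i) (proj₁ (c i)) , ≤⇒≤ᵇ (proj₂ (c i)))

  joint-complete : ∀ (x : Fin n ⊎ Fin n) → x ∈ map inj₁ (allFin n) ++ map inj₂ (allFin n)
  joint-complete (inj₁ i) = ∈-++⁺ˡ (∈-map⁺ inj₁ (∈-allFin i))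
  joint-complete (inj₂ i) = ∈-++⁺ʳ (map inj₁ (allFin n)) (∈-map⁺ inj₂ (∈-allFin i))

  SaturatedFin : Labelling n → Fin n → Fin n → Set
  SaturatedFin π i j = ∀ {x y} → toℕ i < toℕ x → toℕ x ≤ toℕ j → π x ≡ π y → toℕ i < toℕ y × toℕ y ≤ toℕ j

  private
    even<odd : ∀ {a b} → a ≤ b → 2 * a < suc (2 * b)
    even<odd a≤b = s≤s (*-monoʳ-≤ 2 a≤b)

    odd<even : ∀ {a b} → a < b → suc (2 * a) < 2 * b
    odd<even {a} {b} a<b = ≤-trans (≤-reflexive (cong suc (sym (+-suc a (a + 0))))) (*-monoʳ-≤ 2 a<b)

    even<odd⁻¹ : ∀ {a b} → 2 * a < suc (2 * b) → a ≤ b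
    even<odd⁻¹ (s≤s h) = *-cancelˡ-≤ 2 h

    odd<even⁻¹ : ∀ {a b} → suc (2 * a) < 2 * b → a < b
    odd<even⁻¹ {a} {b} h = *-cancelˡ-< 2 a b (<-trans (n<1+n _) h)

    odd<odd⁻¹ : ∀ {a b} → suc (2 * a) < suc (2 * b) → a < b
    odd<odd⁻¹ {a} {b} (s≤s h) = *-cancelˡ-< 2 a b h

  -- If `y` lay outside (i , j], then its block, with `x` inside, would cross the pair i′, j′: in
  -- the order y, i′, x, j′ or i′, x, j′, y. Noncrossing would force a plain and a primed point into
  -- one block, which `jointSame` rules out.
  joint⇒saturated : ∀ {π τ : Labelling n} → NoncrossingRel jointPos (jointSame π τ) →
    ∀ {i j} → toℕ i < toℕ j → τ i ≡ τ j → SaturatedFin π i j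
  joint⇒saturated {π} {τ} nc {i} {j} i<j τij {x} {y} i<x x≤j xy = i<y , y≤j
    where
    i<y : toℕ i < toℕ y
    i<y with <-≤-connex (toℕ i) (toℕ y)
    ... | inj₁ i<y = i<y
    ... | inj₂ y≤i = ⊥-elim (nc (inj₁ y) (inj₂ i) (inj₁ x) (inj₂ j) (even<odd y≤i) (odd<even i<x) (even<odd x≤j)
            (sameBlock-intro π (sym xy)) (sameBlock-intro τ τij))
    y≤j : toℕ y ≤ toℕ j
    y≤j with <-≤-connex (toℕ j) (toℕ y)
    ... | inj₂ y≤j = y≤j
    ... | inj₁ j<y = ⊥-elim (nc (inj₂ i) (inj₁ x) (inj₂ j) (inj₁ y) (odd<even i<x) (even<odd x≤j) (odd<even j<y)
            (sameBlock-intro τ τij) (sameBlock-intro π xy))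

  -- Related points are both plain or both primed, which leaves four patterns: two within one
  -- partition, and two alternating ones in which a block of π has points inside and outside a
  -- saturated interval.
  saturated⇒joint : ∀ {π τ : Labelling n} →
    NoncrossingRel toℕ (sameBlock π) → NoncrossingRel toℕ (sameBlock τ) →
    (∀ {i j} → toℕ i < toℕ j → τ i ≡ τ j → SaturatedFin π i j) →
    NoncrossingRel jointPos (jointSame π τ)
  saturated⇒joint ncπ ncτ sat (inj₁ a) (inj₁ b) (inj₁ c) (inj₁ d) ab bc cd ac bd =
    ncπ a b c d (*-cancelˡ-< 2 _ _ ab) (*-cancelˡ-< 2 _ _ bc) (*-cancelˡ-< 2 _ _ cd) ac bd
  saturated⇒joint ncπ ncτ sat (inj₂ a) (inj₂ b) (inj₂ c) (inj₂ d) ab bc cd ac bd =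
    ncτ a b c d (odd<odd⁻¹ ab) (odd<odd⁻¹ bc) (odd<odd⁻¹ cd) ac bd
  saturated⇒joint {π} {τ} ncπ ncτ sat (inj₁ a) (inj₂ b) (inj₁ c) (inj₂ d) ab bc cd ac bd =
    <⇒≱ (proj₁ (sat (<-≤-trans b<c c≤d) (sameBlock-elim τ bd) {c} {a} b<c c≤d (sym (sameBlock-elim π ac))))
      (even<odd⁻¹ ab)
    where b<c = odd<even⁻¹ bc
          c≤d = even<odd⁻¹ cd
  saturated⇒joint {π} {τ} ncπ ncτ sat (inj₂ a) (inj₁ b) (inj₂ c) (inj₁ d) ab bc cd ac bd =
    <⇒≱ (odd<even⁻¹ cd)
      (proj₂ (sat (<-≤-trans a<b b≤c) (sameBlock-elim τ ac) {b} {d} a<b b≤c (sameBlock-elim π bd)))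
    where a<b = odd<even⁻¹ ab
          b≤c = even<odd⁻¹ bc

  -- The partition τ whose only nontrivial block is {i , j} competes in the coarsest-partition condition as soon
  -- as (i , j] is saturated.
  module _ {i j : Fin n} (i<j : toℕ i < toℕ j) {τ : Labelling n}
           (τj : τ j ≡ i) (τ-id : ∀ {k} → k ≢ j → τ k ≡ k) where

    private
      i≢j : i ≢ j
      i≢j refl = <-irrefl refl i<j

      merge-block : ∀ {a b} → toℕ a < toℕ b → τ a ≡ τ b → a ≡ i × b ≡ j
      merge-block {a} {b} a<b e with a Fin.≟ j | b Fin.≟ j
      ... | yes refl | yes refl = ⊥-elim (<-irrefl refl a<b)
      ... | yes refl | no b≢j = ⊥-elim (<-asym i<j (subst (λ z → toℕ a < toℕ z) (sym (trans (sym τj) (trans e (τ-id b≢j)))) a<b))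
      ... | no a≢j | yes refl = trans (sym (τ-id a≢j)) (trans e τj) , refl
      ... | no a≢j | no b≢j = ⊥-elim (<-irrefl (cong toℕ (trans (sym (τ-id a≢j)) (trans e (τ-id b≢j)))) a<b)

    merge-canonical : Canonical τ
    merge-canonical k with k Fin.≟ j
    ... | yes refl = trans (cong τ τj) (trans (τ-id i≢j) (sym τj)) , subst (λ z → toℕ z ≤ toℕ k) (sym τj) (<⇒≤ i<j)
    ... | no k≢j = cong τ (τ-id k≢j) , ≤-reflexive (cong toℕ (τ-id k≢j))

    merge-joint : ∀ {π} → NoncrossingRel toℕ (sameBlock π) → SaturatedFin π i j →
                  NoncrossingRel jointPos (jointSame π τ)
    merge-joint {π} ncπ sat = saturated⇒joint ncπ ncτ sat′
      where
      ncτ : NoncrossingRel toℕ (sameBlock τ)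
      ncτ a b c d ab bc cd ac bd with merge-block (<-trans ab bc) (sameBlock-elim τ ac) | merge-block (<-trans bc cd) (sameBlock-elim τ bd)
      ... | refl , _ | refl , _ = ⊥-elim (<-irrefl refl ab)
      sat′ : ∀ {a b} → toℕ a < toℕ b → τ a ≡ τ b → SaturatedFin π a b
      sat′ a<b e with merge-block a<b e
      ... | refl , refl = sat

  record DualPairFin (π σ : Labelling n) : Set where
    field
      canonical       : Canonical π
      dual-canonical  : Canonical σ
      noncrossing     : NoncrossingRel toℕ (sameBlock π)
      dual-saturated  : ∀ {i j} → toℕ i < toℕ j → σ i ≡ σ j → SaturatedFin π i j
      dual-same       : ∀ {i j} → toℕ i < toℕ j → SaturatedFin π i j → σ i ≡ σ j

  kreweras⇒dualPairFin : ∀ {π σ} → T (isCanonical π) → T (isNoncrossing π) → T (isKrewerasDual π σ) → DualPairFin π σ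
  kreweras⇒dualPairFin {π} {σ} cπ nπ k = record
    { canonical      = canonical-elim π cπ
    ; dual-canonical = canonical-elim σ cσ
    ; noncrossing    = ncπ
    ; dual-saturated = joint⇒saturated {π} {σ} (noncrossingRel-elim joint-complete joint)
    ; dual-same      = same
    }
    where
    cσ = proj₁ (to (T-∧ {isCanonical σ}) k)
    rest = proj₂ (to (T-∧ {isCanonical σ}) k)
    joint = proj₁ (to (T-∧ {jointNoncrossing π σ}) rest)
    coarsest = proj₂ (to (T-∧ {jointNoncrossing π σ}) rest)
    ncπ = noncrossingRel-elim {same = sameBlock π} ∈-allFin nπ
    same : ∀ {i j} → toℕ i < toℕ j → SaturatedFin π i j → σ i ≡ σ j
    -- The competitor must come from `allFuns`; its member `τ` has the same values as `merge`.
    same {i} {j} i<j sat with allFuns-complete n merge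
      where
      merge : Labelling n
      merge k = if does (k Fin.≟ j) then i else k
    ... | τ , τ∈ , τ≗ = sameBlock-elim σ (T-not-∨ {sameBlock τ i j} (allB-elim (allB-elim refined (∈-allFin i)) (∈-allFin j))
            (sameBlock-intro τ (trans (τ-id i≢j) (sym τj))))
      where
      i≢j : i ≢ j
      i≢j refl = <-irrefl refl i<j
      τj : τ j ≡ i
      τj with j Fin.≟ j | τ≗ j
      ... | yes _ | e = e
      ... | no j≢j | _ = ⊥-elim (j≢j refl)
      τ-id : ∀ {k} → k ≢ j → τ k ≡ k
      τ-id {k} k≢j with k Fin.≟ j | τ≗ k
      ... | yes k≡j | _ = ⊥-elim (k≢j k≡j)
      ... | no _ | e = e
      refined : T (refines τ σ)
      refined = T-not-∨ {isCanonical τ ∧ jointNoncrossing π τ} (allB-elim coarsest τ∈)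
        (from T-∧ (canonical-intro τ (merge-canonical i<j τj τ-id) ,
                   noncrossingRel-intro joint-complete (merge-joint i<j τj τ-id {π} ncπ sat)))

  module _ {π σ : Labelling n} (D : DualPairFin π σ) where
    open DualPairFin D

    private
      -- For a crossing, (a , c] and (b , d] are saturated, hence so is their difference (a , b],
      -- and this puts `a` and `b` into one block.
      σ-noncrossing : NoncrossingRel toℕ (sameBlock σ)
      σ-noncrossing a b c d ab bc cd ac bd = sameBlock-intro σ (dual-same ab sat)
        where
        sat : SaturatedFin π a b
        sat {x} {y} a<x x≤b xy with dual-saturated (<-trans ab bc) (sameBlock-elim σ ac) {x} {y} a<x (≤-trans x≤b (<⇒≤ bc)) xy
        ... | a<y , y≤c with <-≤-connex (toℕ b) (toℕ y)
        ...   | inj₂ y≤b = a<y , y≤b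
        ...   | inj₁ b<y = ⊥-elim (<⇒≱ (proj₁ (dual-saturated (<-trans bc cd) (sameBlock-elim σ bd) {y} {x} b<y
                  (≤-trans y≤c (<⇒≤ cd)) (sym xy))) x≤b)

      refine : ∀ τ → T (isCanonical τ ∧ jointNoncrossing π τ) → T (refines τ σ)
      refine τ t = allB-intro (allFin n) λ {i} _ → allB-intro (allFin n) λ {j} _ →
        not-∨-T {sameBlock τ i j} λ s → sameBlock-intro σ (same (sameBlock-elim τ s))
        where
        nc = noncrossingRel-elim {same = jointSame π τ} joint-complete (proj₂ (to (T-∧ {isCanonical τ}) t))
        same : ∀ {i j} → τ i ≡ τ j → σ i ≡ σ j
        same {i} {j} e with <-cmp (toℕ i) (toℕ j)
        ... | tri< i<j _ _ = dual-same i<j (joint⇒saturated {π} {τ} nc i<j e)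
        ... | tri≈ _ i≡j _ = cong σ (Fin.toℕ-injective i≡j)
        ... | tri> _ _ j<i = sym (dual-same j<i (joint⇒saturated {π} {τ} nc j<i (sym e)))

    dualPairFin⇒kreweras : T (isCanonical π) × T (isNoncrossing π) × T (isKrewerasDual π σ)
    dualPairFin⇒kreweras =
      canonical-intro π canonical ,
      noncrossingRel-intro ∈-allFin noncrossing ,
      from T-∧ (canonical-intro σ dual-canonical ,
        from T-∧ (noncrossingRel-intro joint-complete
                    (saturated⇒joint {π} {σ} noncrossing σ-noncrossing dual-saturated) ,
          allB-intro (allFuns n n) λ {τ} _ → not-∨-T {isCanonical τ ∧ jointNoncrossing π τ} (refine τ)))

-- Transfer between `Fin n` and the interval [0 , n)

module _ {n : ℕ} where

  -- Only the values below `n` matter; the identity fills the rest.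
  extend : Labelling n → ℕ → ℕ
  extend f x with x <? n
  ... | yes x<n = toℕ (f (fromℕ< x<n))
  ... | no _    = x

  extend-toℕ : ∀ f i → extend f (toℕ i) ≡ toℕ (f i)
  extend-toℕ f i with toℕ i <? n
  ... | yes i<n = cong (λ j → toℕ (f j)) (Fin.fromℕ<-toℕ i i<n)
  ... | no i≮n  = ⊥-elim (i≮n (Fin.toℕ<n i))

  point : ∀ {x} → x < n → ∃ λ (i : Fin n) → toℕ i ≡ x
  point x<n = fromℕ< x<n , Fin.toℕ-fromℕ< x<n

  private
    label-≡ : ∀ (f : Labelling n) {i j} → f i ≡ f j → extend f (toℕ i) ≡ extend f (toℕ j)
    label-≡ f {i} {j} e = trans (extend-toℕ f i) (trans (cong toℕ e) (sym (extend-toℕ f j)))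

    label-≡⁻¹ : ∀ (f : Labelling n) {i j} → extend f (toℕ i) ≡ extend f (toℕ j) → f i ≡ f j
    label-≡⁻¹ f {i} {j} e = Fin.toℕ-injective (trans (sym (extend-toℕ f i)) (trans e (extend-toℕ f j)))

  module _ {π σ : Labelling n} where

    private
      saturated-fin : ∀ {i j} → Saturated (extend π) 0 n (toℕ i) (toℕ j) → SaturatedFin π i j
      saturated-fin sat {x} {y} i<x x≤j xy = sat i<x x≤j z≤n (Fin.toℕ<n y) (label-≡ π xy)

      saturated-ext : ∀ {i j} → SaturatedFin π i j → Saturated (extend π) 0 n (toℕ i) (toℕ j)
      saturated-ext {i} {j} sat i<x x≤j _ y<n xy with point (≤-<-trans x≤j (Fin.toℕ<n j)) | point y<n
      ... | x , refl | y , refl = sat {x} {y} i<x x≤j (label-≡⁻¹ π xy)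

      canonical-ext-≤ : ∀ {f} → Canonical f → ∀ {x} → x < n → extend f x ≤ x
      canonical-ext-≤ {f} c x<n with point x<n
      ... | i , refl = subst (_≤ toℕ i) (sym (extend-toℕ f i)) (proj₂ (c i))

      canonical-ext-idem : ∀ {f} → Canonical f → ∀ {x} → x < n → extend f (extend f x) ≡ extend f x
      canonical-ext-idem {f} c x<n with point x<n
      ... | i , refl = trans (cong (extend f) (extend-toℕ f i)) (label-≡ f (proj₁ (c i)))

      canonical-fin : ∀ {f} → (∀ {x} → x < n → extend f x ≤ x) →
                      (∀ {x} → x < n → extend f (extend f x) ≡ extend f x) → Canonical f
      canonical-fin {f} le idem i =
        label-≡⁻¹ f (trans (cong (extend f) (sym (extend-toℕ f i))) (idem (Fin.toℕ<n i))) ,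
        subst (_≤ toℕ i) (extend-toℕ f i) (le (Fin.toℕ<n i))

    dualPairFin⇒dualPair : DualPairFin π σ → DualPair n (extend π) (extend σ)
    dualPairFin⇒dualPair D = record
      { label-≤        = canonical-ext-≤ canonical
      ; label-idem     = canonical-ext-idem canonical
      ; dual-≤         = canonical-ext-≤ dual-canonical
      ; dual-idem      = canonical-ext-idem dual-canonical
      ; noncrossing    = nc
      ; dual-saturated = sat
      ; dual-same      = same
      }
      where
      open DualPairFin D
      nc : ∀ {i j k m} → i < j → j < k → k < m → m < n → extend π i ≡ extend π k →
           extend π j ≡ extend π m → extend π i ≡ extend π j
      nc i<j j<k k<m m<n ik jm
        with point m<n | point (<-trans k<m m<n) | point (<-trans j<k (<-trans k<m m<n))
           | point (<-trans i<j (<-trans j<k (<-trans k<m m<n)))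
      ... | m , refl | k , refl | j , refl | i , refl =
        label-≡ π (sameBlock-elim π (noncrossing i j k m i<j j<k k<m
          (sameBlock-intro π (label-≡⁻¹ π ik)) (sameBlock-intro π (label-≡⁻¹ π jm))))
      sat : ∀ {i j} → i < j → j < n → extend σ i ≡ extend σ j → Saturated (extend π) 0 n i j
      sat i<j j<n e with point j<n | point (<-trans i<j j<n)
      ... | j , refl | i , refl = saturated-ext {i} {j} (dual-saturated i<j (label-≡⁻¹ σ e))
      same : ∀ {i j} → i < j → j < n → Saturated (extend π) 0 n i j → extend σ i ≡ extend σ j
      same i<j j<n s with point j<n | point (<-trans i<j j<n)
      ... | j , refl | i , refl = label-≡ σ (dual-same i<j (saturated-fin {i} {j} s))

    dualPair⇒dualPairFin : DualPair n (extend π) (extend σ) → DualPairFin π σ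
    dualPair⇒dualPairFin D = record
      { canonical      = canonical-fin label-≤ label-idem
      ; dual-canonical = canonical-fin dual-≤ dual-idem
      ; noncrossing    = λ i j k m i<j j<k k<m ik jm → sameBlock-intro π (label-≡⁻¹ π
          (noncrossing i<j j<k k<m (Fin.toℕ<n m) (label-≡ π (sameBlock-elim π ik)) (label-≡ π (sameBlock-elim π jm))))
      ; dual-saturated = λ {i} {j} i<j e → saturated-fin {i} {j} (dual-saturated i<j (Fin.toℕ<n j) (label-≡ σ e))
      ; dual-same      = λ {i} {j} i<j s → label-≡⁻¹ σ (dual-same i<j (Fin.toℕ<n j) (saturated-ext {i} {j} s))
      }
      where open DualPair D

  -- The root of the tree is the block of the first point, with label 0. As it has no parent edge,
  -- all of [0 , n) is a white forest that hangs from it.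
  Encodes : Labelling n × Labelling n → List Tree → Set
  Encodes (π , σ) = WhiteForest (extend π) (extend σ) 0 0 n

  encodes-pointwise : ∀ {π σ π′ σ′ ts} → Encodes (π , σ) ts → Encodes (π′ , σ′) ts → (∀ i → π i ≡ π′ i) × (∀ i → σ i ≡ σ′ i)
  encodes-pointwise {π} {σ} {π′} {σ′} E E′ = (λ i → fin π π′ (proj₁ (at i))) , (λ i → fin σ σ′ (proj₂ (at i)))
    where
    at : ∀ i → _
    at i = white-determines E E′ z≤n (Fin.toℕ<n i)
    fin : ∀ f g {i} → extend f (toℕ i) ≡ extend g (toℕ i) → f i ≡ g i
    fin f g {i} e = Fin.toℕ-injective (trans (sym (extend-toℕ f i)) (trans e (extend-toℕ g i)))

  encodes-resp : ∀ {π σ π′ σ′ ts} → (∀ i → π i ≡ π′ i) → (∀ i → σ i ≡ σ′ i) → Encodes (π , σ) ts → Encodes (π′ , σ′) ts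
  encodes-resp {π} {σ} {π′} {σ′} πe σe = white-cong λ _ x<n → agree πe x<n , agree σe x<n
    where
    agree : ∀ {f g : Labelling n} → (∀ i → f i ≡ g i) → ∀ {x} → x < n → extend f x ≡ extend g x
    agree {f} {g} e x<n with point x<n
    ... | i , refl = trans (extend-toℕ f i) (trans (cong toℕ (e i)) (sym (extend-toℕ g i)))

  -- No label exceeds its point, so labels of points below `n` are again elements of `Fin n`.
  encode : ∀ ts → size ts ≡ n → ∃ λ π → ∃ λ σ → Encodes (π , σ) ts
  encode ts sz with white-realize 0 0 ts
  ... | p , q , h , W with trans (white-end W) sz
  ...   | refl = restrict p label-≤ , restrict q dual-≤ ,
                 white-cong (λ _ x<n → agree p label-≤ x<n , agree q dual-≤ x<n) W
    where
    open DualPair (forest⇒dualPair W)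
    restrict : ∀ f → (∀ {x} → x < n → f x ≤ x) → Labelling n
    restrict f le i = fromℕ< (≤-<-trans (le (Fin.toℕ<n i)) (Fin.toℕ<n i))
    agree : ∀ f (le : ∀ {x} → x < n → f x ≤ x) {x} → x < n → f x ≡ extend (restrict f le) x
    agree f le x<n with point x<n
    ... | i , refl = sym (trans (extend-toℕ (restrict f le) i) (Fin.toℕ-fromℕ< _))

-- Products over blocks

module RangeFold {c ℓ} (M : CommutativeMonoid c ℓ) where
  open CommutativeMonoid M renaming (refl to ≈-refl; sym to ≈-sym; trans to ≈-trans)

  foldFrom : (ℕ → Carrier) → ℕ → ℕ → Carrier
  foldFrom F l zero    = ε
  foldFrom F l (suc k) = F l ∙ foldFrom F (suc l) k

  foldRange : (ℕ → Carrier) → ℕ → ℕ → Carrier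
  foldRange F l h = foldFrom F l (h ∸ l)

  module _ {F : ℕ → Carrier} where

    foldFrom-+ : ∀ l j k → foldFrom F l (j + k) ≈ foldFrom F l j ∙ foldFrom F (l + j) k
    foldFrom-+ l zero k rewrite +-identityʳ l = ≈-sym (identityˡ _)
    foldFrom-+ l (suc j) k rewrite +-suc l j = ≈-trans (∙-congˡ (foldFrom-+ (suc l) j k)) (≈-sym (assoc _ _ _))

    foldRange-split : ∀ {l r h} → l ≤ r → r ≤ h → foldRange F l h ≈ foldRange F l r ∙ foldRange F r h
    foldRange-split {l} {r} {h} l≤r r≤h =
      ≡.subst₂ (λ k s → foldFrom F l k ≈ foldRange F l r ∙ foldFrom F s (h ∸ r)) ks (m+[n∸m]≡n l≤r)
        (foldFrom-+ l (r ∸ l) (h ∸ r))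
      where
      ks : (r ∸ l) + (h ∸ r) ≡ h ∸ l
      ks = trans (sym (+-∸-comm (h ∸ r) l≤r)) (cong (_∸ l) (m+[n∸m]≡n r≤h))

    foldRange-cons : ∀ {l h} → l < h → foldRange F l h ≈ F l ∙ foldRange F (suc l) h
    foldRange-cons {l} l<h = reflexive (cong (foldFrom F l) (+-∸-assoc 1 l<h))

    foldRange-empty : ∀ l → foldRange F l l ≈ ε
    foldRange-empty l rewrite n∸n≡0 l = ≈-refl

    foldFrom-ε : ∀ l k → (∀ {x} → l ≤ x → x < l + k → F x ≈ ε) → foldFrom F l k ≈ ε
    foldFrom-ε l zero _ = ≈-refl
    foldFrom-ε l (suc k) f = ≈-trans (∙-cong (f ≤-refl (m<m+n l (s≤s z≤n)))
      (foldFrom-ε (suc l) k (λ {x} l<x x< → f (<⇒≤ l<x) (subst (x <_) (sym (+-suc l k)) x<)))) (identityˡ ε)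

    foldRange-ε : ∀ {l h} → l ≤ h → (∀ {x} → l ≤ x → x < h → F x ≈ ε) → foldRange F l h ≈ ε
    foldRange-ε {l} {h} l≤h f = foldFrom-ε l (h ∸ l) (λ {x} l≤x x< → f l≤x (subst (x <_) (m+[n∸m]≡n l≤h) x<))

module ℕFold = RangeFold +-0-commutativeMonoid

indicator : (ℕ → ℕ) → ℕ → ℕ → ℕ
indicator p v x = if does (p x ≟ v) then 1 else 0

count : (ℕ → ℕ) → ℕ → ℕ → ℕ → ℕ
count p v = ℕFold.foldRange (indicator p v)

indicator-≡ : ∀ {p v x} → p x ≡ v → indicator p v x ≡ 1
indicator-≡ {p} {v} {x} e = cong (λ t → if t then 1 else 0) (dec-true (p x ≟ v) e)

indicator-≢ : ∀ {p v x} → p x ≢ v → indicator p v x ≡ 0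
indicator-≢ {p} {v} {x} ne = cong (λ t → if t then 1 else 0) (dec-false (p x ≟ v) ne)

count-none : ∀ {p v l h} → l ≤ h → (∀ {x} → l ≤ x → x < h → p x ≢ v) → count p v l h ≡ 0
count-none {p} l≤h f = ℕFold.foldRange-ε l≤h λ l≤x x<h → indicator-≢ {p} (f l≤x x<h)

count-restrict : ∀ {p v l l′ h′ h} → l ≤ l′ → l′ ≤ h′ → h′ ≤ h →
  (∀ {x} → l ≤ x → x < l′ → p x ≢ v) → (∀ {x} → h′ ≤ x → x < h → p x ≢ v) → count p v l h ≡ count p v l′ h′
count-restrict {p} {v} {l} {l′} {h′} {h} a b c before after = begin
  count p v l h                                      ≡⟨ ℕFold.foldRange-split a (≤-trans b c) ⟩
  count p v l l′ + count p v l′ h                    ≡⟨ cong₂ _+_ (count-none a before) (ℕFold.foldRange-split b c) ⟩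
  count p v l′ h′ + count p v h′ h                   ≡⟨ cong (count p v l′ h′ +_) (count-none c after) ⟩
  count p v l′ h′ + 0                                ≡⟨ +-identityʳ _ ⟩
  count p v l′ h′                                    ∎
  where open ≡.≡-Reasoning

module _ {p q : ℕ → ℕ} where

  -- Each tree meets the block of `b` in one point, the edge that plants it. The parent edge of `b`,
  -- if there is one, lies outside [l , h) and is not counted.
  white-degree : ∀ {b l h ts} → WhiteForest p q b l h ts → b ≤ l → count p b l h ≡ length ts
  white-degree {l = l} [] _ = ℕFold.foldRange-empty l
  white-degree {b} {l} {h} (cons {r = r} pl _ B W) b≤l =
    trans (ℕFold.foldRange-cons (<-≤-trans (black-≤ B) (white-≤ W)))
      (cong₂ _+_ (indicator-≡ {p} pl)
        (trans (count-restrict (black-≤ B) (white-≤ W) ≤-refl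
                 (λ l<x x<r e → <⇒≱ (proj₁ (black-label B l<x x<r)) (subst (_≤ l) (sym e) b≤l))
                 (λ h≤x x<h → ⊥-elim (<⇒≱ x<h h≤x)))
          (white-degree W (≤-trans b≤l (<⇒≤ (black-≤ B))))))

  black-degree : ∀ {w l h ts} → BlackForest p q w l h ts → w < l → count q w l h ≡ length ts
  black-degree {l = l} [] _ = ℕFold.foldRange-empty l
  black-degree {w} {l} {h} (cons {m = m} W _ qm B) w<l =
    trans (count-restrict (white-≤ W) (<⇒≤ (black-≤ B)) ≤-refl
            (λ l≤x x<m e → <⇒≱ w<l (subst (l ≤_) e (proj₁ (white-dual-label W l≤x x<m))))
            (λ h≤x x<h → ⊥-elim (<⇒≱ x<h h≤x)))
      (trans (ℕFold.foldRange-cons (black-≤ B))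
        (cong₂ _+_ (indicator-≡ {q} qm) (black-degree B (m≤n⇒m≤1+n (≤-trans w<l (white-≤ W))))))

  white-dual-degree : ∀ {b l h us ts} → WhiteForest p q b l h (node us ∷ ts) → count q l l h ≡ suc (length us)
  white-dual-degree {l = l} {h} (cons {r = r} _ ql B W) =
    trans (count-restrict ≤-refl (<⇒≤ (black-≤ B)) (white-≤ W) (λ l≤x x<l → ⊥-elim (<⇒≱ x<l l≤x))
            (λ r≤y y<h e → <⇒≱ (black-≤ B) (subst (r ≤_) e (proj₁ (white-dual-label W r≤y y<h)))))
      (trans (ℕFold.foldRange-cons (black-≤ B)) (cong₂ _+_ (indicator-≡ {q} ql) (black-degree B ≤-refl)))

-- The argument of `gB` and `gW` is the degree of a vertex: its children and its parent edge. The
-- monoid is arbitrary because the same fold serves for conjunction (block sizes modulo d), addition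
-- (numbers of blocks, exponents) and multiplication (weights).
module TreeFold {c ℓ} (M : CommutativeMonoid c ℓ) (gB gW : ℕ → CommutativeMonoid.Carrier M) where
  open CommutativeMonoid M using (Carrier; _∙_; ε)

  mutual
    foldWhite : List Tree → Carrier
    foldWhite []             = ε
    foldWhite (node us ∷ ts) = (gW (suc (length us)) ∙ foldBlack us) ∙ foldWhite ts

    foldBlack : List Tree → Carrier
    foldBlack []             = ε
    foldBlack (node us ∷ ts) = (gB (suc (length us)) ∙ foldWhite us) ∙ foldBlack ts

-- `Φ` and `Ψ` put the factor of a block at its least point and the unit elsewhere. A product over
-- blocks thus becomes a product over an interval, which splits along the forest. `N` and `N*` are
-- the block sizes in the whole partition; the induction shows that they agree with the counts in
-- each subinterval.
module BlockFold {c ℓ} (M : CommutativeMonoid c ℓ)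
  (gB gW : ℕ → CommutativeMonoid.Carrier M) (p q N N* : ℕ → ℕ) (Φ Ψ : ℕ → CommutativeMonoid.Carrier M)
  (Φ-rep : ∀ {x} → p x ≡ x → CommutativeMonoid._≈_ M (Φ x) (gB (N x)))
  (Φ-nonrep : ∀ {x} → p x ≢ x → CommutativeMonoid._≈_ M (Φ x) (CommutativeMonoid.ε M))
  (Ψ-rep : ∀ {x} → q x ≡ x → CommutativeMonoid._≈_ M (Ψ x) (gW (N* x)))
  (Ψ-nonrep : ∀ {x} → q x ≢ x → CommutativeMonoid._≈_ M (Ψ x) (CommutativeMonoid.ε M))
  where
  open CommutativeMonoid M
    using (Carrier; _∙_; ε; _≈_; setoid; identityˡ; identityʳ; assoc; ∙-cong; ∙-congˡ; ∙-congʳ; reflexive)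
    renaming (refl to ≈-refl; sym to ≈-sym; trans to ≈-trans)
  open RangeFold M
  open TreeFold M gB gW
  open SetoidReasoning setoid

  private
    Ξ : ℕ → Carrier
    Ξ x = Φ x ∙ Ψ x

    absurd : ∀ {a} {A : Set a} {h x : ℕ} → h ≤ x → x < h → A
    absurd h≤x x<h = ⊥-elim (<⇒≱ x<h h≤x)

  mutual
    -- The factor `Φ l` is left out since it concerns the parent: it is trivial for `b < l`, and for
    -- `b ≡ l` it is the factor of the block of `b`, whose size is not the count in [l , h) when
    -- there is a parent edge. Hence also the exception `x ≢ b`.
    white-fold-head : ∀ {b l h ts} → WhiteForest p q b l h ts → b ≤ l → l < h →
      (∀ {x} → l ≤ x → x < h → x ≢ b → N x ≡ count p x l h) →
      (∀ {x} → l ≤ x → x < h → N* x ≡ count q x l h) →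
      Ψ l ∙ foldRange Ξ (suc l) h ≈ foldWhite ts
    white-fold-head [] _ l<l _ _ = absurd ≤-refl l<l
    white-fold-head {b} {l} {h} W₀@(cons {r = r} {us = us} {ts = ts} pl ql B W) b≤l l<h locP locQ = begin
      Ψ l ∙ foldRange Ξ (suc l) h                          ≈⟨ ∙-cong (Ψ-rep ql) (foldRange-split (black-≤ B) (white-≤ W)) ⟩
      gW (N* l) ∙ (foldRange Ξ (suc l) r ∙ foldRange Ξ r h) ≈⟨ ≈-sym (assoc _ _ _) ⟩
      (gW (N* l) ∙ foldRange Ξ (suc l) r) ∙ foldRange Ξ r h ≈⟨ ∙-cong (∙-cong (reflexive (cong gW N*l)) foldB) foldW ⟩
      (gW (suc (length us)) ∙ foldBlack us) ∙ foldWhite ts  ∎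
      where
      b<r = ≤-<-trans b≤l (black-≤ B)
      qW : ∀ {x y} → r ≤ y → y < h → x < r → q y ≢ x
      qW r≤y y<h x<r refl = absurd (proj₁ (white-dual-label W r≤y y<h)) x<r
      qB< : ∀ {y} → l ≤ y → y < r → q y < r
      qB< l≤y y<r with m≤n⇒m<n∨m≡n l≤y
      ... | inj₂ refl = subst (_< r) (sym ql) (black-≤ B)
      ... | inj₁ l<y with black-dual-label B l<y y<r
      ...   | inj₁ e = subst (_< r) (sym e) (black-≤ B)
      ...   | inj₂ (_ , qy≤y , _) = ≤-<-trans qy≤y y<r
      pB< : ∀ {y} → l ≤ y → y < r → p y < r
      pB< l≤y y<r with m≤n⇒m<n∨m≡n l≤y
      ... | inj₂ refl = subst (_< r) (sym pl) b<r
      ... | inj₁ l<y = ≤-<-trans (proj₁ (proj₂ (black-label B l<y y<r))) y<r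
      N*l : N* l ≡ suc (length us)
      N*l = trans (locQ ≤-refl l<h) (white-dual-degree W₀)
      foldB : foldRange Ξ (suc l) r ≈ foldBlack us
      foldB = black-fold B ≤-refl
        (λ {x} l<x x<r → trans (locP (<⇒≤ l<x) (<-≤-trans x<r (white-≤ W)) (λ { refl → absurd b≤l l<x }))
          (count-restrict (n≤1+n l) (black-≤ B) (white-≤ W)
            (λ l≤y y≤l e → absurd b≤l (subst (l <_) (trans (sym e) (trans (cong p (≤-antisym (≤-pred y≤l) l≤y)) pl)) l<x))
            (λ r≤y y<h e → absurd b≤l (subst (l <_) (trans (sym e)
              (white-small-label W (<⇒≤ b<r) r≤y y<h (subst (_< r) (sym e) x<r))) l<x))))
        (λ {x} l<x x<r → trans (locQ (<⇒≤ l<x) (<-≤-trans x<r (white-≤ W)))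
          (count-restrict (n≤1+n l) (black-≤ B) (white-≤ W)
            (λ l≤y y≤l e → <-irrefl (trans (sym (trans (cong q (≤-antisym (≤-pred y≤l) l≤y)) ql)) e) l<x)
            (λ r≤y y<h → qW r≤y y<h x<r)))
      foldW : foldRange Ξ r h ≈ foldWhite ts
      foldW = white-fold W b<r
        (λ r≤x x<h x≢b → trans (locP (≤-trans (<⇒≤ (black-≤ B)) r≤x) x<h x≢b)
          (count-restrict (<⇒≤ (black-≤ B)) (white-≤ W) ≤-refl
            (λ l≤y y<r e → absurd r≤x (subst (_< r) e (pB< l≤y y<r))) absurd))
        (λ r≤x x<h → trans (locQ (≤-trans (<⇒≤ (black-≤ B)) r≤x) x<h)
          (count-restrict (<⇒≤ (black-≤ B)) (white-≤ W) ≤-refl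
            (λ l≤y y<r e → absurd r≤x (subst (_< r) e (qB< l≤y y<r))) absurd))

    white-fold : ∀ {b l h ts} → WhiteForest p q b l h ts → b < l →
      (∀ {x} → l ≤ x → x < h → x ≢ b → N x ≡ count p x l h) →
      (∀ {x} → l ≤ x → x < h → N* x ≡ count q x l h) →
      foldRange Ξ l h ≈ foldWhite ts
    white-fold {l = l} [] _ _ _ = foldRange-empty l
    white-fold {b} {l} {h} {ts} W₀@(cons pl ql B W) b<l locP locQ = begin
      foldRange Ξ l h                    ≈⟨ foldRange-cons l<h ⟩
      (Φ l ∙ Ψ l) ∙ foldRange Ξ (suc l) h ≈⟨ ∙-congʳ (≈-trans (∙-congʳ (Φ-nonrep λ e → <-irrefl (trans (sym pl) e) b<l)) (identityˡ _)) ⟩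
      Ψ l ∙ foldRange Ξ (suc l) h         ≈⟨ white-fold-head W₀ (<⇒≤ b<l) l<h locP locQ ⟩
      foldWhite ts                        ∎
      where l<h = <-≤-trans (black-≤ B) (white-≤ W)

    white-fold-root : ∀ {l h ts} → WhiteForest p q l l h ts → p l ≡ l → l < h →
      (∀ {x} → l ≤ x → x < h → x ≢ l → N x ≡ count p x l h) →
      (∀ {x} → l ≤ x → x < h → N* x ≡ count q x l h) →
      foldRange Ξ l h ≈ gB (N l) ∙ foldWhite ts
    white-fold-root {l} {h} {ts} W pl l<h locP locQ = begin
      foldRange Ξ l h                        ≈⟨ foldRange-cons l<h ⟩
      (Φ l ∙ Ψ l) ∙ foldRange Ξ (suc l) h     ≈⟨ assoc _ _ _ ⟩
      Φ l ∙ (Ψ l ∙ foldRange Ξ (suc l) h)     ≈⟨ ∙-cong (Φ-rep pl) (white-fold-head W ≤-refl l<h locP locQ) ⟩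
      gB (N l) ∙ foldWhite ts                 ∎

    black-fold : ∀ {w l h ts} → BlackForest p q w l h ts → w < l →
      (∀ {x} → l ≤ x → x < h → N x ≡ count p x l h) →
      (∀ {x} → l ≤ x → x < h → N* x ≡ count q x l h) →
      foldRange Ξ l h ≈ foldBlack ts
    black-fold {l = l} [] _ _ _ = foldRange-empty l
    black-fold {w} {l} {h} (cons {m = m} {us = us} {ts = ts} W pm qm B) w<l locP locQ = begin
      foldRange Ξ l h                                       ≈⟨ foldRange-split (white-≤ W) (<⇒≤ (black-≤ B)) ⟩
      foldRange Ξ l m ∙ foldRange Ξ m h                     ≈⟨ ∙-congˡ (foldRange-cons (black-≤ B)) ⟩
      foldRange Ξ l m ∙ (Ξ m ∙ foldRange Ξ (suc m) h)       ≈⟨ ≈-sym (assoc _ _ _) ⟩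
      (foldRange Ξ l m ∙ Ξ m) ∙ foldRange Ξ (suc m) h       ≈⟨ ∙-cong (block (m≤n⇒m<n∨m≡n (white-≤ W)) W) foldB ⟩
      (gB (suc (length us)) ∙ foldWhite us) ∙ foldBlack ts  ∎
      where
      l<h = ≤-<-trans (white-≤ W) (black-≤ B)
      pB : ∀ {x y} → m < y → y < h → x ≤ m → p y ≢ x
      pB m<y y<h x≤m refl = absurd (proj₁ (black-label B m<y y<h)) (s≤s x≤m)
      pW : ∀ {y} → l ≤ y → y ≤ m → p y ≤ m
      pW l≤y y≤m with m≤n⇒m<n∨m≡n y≤m
      ... | inj₁ y<m = ≤-trans (white-label-≤ W ≤-refl l≤y y<m) y≤m
      ... | inj₂ refl = ≤-trans (≤-reflexive pm) l≤y
      qW : ∀ {y} → l ≤ y → y ≤ m → q y ≤ m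
      qW l≤y y≤m with m≤n⇒m<n∨m≡n y≤m
      ... | inj₁ y<m = ≤-trans (proj₁ (proj₂ (white-dual-label W l≤y y<m))) y≤m
      ... | inj₂ refl = ≤-trans (≤-reflexive qm) (≤-trans (<⇒≤ w<l) l≤y)
      Nl : N l ≡ suc (length us)
      Nl = trans (locP ≤-refl l<h)
        (trans (count-restrict ≤-refl (m≤n⇒m≤1+n (white-≤ W)) (black-≤ B) absurd (λ m<y y<h → pB m<y y<h (white-≤ W)))
          (trans (ℕFold.foldRange-split {indicator p l} (white-≤ W) (n≤1+n m))
            (trans (cong₂ _+_ (white-degree W ≤-refl)
                     (trans (ℕFold.foldRange-cons {indicator p l} {m} ≤-refl) (cong₂ _+_ (indicator-≡ {p} pm) (ℕFold.foldRange-empty (suc m)))))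
              (+-comm (length us) 1))))
      locP′ : ∀ {x} → l ≤ x → x < m → x ≢ l → N x ≡ count p x l m
      locP′ l≤x x<m x≢l = trans (locP l≤x (<-trans x<m (black-≤ B)))
        (count-restrict ≤-refl (white-≤ W) (<⇒≤ (black-≤ B)) absurd after)
        where
        after : ∀ {y} → m ≤ y → y < h → p y ≢ _
        after m≤y y<h with m≤n⇒m<n∨m≡n m≤y
        ... | inj₁ m<y  = pB m<y y<h (<⇒≤ x<m)
        ... | inj₂ refl = λ e → x≢l (trans (sym e) pm)
      locQ′ : ∀ {x} → l ≤ x → x < m → N* x ≡ count q x l m
      locQ′ l≤x x<m = trans (locQ l≤x (<-trans x<m (black-≤ B)))
        (count-restrict ≤-refl (white-≤ W) (<⇒≤ (black-≤ B)) absurd after)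
        where
        after : ∀ {y} → m ≤ y → y < h → q y ≢ _
        after m≤y y<h e with m≤n⇒m<n∨m≡n m≤y
        ... | inj₂ refl = absurd l≤x (subst (_< l) (trans (sym qm) e) w<l)
        ... | inj₁ m<y with black-dual-label B m<y y<h
        ...   | inj₁ e′ = absurd l≤x (subst (_< l) (trans (sym e′) e) w<l)
        ...   | inj₂ (m<qy , _) = absurd (subst (m <_) e m<qy) (m<n⇒m<1+n x<m)
      -- The factor of the block sits at `l`. If the black vertex has children, `m` is a further
      -- point and contributes the unit; at a leaf `l` and `m` coincide, and the factor is found at
      -- `m`.
      block : l < m ⊎ l ≡ m → WhiteForest p q l l m us → foldRange Ξ l m ∙ Ξ m ≈ gB (suc (length us)) ∙ foldWhite us
      block (inj₁ l<m) W = begin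
        foldRange Ξ l m ∙ Ξ m ≈⟨ ∙-cong (white-fold-root W (white-closed-first W pm) l<m locP′ locQ′)
                                   (∙-cong (Φ-nonrep λ e → <-irrefl (trans (sym pm) e) l<m)
                                           (Ψ-nonrep λ e → <-irrefl (trans (sym qm) e) (<-trans w<l l<m))) ⟩
        (gB (N l) ∙ foldWhite us) ∙ (ε ∙ ε) ≈⟨ ∙-congˡ (identityˡ ε) ⟩
        (gB (N l) ∙ foldWhite us) ∙ ε       ≈⟨ identityʳ _ ⟩
        gB (N l) ∙ foldWhite us             ≈⟨ ∙-congʳ (reflexive (cong gB Nl)) ⟩
        gB (suc (length us)) ∙ foldWhite us ∎
      block (inj₂ refl) (cons _ _ B′ W′) = absurd (white-≤ W′) (black-≤ B′)
      block (inj₂ refl) [] = begin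
        foldRange Ξ l l ∙ Ξ l ≈⟨ ∙-cong (foldRange-empty l)
                                   (∙-cong (Φ-rep pm) (Ψ-nonrep λ e → <-irrefl (trans (sym qm) e) w<l)) ⟩
        ε ∙ (gB (N l) ∙ ε)    ≈⟨ identityˡ _ ⟩
        gB (N l) ∙ ε          ≈⟨ ∙-congʳ (reflexive (cong gB Nl)) ⟩
        gB (suc (length us)) ∙ ε ∎
      foldB : foldRange Ξ (suc m) h ≈ foldBlack ts
      foldB = black-fold B (m≤n⇒m≤1+n (≤-trans w<l (white-≤ W)))
        (λ m<x x<h → trans (locP (≤-trans (white-≤ W) (<⇒≤ m<x)) x<h)
          (count-restrict (m≤n⇒m≤1+n (white-≤ W)) (black-≤ B) ≤-refl
            (λ l≤y y≤m e → absurd (pW l≤y (≤-pred y≤m)) (subst (m <_) (sym e) m<x)) absurd))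
        (λ m<x x<h → trans (locQ (≤-trans (white-≤ W) (<⇒≤ m<x)) x<h)
          (count-restrict (m≤n⇒m≤1+n (white-≤ W)) (black-≤ B) ≤-refl
            (λ l≤y y≤m e → absurd (qW l≤y (≤-pred y≤m)) (subst (m <_) (sym e) m<x)) absurd))

module _ {A : Set} (P : A → Bool) where

  keep-∈ : ∀ {xs x} → x ∈ xs → T (P x) → x ∈ keep P xs
  keep-∈ {y ∷ ys} (here refl) px with true ← P y = here refl
  keep-∈ {y ∷ ys} (there x∈) px with P y
  ... | true  = there (keep-∈ x∈ px)
  ... | false = keep-∈ x∈ px

  keep-∈⁻ : ∀ xs {x} → x ∈ keep P xs → x ∈ xs × T (P x)
  keep-∈⁻ (y ∷ ys) x∈ with P y in eq
  keep-∈⁻ (y ∷ ys) (here refl) | true = here refl , subst T (sym eq) tt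
  keep-∈⁻ (y ∷ ys) (there x∈)  | true with keep-∈⁻ ys x∈
  ... | x∈′ , px = there x∈′ , px
  keep-∈⁻ (y ∷ ys) x∈ | false with keep-∈⁻ ys x∈
  ... | x∈′ , px = there x∈′ , px

module ListFold {c ℓ} (M : CommutativeMonoid c ℓ) where
  open CommutativeMonoid M using (Carrier; _∙_; ε; _≈_; identityˡ; ∙-cong; ∙-congˡ; reflexive; commutativeSemigroup)
    renaming (refl to ≈-refl; sym to ≈-sym; trans to ≈-trans)
  open RangeFold M
  open CommutativeSemigroupProperties commutativeSemigroup using (interchange)

  foldMap : ∀ {A : Set} → (A → Carrier) → List A → Carrier
  foldMap G xs = foldr _∙_ ε (map G xs)

  foldMap-keep : ∀ {A : Set} (P : A → Bool) (G : A → Carrier) xs →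
    foldMap G (keep P xs) ≈ foldMap (λ x → if P x then G x else ε) xs
  foldMap-keep P G [] = ≈-refl
  foldMap-keep P G (x ∷ xs) with P x
  ... | true  = ∙-congˡ (foldMap-keep P G xs)
  ... | false = ≈-trans (foldMap-keep P G xs) (≈-sym (identityˡ _))

  foldMap-allFin : ∀ n (G : Fin n → Carrier) F → (∀ i → G i ≈ F (toℕ i)) → foldMap G (allFin n) ≈ foldRange F 0 n
  foldMap-allFin n G F e = ≈-trans (reflexive (cong (foldr _∙_ ε) (map-tabulate id G))) (go n 0 G e)
    where
    go : ∀ n l (G : Fin n → Carrier) → (∀ i → G i ≈ F (l + toℕ i)) → foldr _∙_ ε (tabulate G) ≈ foldFrom F l n
    go zero l G e = ≈-refl
    go (suc n) l G e = ∙-cong (≈-trans (e Fin.zero) (reflexive (cong F (+-identityʳ l))))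
      (go n (suc l) (G ∘ Fin.suc) (λ i → ≈-trans (e (Fin.suc i)) (reflexive (cong F (+-suc l (toℕ i))))))

  foldFrom-∙ : ∀ F G l k → foldFrom (λ x → F x ∙ G x) l k ≈ foldFrom F l k ∙ foldFrom G l k
  foldFrom-∙ F G l zero = ≈-sym (identityˡ ε)
  foldFrom-∙ F G l (suc k) = ≈-trans (∙-congˡ (foldFrom-∙ F G (suc l) k)) (interchange _ _ _ _)

module ℕList = ListFold +-0-commutativeMonoid

length≡foldMap : ∀ {A : Set} (xs : List A) → length xs ≡ ℕList.foldMap (λ _ → 1) xs
length≡foldMap []       = refl
length≡foldMap (_ ∷ xs) = cong suc (length≡foldMap xs)

module _ {n : ℕ} (f : Labelling n) where

  blockSize≡count : ∀ i → blockSize f i ≡ count (extend f) (toℕ (f i)) 0 n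
  blockSize≡count i =
    trans (length≡foldMap (keep (sameBlock f i) (allFin n)))
      (trans (ℕList.foldMap-keep (sameBlock f i) (λ _ → 1) (allFin n))
        (ℕList.foldMap-allFin n _ (indicator (extend f) (toℕ (f i))) λ j →
          cong (λ b → if b then 1 else 0) (does-⇔
            (mk⇔ (λ e → trans (extend-toℕ f j) (cong toℕ (sym e)))
                 (λ e → Fin.toℕ-injective (trans (sym e) (extend-toℕ f j))))
            (f i Fin.≟ f j) (extend f (toℕ j) ≟ toℕ (f i)))))

  module _ {c ℓ} (M : CommutativeMonoid c ℓ) where
    open CommutativeMonoid M using (Carrier; ε; _≈_; reflexive) renaming (trans to ≈-trans)
    open ListFold M
    open RangeFold M

    representative : (ℕ → Carrier) → ℕ → Carrier
    representative g x = if does (extend f x ≟ x) then g (count (extend f) x 0 n) else ε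

    foldMap-reps : ∀ (g : ℕ → Carrier) → foldMap (λ i → g (blockSize f i)) (reps f) ≈ foldRange (representative g) 0 n
    foldMap-reps g = ≈-trans (foldMap-keep (λ i → does (f i Fin.≟ i)) _ (allFin n))
      (foldMap-allFin n _ _ at)
      where
      at : ∀ i → (if does (f i Fin.≟ i) then g (blockSize f i) else ε) ≈ representative g (toℕ i)
      at i with f i Fin.≟ i
      ... | yes e = reflexive (trans (cong g (trans (blockSize≡count i) (cong (λ j → count (extend f) (toℕ j) 0 n) e)))
              (cong (λ b → if b then g (count (extend f) (toℕ i) 0 n) else ε)
                (sym (dec-true (extend f (toℕ i) ≟ toℕ i) (trans (extend-toℕ f i) (cong toℕ e))))))
      ... | no ne = reflexive (cong (λ b → if b then g (count (extend f) (toℕ i) 0 n) else ε)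
                (sym (dec-false (extend f (toℕ i) ≟ toℕ i)
                  λ e → ne (Fin.toℕ-injective (trans (sym (extend-toℕ f i)) e)))))

    representative-yes : ∀ (g : ℕ → Carrier) {x} → extend f x ≡ x → representative g x ≈ g (count (extend f) x 0 n)
    representative-yes g {x} e = reflexive (cong (λ b → if b then g (count (extend f) x 0 n) else ε) (dec-true (extend f x ≟ x) e))

    representative-no : ∀ (g : ℕ → Carrier) {x} → extend f x ≢ x → representative g x ≈ ε
    representative-no g {x} ne = reflexive (cong (λ b → if b then g (count (extend f) x 0 n) else ε) (dec-false (extend f x ≟ x) ne))

module _ {n : ℕ} (0<n : 0 < n) {π σ : Labelling n} {ts : List Tree} (E : Encodes (π , σ) ts) where

  module _ {c ℓ} (M : CommutativeMonoid c ℓ) where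
    open CommutativeMonoid M using (Carrier; _∙_; _≈_; ∙-cong; ∙-congʳ; reflexive) renaming (sym to ≈-sym; trans to ≈-trans)
    open ListFold M
    open RangeFold M

    -- The root stands apart in the product because its degree is `length ts`, without the
    -- additional parent edge of every other vertex.
    blocks-fold : ∀ (gB gW : ℕ → Carrier) → let open TreeFold M gB gW in
      foldMap (λ i → gB (blockSize π i)) (reps π) ∙ foldMap (λ i → gW (blockSize σ i)) (reps σ)
        ≈ gB (length ts) ∙ foldWhite ts
    blocks-fold gB gW =
      ≈-trans (∙-cong (foldMap-reps π M gB) (foldMap-reps σ M gW))
        (≈-trans (≈-sym (foldFrom-∙ _ _ 0 n))
          (≈-trans (white-fold-root E (white-first E 0<n) 0<n (λ _ _ _ → refl) (λ _ _ → refl))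
            (∙-congʳ (reflexive (cong gB (white-degree E z≤n))))))
      where
      open BlockFold M gB gW (extend π) (extend σ)
        (λ x → count (extend π) x 0 n) (λ x → count (extend σ) x 0 n)
        (representative π M gB) (representative σ M gW)
        (representative-yes π M gB) (representative-no π M gB)
        (representative-yes σ M gW) (representative-no σ M gW)

module _ {n : ℕ} {π σ : Labelling (suc n)} where

  root-degree : ∀ {ts} → Encodes (π , σ) ts → blockSize π Fin.zero ≡ length ts
  root-degree E = trans (blockSize≡count π Fin.zero)
    (trans (cong (λ v → count (extend π) v 0 (suc n)) (trans (sym (extend-toℕ π Fin.zero)) (white-first E (s≤s z≤n))))
      (white-degree E z≤n))

  dual-root-degree : ∀ {us ts} → Encodes (π , σ) (node us ∷ ts) → blockSize σ Fin.zero ≡ suc (length us)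
  dual-root-degree E@(cons _ q0 _ _) = trans (blockSize≡count σ Fin.zero)
    (trans (cong (λ v → count (extend σ) v 0 (suc n)) (trans (sym (extend-toℕ σ Fin.zero)) q0))
      (white-dual-degree E))

-- Block sizes modulo d

data Divisible (d : ℕ) : List Tree → Set where
  []  : Divisible d []
  _∷_ : ∀ {us ts} → d ∣ length us × Divisible d us → Divisible d ts → Divisible d (node us ∷ ts)

module _ (d : ℕ) .{{_ : NonZero d}} where

  sizeOK : ℕ → Bool
  sizeOK m = ((m ∸ 1) % d) ≡ᵇ 0

  sizeOK⇒∣ : ∀ {m} → T (sizeOK (suc m)) → d ∣ m
  sizeOK⇒∣ {m} t = m%n≡0⇒n∣m m d (≡ᵇ⇒≡ _ _ t)

  ∣⇒sizeOK : ∀ {m} → d ∣ m → T (sizeOK (suc m))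
  ∣⇒sizeOK {m} d∣m = ≡⇒≡ᵇ _ _ (n∣m⇒m%n≡0 m d d∣m)

  open TreeFold ∧-commutativeMonoid sizeOK sizeOK
  open ListFold ∧-commutativeMonoid using (foldMap)

  mutual
    foldWhite⇒divisible : ∀ ts → T (foldWhite ts) → Divisible d ts
    foldWhite⇒divisible [] _ = []
    foldWhite⇒divisible (node us ∷ ts) t with to (T-∧ {sizeOK (suc (length us)) ∧ foldBlack us}) t
    ... | t₁ , t₂ with to (T-∧ {sizeOK (suc (length us))}) t₁
    ...   | t₃ , t₄ = (sizeOK⇒∣ t₃ , foldBlack⇒divisible us t₄) ∷ foldWhite⇒divisible ts t₂

    foldBlack⇒divisible : ∀ ts → T (foldBlack ts) → Divisible d ts
    foldBlack⇒divisible [] _ = []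
    foldBlack⇒divisible (node us ∷ ts) t with to (T-∧ {sizeOK (suc (length us)) ∧ foldWhite us}) t
    ... | t₁ , t₂ with to (T-∧ {sizeOK (suc (length us))}) t₁
    ...   | t₃ , t₄ = (sizeOK⇒∣ t₃ , foldWhite⇒divisible us t₄) ∷ foldBlack⇒divisible ts t₂

  mutual
    divisible⇒foldWhite : ∀ {ts} → Divisible d ts → T (foldWhite ts)
    divisible⇒foldWhite [] = tt
    divisible⇒foldWhite ((d∣ , us) ∷ ts) = from T-∧ (from T-∧ (∣⇒sizeOK d∣ , divisible⇒foldBlack us) , divisible⇒foldWhite ts)

    divisible⇒foldBlack : ∀ {ts} → Divisible d ts → T (foldBlack ts)
    divisible⇒foldBlack [] = tt
    divisible⇒foldBlack ((d∣ , us) ∷ ts) = from T-∧ (from T-∧ (∣⇒sizeOK d∣ , divisible⇒foldWhite us) , divisible⇒foldBlack ts)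

  allB≡foldMap : ∀ {A : Set} (P : A → Bool) xs → allB P xs ≡ foldMap P xs
  allB≡foldMap P [] = refl
  allB≡foldMap P (x ∷ xs) = cong (P x ∧_) (allB≡foldMap P xs)

  module _ {n : ℕ} (f : Labelling n) (canonical : Canonical f) where

    sizesOK⇒reps : T (sizesOK d f) → T (foldMap (λ i → sizeOK (blockSize f i)) (reps f))
    sizesOK⇒reps t = subst T (allB≡foldMap (λ i → sizeOK (blockSize f i)) (reps f))
      (allB-intro (reps f) λ {i} _ → allB-elim t (∈-allFin i))

    -- The point `i` and its representative `f i` have the same block size, and canonicity puts
    -- `f i` into `reps f`.
    reps⇒sizesOK : T (foldMap (λ i → sizeOK (blockSize f i)) (reps f)) → T (sizesOK d f)
    reps⇒sizesOK t = allB-intro (allFin n) λ {i} _ →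
      subst (λ m → T (sizeOK m))
        (trans (blockSize≡count f (f i))
          (trans (cong (λ j → count (extend f) (toℕ j) 0 n) (proj₁ (canonical i))) (sym (blockSize≡count f i))))
        (allB-elim (subst T (sym (allB≡foldMap (λ i → sizeOK (blockSize f i)) (reps f))) t)
          (keep-∈ (λ i → does (f i Fin.≟ i)) (∈-allFin (f i)) (does-T (f (f i) Fin.≟ f i) (proj₁ (canonical i)))))

-- A degree congruent to 1 means a number of children divisible by d at a vertex with a parent edge.
-- At the root it means that one child more than a multiple of d is present.
record DivisibleForest (d : ℕ) (ts : List Tree) : Set where
  constructor divisibleForest
  field
    root     : d ∣ (length ts ∸ 1)
    children : Divisible d ts

module _ {d : ℕ} .{{_ : NonZero d}} {n : ℕ} (0<n : 0 < n) {π σ : Labelling n} where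

  isNCdPair⇒encodes : T (isNCdPair d (π , σ)) → ∃ λ ts → Encodes (π , σ) ts × DivisibleForest d ts
  isNCdPair⇒encodes t
    with cπ , t₁ ← to (T-∧ {isCanonical π}) t
    with nπ , t₂ ← to (T-∧ {isNoncrossing π}) t₁
    with kσ , t₃ ← to (T-∧ {isKrewerasDual π σ}) t₂
    with sπ , sσ ← to (T-∧ {sizesOK d π}) t₃
    with D ← kreweras⇒dualPairFin cπ nπ kσ
    with ts , E ← dualPair⇒forest 0<n (dualPairFin⇒dualPair D)
    with root , rest ← to (T-∧ {sizeOK d (length ts)}) (subst T (blocks-fold 0<n E ∧-commutativeMonoid (sizeOK d) (sizeOK d))
           (from T-∧ (sizesOK⇒reps d π (DualPairFin.canonical D) sπ , sizesOK⇒reps d σ (DualPairFin.dual-canonical D) sσ)))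
    = ts , E , divisibleForest (m%n≡0⇒n∣m _ d (≡ᵇ⇒≡ _ _ root)) (foldWhite⇒divisible d ts rest)

  encodes⇒isNCdPair : ∀ {ts} → Encodes (π , σ) ts → DivisibleForest d ts → T (isNCdPair d (π , σ))
  encodes⇒isNCdPair {ts} E (divisibleForest root children)
    with D ← dualPair⇒dualPairFin (forest⇒dualPair E)
    with cπ , nπ , kσ ← dualPairFin⇒kreweras D
    with sπ , sσ ← to (T-∧ {ListFold.foldMap ∧-commutativeMonoid (λ i → sizeOK d (blockSize π i)) (reps π)})
           (subst T (sym (blocks-fold 0<n E ∧-commutativeMonoid (sizeOK d) (sizeOK d)))
           (from T-∧ (≡⇒≡ᵇ _ _ (n∣m⇒m%n≡0 _ d root) , divisible⇒foldWhite d children)))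
    = from T-∧ (cπ , from T-∧ (nπ , from T-∧ (kσ , from (T-∧ {sizesOK d π})
        (reps⇒sizesOK d π (DualPairFin.canonical D) sπ , reps⇒sizesOK d σ (DualPairFin.dual-canonical D) sσ))))

-- Sums along a bijection of lists

module _ {A : Set} where

  ∈-─⁺ : ∀ {xs : List A} {x y} (x∈ : x ∈ xs) → y ∈ xs → y ≢ x → y ∈ (xs ─ x∈)
  ∈-─⁺ (here refl) (here refl) y≢x = ⊥-elim (y≢x refl)
  ∈-─⁺ (here refl) (there y∈) _ = y∈
  ∈-─⁺ (there x∈) (here refl) _ = here refl
  ∈-─⁺ (there x∈) (there y∈) y≢x = there (∈-─⁺ x∈ y∈ y≢x)

  ∈-─⁻ : ∀ {xs : List A} {x y} (x∈ : x ∈ xs) → y ∈ (xs ─ x∈) → y ∈ xs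
  ∈-─⁻ (here refl) y∈ = there y∈
  ∈-─⁻ (there x∈) (here refl) = here refl
  ∈-─⁻ (there x∈) (there y∈) = there (∈-─⁻ x∈ y∈)

  unique-─ : ∀ {xs : List A} {x} (x∈ : x ∈ xs) → Unique xs → Unique (xs ─ x∈)
  unique-─ (here refl) (_ ∷ u) = u
  unique-─ (there x∈) (x∉ ∷ u) = All.tabulate (λ y∈ → All.lookup x∉ (∈-─⁻ x∈ y∈)) ∷ unique-─ x∈ u

  ∈-─-≢ : ∀ {xs : List A} {x y} (x∈ : x ∈ xs) → Unique xs → y ∈ (xs ─ x∈) → y ≢ x
  ∈-─-≢ (here refl) (x∉ ∷ u) y∈ refl = All.lookup x∉ y∈ refl
  ∈-─-≢ (there x∈) (z∉ ∷ u) (here refl) refl = All.lookup z∉ x∈ refl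
  ∈-─-≢ (there x∈) (z∉ ∷ u) (there y∈) = ∈-─-≢ x∈ u y∈

module Bijection {c ℓ} (M : CommutativeMonoid c ℓ) where
  open CommutativeMonoid M using (Carrier; _∙_; _≈_; ∙-cong; ∙-congˡ; commutativeSemigroup)
    renaming (refl to ≈-refl; sym to ≈-sym; trans to ≈-trans)
  open CommutativeSemigroupProperties commutativeSemigroup using (x∙yz≈y∙xz)
  open ListFold M using (foldMap)

  foldMap-─ : ∀ {A : Set} (v : A → Carrier) {xs x} (x∈ : x ∈ xs) → foldMap v xs ≈ v x ∙ foldMap v (xs ─ x∈)
  foldMap-─ v (here refl) = ≈-refl
  foldMap-─ v (there x∈) = ≈-trans (∙-congˡ (foldMap-─ v x∈)) (x∙yz≈y∙xz _ _ _)

  -- The entries of `xs` will be labellings, which are known to differ only pointwise; so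
  -- injectivity is stated as having no common image. The induction removes the image of the first
  -- entry from `ys`.
  foldMap-bijection : ∀ {X Y : Set} (R : X → Y → Set) {w : X → Carrier} {v : Y → Carrier} →
    (∀ {x y} → R x y → w x ≈ v y) → (∀ {x y y′} → R x y → R x y′ → y ≡ y′) →
    ∀ {xs ys} → AllPairs (λ x x′ → ∀ y → R x y → ¬ R x′ y) xs → Unique ys →
    (∀ {x} → x ∈ xs → ∃ λ y → y ∈ ys × R x y) → (∀ {y} → y ∈ ys → ∃ λ x → x ∈ xs × R x y) →
    foldMap w xs ≈ foldMap v ys
  foldMap-bijection R w≈v functional {[]} {[]} _ _ _ _ = ≈-refl
  foldMap-bijection R w≈v functional {[]} {y ∷ ys} _ _ _ onto with onto (here refl)
  ... | _ , () , _
  foldMap-bijection R {w} {v} w≈v functional {x ∷ xs} {ys} (x# ∷ xs#) u into onto with into (here refl)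
  ... | y , y∈ , Rxy = ≈-trans (∙-cong (w≈v Rxy) (foldMap-bijection R w≈v functional xs# (unique-─ y∈ u) into′ onto′))
                         (≈-sym (foldMap-─ v y∈))
    where
    into′ : ∀ {x′} → x′ ∈ xs → ∃ λ y′ → y′ ∈ (ys ─ y∈) × R x′ y′
    into′ x′∈ with into (there x′∈)
    ... | y′ , y′∈ , Rx′y′ = y′ , ∈-─⁺ y∈ y′∈ (λ { refl → All.lookup x# x′∈ y Rxy Rx′y′ }) , Rx′y′
    onto′ : ∀ {y′} → y′ ∈ (ys ─ y∈) → ∃ λ x′ → x′ ∈ xs × R x′ y′
    onto′ y′∈ with onto (∈-─⁻ y∈ y′∈)
    ... | x′ , there x′∈ , Rx′y′ = x′ , x′∈ , Rx′y′
    ... | x′ , here refl , Rxy′  = ⊥-elim (∈-─-≢ y∈ u y′∈ (functional Rxy′ Rxy))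

  foldMap-unique : ∀ {X : Set} (v : X → Carrier) {xs ys} → Unique xs → Unique ys →
    (∀ {x} → x ∈ xs → x ∈ ys) → (∀ {x} → x ∈ ys → x ∈ xs) → foldMap v xs ≈ foldMap v ys
  foldMap-unique v xs! ys! xs⊆ys ys⊆xs = foldMap-bijection _≡_ (λ { refl → ≈-refl }) (λ { refl refl → refl })
    (AllPairs.map (λ x≢x′ _ x≡y x′≡y → x≢x′ (trans x≡y (sym x′≡y))) xs!) ys!
    (λ x∈ → _ , xs⊆ys x∈ , refl) (λ y∈ → _ , ys⊆xs y∈ , refl)

allFuns-unique : ∀ n m → SetoidUnique.Unique ((Fin n) →-setoid (Fin m)) (allFuns n m)
allFuns-unique zero m = [] ∷ []
allFuns-unique (suc n) m = AllPairs.concat⁺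
  (All.map⁺ (All.tabulate λ _ → AllPairs.map⁺ (AllPairs.map (λ f≉g e → f≉g (e ∘ Fin.suc)) (allFuns-unique n m))))
  (AllPairs.map⁺ (AllPairs.map (λ x≢y → All.map⁺ (All.tabulate λ _ → All.map⁺ (All.tabulate λ _ e → x≢y (e Fin.zero))))
    (Unique.allFin⁺ m)))

PointwisePair : ∀ {n} → Labelling n × Labelling n → Labelling n × Labelling n → Set
PointwisePair (π , σ) (π′ , σ′) = π ≗ π′ × σ ≗ σ′

keep≡filter : ∀ {A : Set} (P : A → Bool) xs → keep P xs ≡ filter (T? ∘ P) xs
keep≡filter P [] = refl
keep≡filter P (x ∷ xs) with P x
... | true  = cong (x ∷_) (keep≡filter P xs)
... | false = keep≡filter P xs

NCdPairs-unique : ∀ d .{{_ : NonZero d}} n → AllPairs (λ x y → ¬ PointwisePair x y) (NCdPairs d n)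
NCdPairs-unique d n rewrite keep≡filter (isNCdPair d) (cartesianProduct (allFuns n n) (allFuns n n)) =
  UniqueSetoid.filter⁺ (×-setoid S S) (T? ∘ isNCdPair d)
    (UniqueSetoid.cartesianProduct⁺ S S (allFuns-unique n n) (allFuns-unique n n))
  where S = (Fin n) →-setoid (Fin n)

module _ {A B : Set} where

  -- The list version of the Cauchy product. The recursion splits off index 0 of `F`, exactly as
  -- `⊛-suc` does for series.
  convolution : (ℕ → List A) → (ℕ → List B) → ℕ → List (A × B)
  convolution F G zero    = cartesianProduct (F 0) (G 0)
  convolution F G (suc n) = cartesianProduct (F 0) (G (suc n)) ++ convolution (F ∘ suc) G n

  ∈-convolution⁺ : ∀ {F : ℕ → List A} {G : ℕ → List B} {x y} i j → x ∈ F i → y ∈ G j → (x , y) ∈ convolution F G (i + j)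
  ∈-convolution⁺ zero zero x∈ y∈ = ∈-cartesianProduct⁺ x∈ y∈
  ∈-convolution⁺ zero (suc j) x∈ y∈ = ∈-++⁺ˡ (∈-cartesianProduct⁺ x∈ y∈)
  ∈-convolution⁺ {F} {G} (suc i) j x∈ y∈ = ∈-++⁺ʳ (cartesianProduct (F 0) (G (suc (i + j)))) (∈-convolution⁺ i j x∈ y∈)

  ∈-convolution⁻ : ∀ (F : ℕ → List A) (G : ℕ → List B) n {x y} → (x , y) ∈ convolution F G n →
    ∃ λ i → ∃ λ j → i + j ≡ n × x ∈ F i × y ∈ G j
  ∈-convolution⁻ F G zero xy∈ = 0 , 0 , refl , ∈-cartesianProduct⁻ (F 0) (G 0) xy∈
  ∈-convolution⁻ F G (suc n) xy∈ with ∈-++⁻ (cartesianProduct (F 0) (G (suc n))) xy∈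
  ... | inj₁ xy∈′ = 0 , suc n , refl , ∈-cartesianProduct⁻ (F 0) (G (suc n)) xy∈′
  ... | inj₂ xy∈′ with ∈-convolution⁻ (F ∘ suc) G n xy∈′
  ...   | i , j , e , x∈ , y∈ = suc i , j , cong suc e , x∈ , y∈

  convolution-unique : ∀ (F : ℕ → List A) (G : ℕ → List B) n → (∀ i → Unique (F i)) → (∀ j → Unique (G j)) →
    (∀ {i j x} → x ∈ F i → x ∈ F j → i ≡ j) → Unique (convolution F G n)
  convolution-unique F G zero F! G! _ = Unique.cartesianProduct⁺ (F! 0) (G! 0)
  convolution-unique F G (suc n) F! G! disjoint =
    Unique.++⁺ (Unique.cartesianProduct⁺ (F! 0) (G! (suc n)))
      (convolution-unique (F ∘ suc) G n (F! ∘ suc) G! (λ x∈ x∈′ → suc-injective (disjoint x∈ x∈′)))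
      separate
    where
    separate : ∀ {xy} → ¬ (xy ∈ cartesianProduct (F 0) (G (suc n)) × xy ∈ convolution (F ∘ suc) G n)
    separate (p , q) with ∈-cartesianProduct⁻ (F 0) (G (suc n)) p | ∈-convolution⁻ (F ∘ suc) G n q
    ... | x∈ , _ | i , _ , _ , x∈′ , _ with () ← disjoint x∈ x∈′

-- Enumeration of trees

-- Below the edge that plants a tree, edges come in groups of children, each of a size divisible by
-- d; so a tree has 1 plus a multiple of d edges.
divisible-size : ∀ {d ts} → Divisible d ts → ∃ λ k → size ts ≡ length ts + k * d
divisible-size [] = 0 , refl
divisible-size {d} {node us ∷ ts} ((divides c lc , us#) ∷ ts#) with divisible-size us# | divisible-size ts#
... | k , ek | l , el = (c + k) + l , cong suc (trans (cong₂ _+_ (trans ek (cong (_+ k * d) lc)) el)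
        (solve 5 (λ c k l d n → (c :* d :+ k :* d) :+ (n :+ l :* d) := n :+ (c :+ k :+ l) :* d) refl c k l d (length ts)))
  where open +-*-Solver

length≤size : ∀ ts → length ts ≤ size ts
length≤size [] = z≤n
length≤size (node us ∷ ts) = s≤s (≤-trans (length≤size ts) (m≤n+m (size ts) (size us)))

module Enumeration (d : ℕ) .{{_ : NonZero d}} where

  -- The index `k` is the exponent of x. Identifying the planting edges of two trees leaves (1 + id)
  -- + (1 + jd) - 1 = 1 + (i + j)d edges, so that indices add.
  record IsTree (k : ℕ) (t : Tree) : Set where
    constructor isTree
    field
      divisible : Divisible d (t ∷ [])
      size≡     : size (t ∷ []) ≡ suc (k * d)

  record IsForest (m k : ℕ) (ts : List Tree) : Set where
    constructor isForest
    field
      divisible : Divisible d ts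
      length≡   : length ts ≡ m
      size≡     : size ts ≡ m + k * d

  -- Here `j` bounds the number of children, divided by d, from below, and `k` is what remains of
  -- the total. While `children` passes from jd to (j + 1)d children, `j + k` stays fixed.
  record IsChildren (j k : ℕ) (ts : List Tree) : Set where
    constructor isChildren
    field
      divisible : Divisible d ts
      quotient  : ℕ
      j≤        : j ≤ quotient
      length≡   : length ts ≡ quotient * d
      size≡     : size ts ≡ (j + k) * d

  forests : (ℕ → List Tree) → ℕ → ℕ → List (List Tree)
  forests U zero    zero    = [] ∷ []
  forests U zero    (suc k) = []
  forests U (suc m) k       = map (uncurry _∷_) (convolution U (forests U m) k)

  children : (ℕ → List Tree) → ℕ → ℕ → List (List Tree)
  children U j zero    = forests U (j * d) 0
  children U j (suc k) = forests U (j * d) (suc k) ++ children U (suc j) k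

  -- The first argument bounds the depth. It suffices that it exceeds `k`: a vertex that has
  -- children at all has at least d of them, so their indices are smaller than its own.
  trees : ℕ → ℕ → List Tree
  trees zero    k = []
  trees (suc f) k = map node (children (trees f) 0 k)

  isTree-unique : ∀ {i j t} → IsTree i t → IsTree j t → i ≡ j
  isTree-unique {i} {j} (isTree _ e) (isTree _ e′) = *-cancelʳ-≡ i j d (suc-injective (trans (sym e) e′))

  isTree-cons : ∀ {i m k t ts} → IsTree i t → IsForest m k ts → IsForest (suc m) (i + k) (t ∷ ts)
  isTree-cons {i} {m} {k} {node us} {ts} (isTree (u ∷ []) st) (isForest v l s) =
    isForest (u ∷ v) (cong suc l) (trans (cong (λ z → suc (z + size ts)) (trans (sym (+-identityʳ (size us))) (suc-injective st)))
      (trans (cong (λ z → suc (i * d + z)) s)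
        (solve 4 (λ i d m k → con 1 :+ (i :* d :+ (m :+ k :* d)) := con 1 :+ m :+ (i :+ k) :* d) refl i d m k)))
    where open +-*-Solver

  isTree-uncons : ∀ {m k t ts} → IsForest (suc m) k (t ∷ ts) → ∃ λ i → ∃ λ j → i + j ≡ k × IsTree i t × IsForest m j ts
  isTree-uncons {m} {k} {node us} {ts} (isForest ((divides c lc , u) ∷ v) l s) with divisible-size u | divisible-size v
  ... | i , ei | j , ej = c + i , j ,
        *-cancelʳ-≡ _ k d (+-cancelˡ-≡ (suc m) _ _ (trans (trans
          (solve 5 (λ c i j d m → con 1 :+ m :+ (c :+ i :+ j) :* d := con 1 :+ ((c :* d :+ i :* d) :+ (m :+ j :* d))) refl c i j d m)
          (cong suc (sym (cong₂ _+_ us≡ ts≡)))) s)) ,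
        isTree ((divides c lc , u) ∷ []) (cong suc (trans (+-identityʳ (size us)) (trans us≡ (sym (*-distribʳ-+ d c i))))) ,
        isForest v (suc-injective l) ts≡
    where
    open +-*-Solver
    us≡ : size us ≡ c * d + i * d
    us≡ = trans ei (cong (_+ i * d) lc)
    ts≡ : size ts ≡ m + j * d
    ts≡ = trans ej (cong (_+ j * d) (suc-injective l))

  module _ {U : ℕ → List Tree} (sound : ∀ {k t} → t ∈ U k → IsTree k t) where

    forests-sound : ∀ m {k ts} → ts ∈ forests U m k → IsForest m k ts
    forests-sound zero {zero} (here refl) = isForest [] refl refl
    forests-sound (suc m) {k} ts∈ with ∈-map⁻ (uncurry _∷_) ts∈
    ... | (t , ts) , tts∈ , refl with ∈-convolution⁻ U (forests U m) k tts∈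
    ...   | i , j , refl , t∈ , ts∈′ = isTree-cons (sound t∈) (forests-sound m ts∈′)

    forest⇒children : ∀ {j k ts} → IsForest (j * d) k ts → IsChildren j k ts
    forest⇒children {j} {k} (isForest v l s) = isChildren v j ≤-refl l (trans s (sym (*-distribʳ-+ d j k)))

    children-sound : ∀ j k {ts} → ts ∈ children U j k → IsChildren j k ts
    children-sound j zero ts∈ = forest⇒children (forests-sound (j * d) ts∈)
    children-sound j (suc k) ts∈ with ∈-++⁻ (forests U (j * d) (suc k)) ts∈
    ... | inj₁ ts∈′ = forest⇒children (forests-sound (j * d) ts∈′)
    ... | inj₂ ts∈′ with children-sound (suc j) k ts∈′
    ...   | isChildren v i j<i l s = isChildren v i (<⇒≤ j<i) l (trans s (cong (_* d) (sym (+-suc j k))))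

    module _ (unique : ∀ k → Unique (U k)) where

      forests-unique : ∀ m k → Unique (forests U m k)
      forests-unique zero zero = [] ∷ []
      forests-unique zero (suc k) = []
      forests-unique (suc m) k = Unique.map⁺ (λ { {_ , _} {_ , _} refl → refl })
        (convolution-unique U (forests U m) k unique (forests-unique m) (λ x∈ x∈′ → isTree-unique (sound x∈) (sound x∈′)))

      children-unique : ∀ j k → Unique (children U j k)
      children-unique j zero = forests-unique (j * d) 0
      children-unique j (suc k) = Unique.++⁺ (forests-unique (j * d) (suc k)) (children-unique (suc j) k) separate
        where
        separate : ∀ {ts} → ¬ (ts ∈ forests U (j * d) (suc k) × ts ∈ children U (suc j) k)
        separate (p , q) with forests-sound (j * d) p | children-sound (suc j) k q
        ... | isForest _ l _ | isChildren _ i j<i l′ _ =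
              <-irrefl (*-cancelʳ-≡ j i d (trans (sym l) l′)) j<i

    module _ {K : ℕ} (complete : ∀ {k t} → k < K → IsTree k t → t ∈ U k) where

      forests-complete : ∀ m {k ts} → k < K → IsForest m k ts → ts ∈ forests U m k
      forests-complete zero {k} {[]} _ (isForest _ _ s) with *-cancelʳ-≡ 0 k d s
      ... | refl = here refl
      forests-complete (suc m) {k} {t ∷ ts} k<K F with isTree-uncons F
      ... | i , j , refl , It , Its = ∈-map⁺ (uncurry _∷_) (∈-convolution⁺ i j
            (complete (≤-<-trans (m≤m+n i j) k<K) It) (forests-complete m (≤-<-trans (m≤n+m j i) k<K) Its))

      children-complete : ∀ j k {ts} → k < K → IsChildren j k ts → ts ∈ children U j k
      children-complete j k {ts} k<K (isChildren v i j≤i l s) with m≤n⇒m<n∨m≡n j≤i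
      ... | inj₂ refl = member k (forests-complete (j * d) k<K (isForest v l (trans s (*-distribʳ-+ d j k))))
        where
        member : ∀ k → ts ∈ forests U (j * d) k → ts ∈ children U j k
        member zero ts∈ = ts∈
        member (suc k) ts∈ = ∈-++⁺ˡ ts∈
      -- Only jd edges are available, fewer than the id trees, each of which needs one.
      children-complete j zero {ts} k<K (isChildren v i j≤i l s) | inj₁ j<i =
        ⊥-elim (<⇒≱ (*-monoˡ-< d j<i)
          (≡.subst₂ _≤_ l (trans s (cong (_* d) (+-identityʳ j))) (length≤size ts)))
      children-complete j (suc k) {ts} k<K (isChildren v i j≤i l s) | inj₁ j<i =
        ∈-++⁺ʳ (forests U (j * d) (suc k))
          (children-complete (suc j) k (<-trans (n<1+n k) k<K) (isChildren v i j<i l (trans s (cong (_* d) (+-suc j k)))))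

  trees-sound : ∀ f {k t} → t ∈ trees f k → IsTree k t
  trees-sound (suc f) {k} t∈ with ∈-map⁻ node t∈
  ... | us , us∈ , refl with children-sound (trees-sound f) 0 k us∈
  ...   | isChildren v i _ l s = isTree ((divides i l , v) ∷ []) (cong suc (trans (+-identityʳ _) s))

  trees-unique : ∀ f k → Unique (trees f k)
  trees-unique zero k = []
  trees-unique (suc f) k = Unique.map⁺ (λ { refl → refl }) (children-unique (trees-sound f) (trees-unique f) 0 k)

  trees-complete : ∀ f {k t} → k < f → IsTree k t → t ∈ trees f k
  trees-complete (suc f) {k} {node us} k<1+f (isTree ((divides i l , v) ∷ []) s) = ∈-map⁺ node (top k k<1+f us i l v size-us)
    where
    size-us : size us ≡ k * d
    size-us = trans (sym (+-identityʳ _)) (suc-injective s)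
    top : ∀ k → k < suc f → ∀ us i → length us ≡ i * d → Divisible d us → size us ≡ k * d → us ∈ children (trees f) 0 k
    top zero _ [] _ _ _ _ = here refl
    top (suc k) (s≤s k<f) [] _ _ _ s with () ← *-cancelʳ-≡ 0 (suc k) d s
    top zero _ (node _ ∷ us) _ _ _ ()
    -- A nonempty list has at least d trees, whose planting edges use up one unit of the index. The
    -- remaining index is below `f`, where the enumeration with bound `f` is already complete.
    top (suc k) (s≤s k<f) us@(_ ∷ _) (suc i) l v s = ∈-++⁺ʳ (forests (trees f) 0 (suc k))
      (children-complete (trees-sound f) (trees-complete f) 1 k k<f (isChildren v (suc i) (s≤s z≤n) l s))

-- Formal power series

module PowerSeries {c ℓ} (R : CommutativeRing c ℓ) where
  open CommutativeRing R using (Carrier; _≈_; 0#; 1#; setoid; reflexive; distribˡ; distribʳ; zeroˡ; zeroʳ; +-commutativeMonoid; *-commutativeMonoid)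
    renaming (_+_ to _⊕_; _*_ to _⊗_; refl to ≈-refl; sym to ≈-sym; trans to ≈-trans;
      +-cong to ⊕-cong; +-congˡ to ⊕-congˡ; +-congʳ to ⊕-congʳ; +-assoc to ⊕-assoc;
      +-identityˡ to ⊕-identityˡ; +-identityʳ to ⊕-identityʳ;
      *-cong to ⊗-cong; *-congˡ to ⊗-congˡ; *-congʳ to ⊗-congʳ; *-assoc to ⊗-assoc;
      *-identityˡ to ⊗-identityˡ; *-identityʳ to ⊗-identityʳ)
  open WithRing R
  open SetoidReasoning setoid
  open CommutativeSemigroupProperties (CommutativeMonoid.commutativeSemigroup +-commutativeMonoid)
    using () renaming (interchange to ⊕-interchange)
  open CommutativeSemigroupProperties (CommutativeMonoid.commutativeSemigroup *-commutativeMonoid)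
    using () renaming (interchange to ⊗-interchange)

  Σ≤-suc : ∀ n f → Σ≤ (suc n) f ≡ f 0 ⊕ Σ≤ n (f ∘ suc)
  Σ≤-suc n f = cong (λ xs → f 0 ⊕ sumR xs)
    (≡.trans (map-applyUpTo suc f (suc n)) (≡.sym (map-applyUpTo id (f ∘ suc) (suc n))))

  Σ≤-cong : ∀ n {f g : ℕ → Carrier} → (∀ i → i ≤ n → f i ≈ g i) → Σ≤ n f ≈ Σ≤ n g
  Σ≤-cong zero e = ⊕-congʳ (e 0 z≤n)
  Σ≤-cong (suc n) {f} {g} e = begin
    Σ≤ (suc n) f            ≡⟨ Σ≤-suc n f ⟩
    f 0 ⊕ Σ≤ n (f ∘ suc)    ≈⟨ ⊕-cong (e 0 z≤n) (Σ≤-cong n (λ i i≤n → e (suc i) (s≤s i≤n))) ⟩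
    g 0 ⊕ Σ≤ n (g ∘ suc)    ≡⟨ Σ≤-suc n g ⟨
    Σ≤ (suc n) g            ∎

  ⊛-cong : ∀ n {f f′ g g′ : Series} → (∀ i → i ≤ n → f i ≈ f′ i) → (∀ i → i ≤ n → g i ≈ g′ i) →
           (f ⊛ g) n ≈ (f′ ⊛ g′) n
  ⊛-cong n e e′ = Σ≤-cong n λ i i≤n → ⊗-cong (e i i≤n) (e′ (n ∸ i) (m∸n≤m n i))

  ⊛-congˡ : ∀ n f {g g′ : Series} → (∀ i → g i ≈ g′ i) → (f ⊛ g) n ≈ (f ⊛ g′) n
  ⊛-congˡ n f e = ⊛-cong n {f} {f} (λ _ _ → ≈-refl) (λ i _ → e i)

  ⊛-congʳ : ∀ n g {f f′ : Series} → (∀ i → f i ≈ f′ i) → (f ⊛ g) n ≈ (f′ ⊛ g) n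
  ⊛-congʳ n g e = ⊛-cong n {g = g} {g} (λ i _ → e i) (λ _ _ → ≈-refl)

  ^ₛ-cong : ∀ m {n} {f g : Series} → (∀ i → i ≤ n → f i ≈ g i) → ∀ i → i ≤ n → (f ^ₛ m) i ≈ (g ^ₛ m) i
  ^ₛ-cong zero e i i≤n = ≈-refl
  ^ₛ-cong (suc m) e i i≤n = ⊛-cong i (λ j j≤i → e j (≤-trans j≤i i≤n)) (λ j j≤i → ^ₛ-cong m e j (≤-trans j≤i i≤n))

  ⊛-suc : ∀ f g n → (f ⊛ g) (suc n) ≡ f 0 ⊗ g (suc n) ⊕ ((f ∘ suc) ⊛ g) n
  ⊛-suc f g n = Σ≤-suc n (λ i → f i ⊗ g (suc n ∸ i))

  ⊛-zero : ∀ f g → (f ⊛ g) 0 ≈ f 0 ⊗ g 0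
  ⊛-zero f g = ⊕-identityʳ _

  ⊛-zeroˡ : ∀ g n → ((λ _ → 0#) ⊛ g) n ≈ 0#
  ⊛-zeroˡ g zero = ≈-trans (⊛-zero (λ _ → 0#) g) (zeroˡ _)
  ⊛-zeroˡ g (suc n) = begin
    ((λ _ → 0#) ⊛ g) (suc n)                ≡⟨ ⊛-suc _ g n ⟩
    0# ⊗ g (suc n) ⊕ ((λ _ → 0#) ⊛ g) n     ≈⟨ ⊕-cong (zeroˡ _) (⊛-zeroˡ g n) ⟩
    0# ⊕ 0#                                 ≈⟨ ⊕-identityˡ 0# ⟩
    0#                                      ∎

  ⊛-identityˡ : ∀ g n → (oneS ⊛ g) n ≈ g n
  ⊛-identityˡ g zero = ≈-trans (⊛-zero oneS g) (⊗-identityˡ _)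
  ⊛-identityˡ g (suc n) = begin
    (oneS ⊛ g) (suc n)                      ≡⟨ ⊛-suc oneS g n ⟩
    1# ⊗ g (suc n) ⊕ ((λ _ → 0#) ⊛ g) n     ≈⟨ ⊕-cong (⊗-identityˡ _) (⊛-zeroˡ g n) ⟩
    g (suc n) ⊕ 0#                          ≈⟨ ⊕-identityʳ _ ⟩
    g (suc n)                               ∎

  ⊛-identityʳ : ∀ f n → (f ⊛ oneS) n ≈ f n
  ⊛-identityʳ f zero = ≈-trans (⊛-zero f oneS) (⊗-identityʳ _)
  ⊛-identityʳ f (suc n) = begin
    (f ⊛ oneS) (suc n)                    ≡⟨ ⊛-suc f oneS n ⟩
    f 0 ⊗ 0# ⊕ ((f ∘ suc) ⊛ oneS) n       ≈⟨ ⊕-cong (zeroʳ _) (⊛-identityʳ (f ∘ suc) n) ⟩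
    0# ⊕ f (suc n)                        ≈⟨ ⊕-identityˡ _ ⟩
    f (suc n)                             ∎

  ⊛-distribʳ : ∀ f g h n → ((λ i → f i ⊕ g i) ⊛ h) n ≈ (f ⊛ h) n ⊕ (g ⊛ h) n
  ⊛-distribʳ f g h zero = begin
    ((λ i → f i ⊕ g i) ⊛ h) 0       ≈⟨ ⊛-zero (λ i → f i ⊕ g i) h ⟩
    (f 0 ⊕ g 0) ⊗ h 0               ≈⟨ distribʳ _ _ _ ⟩
    f 0 ⊗ h 0 ⊕ g 0 ⊗ h 0           ≈⟨ ⊕-cong (⊛-zero f h) (⊛-zero g h) ⟨
    (f ⊛ h) 0 ⊕ (g ⊛ h) 0           ∎
  ⊛-distribʳ f g h (suc n) = begin
    ((λ i → f i ⊕ g i) ⊛ h) (suc n)                                             ≡⟨ ⊛-suc _ h n ⟩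
    (f 0 ⊕ g 0) ⊗ h (suc n) ⊕ ((λ i → f (suc i) ⊕ g (suc i)) ⊛ h) n             ≈⟨ ⊕-cong (distribʳ _ _ _) (⊛-distribʳ (f ∘ suc) (g ∘ suc) h n) ⟩
    (f 0 ⊗ h (suc n) ⊕ g 0 ⊗ h (suc n)) ⊕ (((f ∘ suc) ⊛ h) n ⊕ ((g ∘ suc) ⊛ h) n) ≈⟨ ⊕-interchange _ _ _ _ ⟩
    (f 0 ⊗ h (suc n) ⊕ ((f ∘ suc) ⊛ h) n) ⊕ (g 0 ⊗ h (suc n) ⊕ ((g ∘ suc) ⊛ h) n) ≡⟨ ≡.cong₂ _⊕_ (⊛-suc f h n) (⊛-suc g h n) ⟨
    (f ⊛ h) (suc n) ⊕ (g ⊛ h) (suc n)                                           ∎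

  ⊛-scale : ∀ r s f g n → (scale r f ⊛ scale s g) n ≈ (r ⊗ s) ⊗ (f ⊛ g) n
  ⊛-scale r s f g zero = begin
    (scale r f ⊛ scale s g) 0         ≈⟨ ⊛-zero (scale r f) (scale s g) ⟩
    (r ⊗ f 0) ⊗ (s ⊗ g 0)             ≈⟨ ⊗-interchange _ _ _ _ ⟩
    (r ⊗ s) ⊗ (f 0 ⊗ g 0)             ≈⟨ ⊗-congˡ (⊛-zero f g) ⟨
    (r ⊗ s) ⊗ (f ⊛ g) 0               ∎
  ⊛-scale r s f g (suc n) = begin
    (scale r f ⊛ scale s g) (suc n)                                      ≡⟨ ⊛-suc (scale r f) (scale s g) n ⟩
    (r ⊗ f 0) ⊗ (s ⊗ g (suc n)) ⊕ (scale r (f ∘ suc) ⊛ scale s g) n      ≈⟨ ⊕-cong (⊗-interchange _ _ _ _) (⊛-scale r s (f ∘ suc) g n) ⟩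
    (r ⊗ s) ⊗ (f 0 ⊗ g (suc n)) ⊕ (r ⊗ s) ⊗ ((f ∘ suc) ⊛ g) n            ≈⟨ distribˡ _ _ _ ⟨
    (r ⊗ s) ⊗ (f 0 ⊗ g (suc n) ⊕ ((f ∘ suc) ⊛ g) n)                      ≡⟨ cong ((r ⊗ s) ⊗_) (⊛-suc f g n) ⟨
    (r ⊗ s) ⊗ (f ⊛ g) (suc n)                                            ∎

  ⊛-scaleˡ : ∀ r f g n → (scale r f ⊛ g) n ≈ r ⊗ (f ⊛ g) n
  ⊛-scaleˡ r f g n = begin
    (scale r f ⊛ g) n           ≈⟨ ⊛-congˡ n (scale r f) (λ i → ⊗-identityˡ (g i)) ⟨
    (scale r f ⊛ scale 1# g) n  ≈⟨ ⊛-scale r 1# f g n ⟩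
    (r ⊗ 1#) ⊗ (f ⊛ g) n        ≈⟨ ⊗-congʳ (⊗-identityʳ r) ⟩
    r ⊗ (f ⊛ g) n               ∎

  ⊛-assoc : ∀ f g h n → ((f ⊛ g) ⊛ h) n ≈ (f ⊛ (g ⊛ h)) n
  ⊛-assoc f g h zero = begin
    ((f ⊛ g) ⊛ h) 0         ≈⟨ ⊛-zero (f ⊛ g) h ⟩
    (f ⊛ g) 0 ⊗ h 0         ≈⟨ ⊗-congʳ (⊛-zero f g) ⟩
    (f 0 ⊗ g 0) ⊗ h 0       ≈⟨ ⊗-assoc _ _ _ ⟩
    f 0 ⊗ (g 0 ⊗ h 0)       ≈⟨ ⊗-congˡ (⊛-zero g h) ⟨
    f 0 ⊗ (g ⊛ h) 0         ≈⟨ ⊛-zero f (g ⊛ h) ⟨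
    (f ⊛ (g ⊛ h)) 0         ∎
  ⊛-assoc f g h (suc n) = begin
    ((f ⊛ g) ⊛ h) (suc n)
      ≡⟨ ⊛-suc (f ⊛ g) h n ⟩
    (f ⊛ g) 0 ⊗ h (suc n) ⊕ (((f ⊛ g) ∘ suc) ⊛ h) n
      ≈⟨ ⊕-cong (≈-trans (⊗-congʳ (⊛-zero f g)) (⊗-assoc _ _ _)) (⊛-congʳ n h (λ i → reflexive (⊛-suc f g i))) ⟩
    f 0 ⊗ (g 0 ⊗ h (suc n)) ⊕ ((λ i → f 0 ⊗ g (suc i) ⊕ ((f ∘ suc) ⊛ g) i) ⊛ h) n
      ≈⟨ ⊕-congˡ (⊛-distribʳ (scale (f 0) (g ∘ suc)) ((f ∘ suc) ⊛ g) h n) ⟩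
    f 0 ⊗ (g 0 ⊗ h (suc n)) ⊕ ((scale (f 0) (g ∘ suc) ⊛ h) n ⊕ (((f ∘ suc) ⊛ g) ⊛ h) n)
      ≈⟨ ⊕-congˡ (⊕-cong (⊛-scaleˡ (f 0) (g ∘ suc) h n) (⊛-assoc (f ∘ suc) g h n)) ⟩
    f 0 ⊗ (g 0 ⊗ h (suc n)) ⊕ (f 0 ⊗ ((g ∘ suc) ⊛ h) n ⊕ ((f ∘ suc) ⊛ (g ⊛ h)) n)
      ≈⟨ ⊕-assoc _ _ _ ⟨
    (f 0 ⊗ (g 0 ⊗ h (suc n)) ⊕ f 0 ⊗ ((g ∘ suc) ⊛ h) n) ⊕ ((f ∘ suc) ⊛ (g ⊛ h)) n
      ≈⟨ ⊕-congʳ (distribˡ _ _ _) ⟨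
    f 0 ⊗ (g 0 ⊗ h (suc n) ⊕ ((g ∘ suc) ⊛ h) n) ⊕ ((f ∘ suc) ⊛ (g ⊛ h)) n
      ≡⟨ cong (λ z → f 0 ⊗ z ⊕ ((f ∘ suc) ⊛ (g ⊛ h)) n) (⊛-suc g h n) ⟨
    f 0 ⊗ (g ⊛ h) (suc n) ⊕ ((f ∘ suc) ⊛ (g ⊛ h)) n
      ≡⟨ ⊛-suc f (g ⊛ h) n ⟨
    (f ⊛ (g ⊛ h)) (suc n) ∎

  ^ₛ-+ : ∀ f j k n → (f ^ₛ (j + k)) n ≈ ((f ^ₛ j) ⊛ (f ^ₛ k)) n
  ^ₛ-+ f zero k n = ≈-sym (⊛-identityˡ (f ^ₛ k) n)
  ^ₛ-+ f (suc j) k n = ≈-trans (⊛-congˡ n f (^ₛ-+ f j k)) (≈-sym (⊛-assoc f (f ^ₛ j) (f ^ₛ k) n))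

  ^ₛ-* : ∀ f d j n → ((f ^ₛ d) ^ₛ j) n ≈ (f ^ₛ (j * d)) n
  ^ₛ-* f d zero n = ≈-refl
  ^ₛ-* f d (suc j) n = ≈-trans (⊛-congˡ n (f ^ₛ d) (^ₛ-* f d j)) (≈-sym (^ₛ-+ f d (j * d) n))

  xTimes-cong : ∀ {f g : Series} → (∀ i → f i ≈ g i) → ∀ n → xTimes f n ≈ xTimes g n
  xTimes-cong e zero    = ≈-refl
  xTimes-cong e (suc n) = e n

  xTimes-⊛ : ∀ f g n → (xTimes f ⊛ g) n ≈ xTimes (f ⊛ g) n
  xTimes-⊛ f g zero = ≈-trans (⊛-zero (xTimes f) g) (zeroˡ _)
  xTimes-⊛ f g (suc n) = begin
    (xTimes f ⊛ g) (suc n)          ≡⟨ ⊛-suc (xTimes f) g n ⟩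
    0# ⊗ g (suc n) ⊕ (f ⊛ g) n      ≈⟨ ⊕-congʳ (zeroˡ _) ⟩
    0# ⊕ (f ⊛ g) n                  ≈⟨ ⊕-identityˡ _ ⟩
    (f ⊛ g) n                       ∎

  ⊛-xTimes : ∀ f g n → (f ⊛ xTimes g) n ≈ xTimes (f ⊛ g) n
  ⊛-xTimes f g zero = ≈-trans (⊛-zero f (xTimes g)) (zeroʳ _)
  ⊛-xTimes f g (suc zero) = begin
    (f ⊛ xTimes g) 1                        ≡⟨ ⊛-suc f (xTimes g) 0 ⟩
    f 0 ⊗ g 0 ⊕ ((f ∘ suc) ⊛ xTimes g) 0    ≈⟨ ⊕-congˡ (⊛-xTimes (f ∘ suc) g 0) ⟩
    f 0 ⊗ g 0 ⊕ 0#                          ∎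
  ⊛-xTimes f g (suc (suc n)) = begin
    (f ⊛ xTimes g) (suc (suc n))                       ≡⟨ ⊛-suc f (xTimes g) (suc n) ⟩
    f 0 ⊗ g (suc n) ⊕ ((f ∘ suc) ⊛ xTimes g) (suc n)   ≈⟨ ⊕-congˡ (⊛-xTimes (f ∘ suc) g (suc n)) ⟩
    f 0 ⊗ g (suc n) ⊕ ((f ∘ suc) ⊛ g) n                ≡⟨ ⊛-suc f g n ⟨
    (f ⊛ g) (suc n)                                    ∎

  shift : ℕ → Series → Series
  shift zero    f = f
  shift (suc j) f = xTimes (shift j f)

  shift-cong : ∀ j {f g : Series} → (∀ i → f i ≈ g i) → ∀ n → shift j f n ≈ shift j g n
  shift-cong zero    e = e
  shift-cong (suc j) e = xTimes-cong (shift-cong j e)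

  ⊛-shift : ∀ j f g n → (f ⊛ shift j g) n ≈ shift j (f ⊛ g) n
  ⊛-shift zero    f g n = ≈-refl
  ⊛-shift (suc j) f g n = ≈-trans (⊛-xTimes f (shift j g) n) (xTimes-cong (⊛-shift j f g) n)

  shift-∸ : ∀ j {n} f → j ≤ n → shift j f n ≡ f (n ∸ j)
  shift-∸ zero    f _ = refl
  shift-∸ (suc j) f (s≤s j≤n) = shift-∸ j f j≤n

  xTimes-^ₛ : ∀ s H j n → (xTimes (scale s H) ^ₛ j) n ≈ shift j (scale (pow s j) (H ^ₛ j)) n
  xTimes-^ₛ s H zero n = ≈-sym (⊗-identityˡ _)
  xTimes-^ₛ s H (suc j) n = begin
    (xTimes (scale s H) ⊛ (xTimes (scale s H) ^ₛ j)) n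
      ≈⟨ ⊛-congˡ n (xTimes (scale s H)) (xTimes-^ₛ s H j) ⟩
    (xTimes (scale s H) ⊛ shift j (scale (pow s j) (H ^ₛ j))) n
      ≈⟨ xTimes-⊛ (scale s H) _ n ⟩
    xTimes (scale s H ⊛ shift j (scale (pow s j) (H ^ₛ j))) n
      ≈⟨ xTimes-cong (⊛-shift j (scale s H) _) n ⟩
    xTimes (shift j (scale s H ⊛ scale (pow s j) (H ^ₛ j))) n
      ≈⟨ shift-cong (suc j) (⊛-scale s (pow s j) H (H ^ₛ j)) n ⟩
    shift (suc j) (scale (pow s (suc j)) (H ^ₛ suc j)) n ∎

  -- The coefficient of x^n in A(x s G^d), written in the form that the tree recursion produces:
  -- `j * d` is the number of children of the root.
  composeExpanded : Series → Carrier → ℕ → Series → Series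
  composeExpanded A s d G n = Σ≤ n (λ j → (A j ⊗ pow s j) ⊗ (G ^ₛ (j * d)) (n ∸ j))

  compose-expand : ∀ A s d G n → compose A (xTimes (scale s (G ^ₛ d))) n ≈ composeExpanded A s d G n
  compose-expand A s d G n = Σ≤-cong n λ j j≤n → begin
    A j ⊗ (xTimes (scale s (G ^ₛ d)) ^ₛ j) n              ≈⟨ ⊗-congˡ (xTimes-^ₛ s (G ^ₛ d) j n) ⟩
    A j ⊗ shift j (scale (pow s j) ((G ^ₛ d) ^ₛ j)) n     ≡⟨ cong (A j ⊗_) (shift-∸ j _ j≤n) ⟩
    A j ⊗ (pow s j ⊗ ((G ^ₛ d) ^ₛ j) (n ∸ j))             ≈⟨ ⊗-assoc _ _ _ ⟨
    (A j ⊗ pow s j) ⊗ ((G ^ₛ d) ^ₛ j) (n ∸ j)             ≈⟨ ⊗-congˡ (^ₛ-* G d j (n ∸ j)) ⟩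
    (A j ⊗ pow s j) ⊗ (G ^ₛ (j * d)) (n ∸ j)              ∎

  -- The term j = 0 contains the power 0, which is the same for both series; a term with j ≥ 1
  -- involves only coefficients up to n - j. This supports both the uniqueness of the solution and
  -- the depth bound in the enumeration.
  Σ-power-cong : ∀ (α : Series) d n {F G : Series} → (∀ i → i < n → F i ≈ G i) →
    Σ≤ n (λ j → α j ⊗ (F ^ₛ (j * d)) (n ∸ j)) ≈ Σ≤ n (λ j → α j ⊗ (G ^ₛ (j * d)) (n ∸ j))
  Σ-power-cong α d n {F} {G} e = Σ≤-cong n λ j j≤n → ⊗-congˡ (power j j≤n)
    where
    power : ∀ j → j ≤ n → (F ^ₛ (j * d)) (n ∸ j) ≈ (G ^ₛ (j * d)) (n ∸ j)
    power zero _ = ≈-refl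
    power (suc j) j<n = ^ₛ-cong (suc j * d)
      (λ i i≤ → e i (≤-<-trans i≤ (subst (n ∸ suc j <_) (m∸n+n≡m j<n) (m<m+n (n ∸ suc j) (s≤s z≤n))))) (n ∸ suc j) ≤-refl

  solution-unique : ∀ A A* s t d {F G F′ G′ : Series} →
    (∀ n → F n ≈ composeExpanded A* s d G n) → (∀ n → G n ≈ composeExpanded A t d F n) →
    (∀ n → F′ n ≈ composeExpanded A* s d G′ n) → (∀ n → G′ n ≈ composeExpanded A t d F′ n) →
    ∀ n → (F n ≈ F′ n) × (G n ≈ G′ n)
  solution-unique A A* s t d {F} {G} {F′} {G′} eF eG eF′ eG′ n = below (suc n) n ≤-refl
    where
    below : ∀ m i → i < m → (F i ≈ F′ i) × (G i ≈ G′ i)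
    below (suc m) i (s≤s i≤m) =
      ≈-trans (eF i) (≈-trans (Σ-power-cong _ d i (λ j j<i → proj₂ (below m j (<-≤-trans j<i i≤m)))) (≈-sym (eF′ i))) ,
      ≈-trans (eG i) (≈-trans (Σ-power-cong _ d i (λ j j<i → proj₁ (below m j (<-≤-trans j<i i≤m)))) (≈-sym (eG′ i)))

-- Weights

module _ {c ℓ} (M : CommutativeMonoid c ℓ) where
  open CommutativeMonoid M using (Carrier; _∙_; ε; _≈_; ∙-cong; ∙-congˡ; identityˡ; commutativeSemigroup)
    renaming (sym to ≈-sym; trans to ≈-trans)
  open CommutativeSemigroupProperties commutativeSemigroup using (interchange)

  mutual
    foldWhite-∙ : ∀ (gB gW hB hW : ℕ → Carrier) ts →
      TreeFold.foldWhite M (λ m → gB m ∙ hB m) (λ m → gW m ∙ hW m) ts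
        ≈ TreeFold.foldWhite M gB gW ts ∙ TreeFold.foldWhite M hB hW ts
    foldWhite-∙ gB gW hB hW [] = ≈-sym (identityˡ ε)
    foldWhite-∙ gB gW hB hW (node us ∷ ts) =
      ≈-trans (∙-cong (≈-trans (∙-congˡ (foldBlack-∙ gB gW hB hW us)) (interchange _ _ _ _)) (foldWhite-∙ gB gW hB hW ts))
        (interchange _ _ _ _)

    foldBlack-∙ : ∀ (gB gW hB hW : ℕ → Carrier) ts →
      TreeFold.foldBlack M (λ m → gB m ∙ hB m) (λ m → gW m ∙ hW m) ts
        ≈ TreeFold.foldBlack M gB gW ts ∙ TreeFold.foldBlack M hB hW ts
    foldBlack-∙ gB gW hB hW [] = ≈-sym (identityˡ ε)
    foldBlack-∙ gB gW hB hW (node us ∷ ts) =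
      ≈-trans (∙-cong (≈-trans (∙-congˡ (foldWhite-∙ gB gW hB hW us)) (interchange _ _ _ _)) (foldBlack-∙ gB gW hB hW ts))
        (interchange _ _ _ _)

  module _ (φ : ℕ → Carrier) (φ-0 : φ 0 ≈ ε) (φ-+ : ∀ j k → φ (j + k) ≈ φ j ∙ φ k) (eB eW : ℕ → ℕ) where
    private
      module E = TreeFold +-0-commutativeMonoid eB eW
      module F = TreeFold M (φ ∘ eB) (φ ∘ eW)

    mutual
      -- With φ a power of s or t, this distributes an exponent that is a sum over vertices as one
      -- factor per vertex.
      foldWhite-hom : ∀ ts → φ (E.foldWhite ts) ≈ F.foldWhite ts
      foldWhite-hom [] = φ-0
      foldWhite-hom (node us ∷ ts) =
        ≈-trans (φ-+ _ _) (∙-cong (≈-trans (φ-+ _ _) (∙-congˡ (foldBlack-hom us))) (foldWhite-hom ts))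

      foldBlack-hom : ∀ ts → φ (E.foldBlack ts) ≈ F.foldBlack ts
      foldBlack-hom [] = φ-0
      foldBlack-hom (node us ∷ ts) =
        ≈-trans (φ-+ _ _) (∙-cong (≈-trans (φ-+ _ _) (∙-congˡ (foldWhite-hom us))) (foldBlack-hom ts))

mutual
  -- A `Tree` does not record colours, so exchanging the two functions exchanges white and black
  -- forests. This transfers the count of black vertices to white ones.
  foldWhite-swap : ∀ (gB gW : ℕ → ℕ) ts →
    TreeFold.foldWhite +-0-commutativeMonoid gB gW ts ≡ TreeFold.foldBlack +-0-commutativeMonoid gW gB ts
  foldWhite-swap gB gW [] = refl
  foldWhite-swap gB gW (node us ∷ ts) =
    cong₂ _+_ (cong (gW (suc (length us)) +_) (sym (foldWhite-swap gW gB us))) (foldWhite-swap gB gW ts)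

module _ (d : ℕ) .{{_ : NonZero d}} where

  quotient : ℕ → ℕ
  quotient m = (m ∸ 1) / d

  quotient-suc : ∀ m → quotient (suc (m * d)) ≡ m
  quotient-suc m = m*n/n≡m m d

  private
    module #Black = TreeFold +-0-commutativeMonoid (λ _ → 1) (λ _ → 0)
    module #White = TreeFold +-0-commutativeMonoid (λ _ → 0) (λ _ → 1)

  module WhiteQuotients = TreeFold +-0-commutativeMonoid (λ _ → 0) quotient
  module BlackQuotients = TreeFold +-0-commutativeMonoid quotient (λ _ → 0)

  -- The black nodes of a forest are its roots, if black, and the children of its white nodes.
  mutual
    black-count-white : ∀ {ts} → Divisible d ts → #Black.foldWhite ts ≡ WhiteQuotients.foldWhite ts * d
    black-count-white [] = refl
    black-count-white {node us ∷ ts} ((divides k e , u) ∷ v) =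
      trans (cong₂ _+_ (black-count-black u) (black-count-white v))
        (trans (cong (λ m → (m + WhiteQuotients.foldBlack us * d) + WhiteQuotients.foldWhite ts * d)
                     (trans e (cong (_* d) (sym (trans (cong (λ m → quotient (suc m)) e) (quotient-suc k))))))
          (solve 4 (λ k l m d → (k :* d :+ l :* d) :+ m :* d := (k :+ l :+ m) :* d) refl
            (quotient (suc (length us))) (WhiteQuotients.foldBlack us) (WhiteQuotients.foldWhite ts) d))
      where open +-*-Solver

    black-count-black : ∀ {ts} → Divisible d ts → #Black.foldBlack ts ≡ length ts + WhiteQuotients.foldBlack ts * d
    black-count-black [] = refl
    black-count-black {node us ∷ ts} ((_ , u) ∷ v) =
      trans (cong₂ (λ x y → suc x + y) (black-count-white u) (black-count-black v))
        (solve 4 (λ k n l d → con 1 :+ k :* d :+ (n :+ l :* d) := con 1 :+ n :+ (k :+ l) :* d) refl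
          (WhiteQuotients.foldWhite us) (length ts) (WhiteQuotients.foldBlack ts) d)
      where open +-*-Solver

  white-count-white : ∀ {ts} → Divisible d ts → #White.foldWhite ts ≡ length ts + BlackQuotients.foldWhite ts * d
  white-count-white {ts} v = trans (foldWhite-swap _ _ ts)
    (trans (black-count-black v) (cong (λ m → length ts + m * d) (sym (foldWhite-swap _ _ ts))))

  module _ {n : ℕ} (0<n : 0 < n) {π σ : Labelling n} {ts : List Tree} (E : Encodes (π , σ) ts) (D : DivisibleForest d ts) where
    open ℕList using (foldMap)
    open DivisibleForest D

    private
      foldMap-0 : ∀ {A : Set} (xs : List A) → foldMap (λ _ → 0) xs ≡ 0
      foldMap-0 [] = refl
      foldMap-0 (_ ∷ xs) = foldMap-0 xs

    -- Besides the root, the black vertices are the children of the white ones, so |π| - 1 is d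
    -- times the sum of the white quotients.
    numBlocks-quotient : quotient (numBlocks π) ≡ WhiteQuotients.foldWhite ts
    numBlocks-quotient = trans (cong quotient blocks) (quotient-suc _)
      where
      blocks : numBlocks π ≡ suc (WhiteQuotients.foldWhite ts * d)
      blocks = trans (length≡foldMap (reps π)) (trans (sym (+-identityʳ _))
        (trans (cong (foldMap (λ _ → 1) (reps π) +_) (sym (foldMap-0 (reps σ))))
          (trans (blocks-fold 0<n E +-0-commutativeMonoid (λ _ → 1) (λ _ → 0)) (cong suc (black-count-white children)))))

    -- The white vertices are the children of all black ones, the root included. The root has one
    -- child more than d times its quotient, and this child is the 1 that is subtracted from |π′|.
    dual-numBlocks-quotient : 0 < length ts → quotient (numBlocks σ) ≡ quotient (length ts) + BlackQuotients.foldWhite ts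
    dual-numBlocks-quotient 0<len with root
    ... | divides k e = trans (cong quotient blocks) (trans (quotient-suc _) (cong (_+ BlackQuotients.foldWhite ts) (sym (trans (cong quotient len) (quotient-suc k)))))
      where
      len : length ts ≡ suc (k * d)
      len = trans (sym (m+[n∸m]≡n 0<len)) (cong suc e)
      blocks : numBlocks σ ≡ suc ((k + BlackQuotients.foldWhite ts) * d)
      blocks = trans (length≡foldMap (reps σ)) (trans (cong (_+ foldMap (λ _ → 1) (reps σ)) (sym (foldMap-0 (reps π))))
        (trans (blocks-fold 0<n E +-0-commutativeMonoid (λ _ → 0) (λ _ → 1))
          (trans (white-count-white children) (trans (cong (_+ BlackQuotients.foldWhite ts * d) len)
            (cong suc (sym (*-distribʳ-+ d k (BlackQuotients.foldWhite ts))))))))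

-- Noncrossing partitions as pairs of planted trees

module RootedPairs (d : ℕ) .{{_ : NonZero d}} where
  open Enumeration d

  treePairs : ℕ → ℕ → List (Tree × Tree)
  treePairs f = convolution (trees f) (trees f)

  -- The two trees hang from the edge joining 1 and 1′: the first has the block of 1′ as root, the second the
  -- block of 1.
  record Represents {n} (x : Labelling n × Labelling n) (y : Tree × Tree) : Set where
    constructor represents
    field
      {left}    : Tree
      {right}   : List Tree
      pair≡     : y ≡ (left , node right)
      encodes   : Encodes x (left ∷ right)
      divisible : DivisibleForest d (left ∷ right)

  represents-functional : ∀ {n} {x : Labelling n × Labelling n} {y y′} → Represents x y → Represents x y′ → y ≡ y′
  represents-functional (represents refl E _) (represents refl E′ _) with refl ← white-unique z≤n E E′ = refl

  ∈-NCdPairs⁻ : ∀ {n} → 0 < n → ∀ {x} → x ∈ NCdPairs d n → ∃ λ ts → Encodes x ts × DivisibleForest d ts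
  ∈-NCdPairs⁻ {n} 0<n x∈ =
    isNCdPair⇒encodes 0<n (proj₂ (keep-∈⁻ (isNCdPair d) (cartesianProduct (allFuns n n) (allFuns n n)) x∈))

  ∈-NCdPairs⁺ : ∀ {n} → 0 < n → ∀ {ts} → size ts ≡ n → DivisibleForest d ts → ∃ λ x → x ∈ NCdPairs d n × Encodes x ts
  ∈-NCdPairs⁺ {n} 0<n {ts} sz D =
    let π , σ , E        = encode ts sz
        π′ , π′∈ , π′≗π = allFuns-complete n π
        σ′ , σ′∈ , σ′≗σ = allFuns-complete n σ
        E′               = encodes-resp (λ x → sym (π′≗π x)) (λ x → sym (σ′≗σ x)) E
    in (π′ , σ′) , keep-∈ (isNCdPair d) (∈-cartesianProduct⁺ π′∈ σ′∈) (encodes⇒isNCdPair 0<n E′ D) , E′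

  ∈-treePairs⁺ : ∀ f k → k < f → ∀ {t us} → size (t ∷ us) ≡ suc (k * d) → DivisibleForest d (t ∷ us) →
                 (t , node us) ∈ treePairs f k
  ∈-treePairs⁺ f k k<f {t} {us} sz (divisibleForest (divides c e) v@(_ ∷ v₁)) =
    let K , szK                            = divisible-size v
        i , j , i+j≡K , T₀ , isForest _ _ s₁ = isTree-uncons {c * d} {K} (isForest v (cong suc e) (trans szK (cong (λ m → suc m + K * d) e)))
    in conclude i j T₀ s₁ (suc-injective (trans (sym sz) (trans szK (cong₂ (λ l m → suc l + m * d) e (sym i+j≡K)))))
    where
    conclude : ∀ i j → IsTree i t → size us ≡ c * d + j * d → k * d ≡ c * d + (i + j) * d → (t , node us) ∈ treePairs f k
    -- Of the 1 + cd children of the root, the first becomes the left tree. The right tree keeps cd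
    -- children; their number adds `c` to the index `j` of the forest they form.
    conclude i j T₀ s₁ kd = subst (λ m → (t , node us) ∈ treePairs f m) k≡
      (∈-convolution⁺ i (c + j) (trees-complete f (≤-<-trans (≤-trans (m≤m+n i (c + j)) (≤-reflexive k≡)) k<f) T₀)
        (trees-complete f (≤-<-trans (≤-trans (m≤n+m (c + j) i) (≤-reflexive k≡)) k<f) T₁))
      where
      open +-*-Solver
      k≡ : i + (c + j) ≡ k
      k≡ = *-cancelʳ-≡ _ k d (trans
        (solve 4 (λ i c j d → (i :+ (c :+ j)) :* d := c :* d :+ (i :+ j) :* d) refl i c j d) (sym kd))
      T₁ : IsTree (c + j) (node us)
      T₁ = isTree ((divides c e , v₁) ∷ []) (cong suc (trans (+-identityʳ _) (trans s₁ (sym (*-distribʳ-+ d c j)))))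

  ∈-treePairs⁻ : ∀ f k {y} → y ∈ treePairs f k → ∃ λ t → ∃ λ us →
                 y ≡ (t , node us) × size (t ∷ us) ≡ suc (k * d) × DivisibleForest d (t ∷ us)
  ∈-treePairs⁻ f k {t₀ , t₁} y∈ with ∈-convolution⁻ (trees f) (trees f) k y∈
  ∈-treePairs⁻ f k {node ts , node us} y∈ | i , j , refl , t₀∈ , t₁∈
    with trees-sound f t₀∈ | trees-sound f t₁∈
  ... | isTree (v₀ ∷ []) s₀ | isTree ((divides c e , v) ∷ []) s₁ =
    node ts , us , refl , size≡ , divisibleForest (divides c e) (v₀ ∷ v)
    where
    size≡ : size (node ts ∷ us) ≡ suc ((i + j) * d)
    size≡ = cong suc (trans (cong₂ _+_ (suc-injective (trans (cong suc (sym (+-identityʳ _))) s₀))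
                                       (suc-injective (trans (cong suc (sym (+-identityʳ _))) s₁)))
              (sym (*-distribʳ-+ d i j)))

  module _ (f k n : ℕ) (k<f : k < f) (n≡ : n ≡ suc (k * d)) where

    private
      0<n : 0 < n
      0<n = subst (0 <_) (sym n≡) (s≤s z≤n)

    represents-into : ∀ {x} → x ∈ NCdPairs d n → ∃ λ y → y ∈ treePairs f k × Represents x y
    represents-into {x} x∈ = let ts , E , D = ∈-NCdPairs⁻ 0<n x∈ in pair ts E D
      where
      pair : ∀ ts → Encodes x ts → DivisibleForest d ts → ∃ λ y → y ∈ treePairs f k × Represents x y
      pair [] E _ = ⊥-elim (<-irrefl (sym (white-end E)) 0<n)
      pair (t ∷ us) E D = (t , node us) , ∈-treePairs⁺ f k k<f (trans (sym (white-end E)) n≡) D , represents refl E D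

    represents-onto : ∀ {y} → y ∈ treePairs f k → ∃ λ x → x ∈ NCdPairs d n × Represents x y
    represents-onto y∈ =
      let t , us , y≡ , sz , D = ∈-treePairs⁻ f k y∈
          x , x∈ , E           = ∈-NCdPairs⁺ 0<n (trans sz (sym n≡)) D
      in x , x∈ , represents y≡ E D

    module _ {a ℓ} (M : CommutativeMonoid a ℓ) where
      open CommutativeMonoid M using (Carrier; _≈_)
      open ListFold M using (foldMap)

      foldMap-NCdPairs : ∀ {w : Labelling n × Labelling n → Carrier} {v : Tree × Tree → Carrier} →
        (∀ {x y} → Represents x y → w x ≈ v y) → foldMap w (NCdPairs d n) ≈ foldMap v (treePairs f k)
      foldMap-NCdPairs w≈v = Bijection.foldMap-bijection M Represents w≈v represents-functional
        (AllPairs.map (λ x≉x′ _ r r′ → x≉x′ (pointwise r r′)) (NCdPairs-unique d n))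
        (convolution-unique (trees f) (trees f) k (trees-unique f) (trees-unique f)
          (λ t∈ t∈′ → isTree-unique (trees-sound f t∈) (trees-sound f t∈′)))
        represents-into represents-onto
        where
        pointwise : ∀ {x x′ y} → Represents x y → Represents x′ y → PointwisePair x x′
        pointwise (represents refl E _) (represents refl E′ _) = encodes-pointwise E E′

-- Sums over trees as power series

module GeneratingFunctions {c ℓ} (R : CommutativeRing c ℓ) (d : ℕ) .{{_ : NonZero d}} where
  open CommutativeRing R using (Carrier; _≈_; 0#; 1#; setoid; reflexive; distribˡ; distribʳ; zeroˡ; zeroʳ; +-commutativeMonoid; *-commutativeMonoid)
    renaming (_+_ to _⊕_; _*_ to _⊗_; refl to ≈-refl; sym to ≈-sym; trans to ≈-trans;
      +-cong to ⊕-cong; +-congˡ to ⊕-congˡ; +-congʳ to ⊕-congʳ; +-assoc to ⊕-assoc;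
      +-identityˡ to ⊕-identityˡ; +-identityʳ to ⊕-identityʳ;
      *-cong to ⊗-cong; *-congˡ to ⊗-congˡ; *-congʳ to ⊗-congʳ; *-assoc to ⊗-assoc;
      *-identityˡ to ⊗-identityˡ; *-identityʳ to ⊗-identityʳ)
  open WithRing R
  open PowerSeries R
  open Enumeration d
  open RootedPairs d
  open SetoidReasoning setoid
  open CommutativeSemigroupProperties (CommutativeMonoid.commutativeSemigroup *-commutativeMonoid)
    using () renaming (interchange to ⊗-interchange; x∙yz≈y∙xz to x⊗yz≈y⊗xz)
  open ListFold +-commutativeMonoid using () renaming (foldMap to sumOver; foldMap-keep to sumOver-keep)

  sumOver-cong : ∀ {A : Set} {u v : A → Carrier} xs → (∀ {x} → x ∈ xs → u x ≈ v x) → sumOver u xs ≈ sumOver v xs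
  sumOver-cong [] _ = ≈-refl
  sumOver-cong (x ∷ xs) e = ⊕-cong (e (here refl)) (sumOver-cong xs (e ∘ there))

  sumOver-scale : ∀ {A : Set} r (u : A → Carrier) xs → sumOver (λ x → r ⊗ u x) xs ≈ r ⊗ sumOver u xs
  sumOver-scale r u [] = ≈-sym (zeroʳ r)
  sumOver-scale r u (x ∷ xs) = ≈-trans (⊕-congˡ (sumOver-scale r u xs)) (≈-sym (distribˡ _ _ _))

  sumOver-++ : ∀ {A : Set} (u : A → Carrier) xs ys → sumOver u (xs ++ ys) ≈ sumOver u xs ⊕ sumOver u ys
  sumOver-++ u [] ys = ≈-sym (⊕-identityˡ _)
  sumOver-++ u (x ∷ xs) ys = ≈-trans (⊕-congˡ (sumOver-++ u xs ys)) (≈-sym (⊕-assoc _ _ _))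

  sumOver-map : ∀ {A B : Set} (u : B → Carrier) (f : A → B) xs → sumOver u (map f xs) ≡ sumOver (u ∘ f) xs
  sumOver-map u f xs = cong sumR (sym (map-∘ xs))

  sumOver-product : ∀ {A B : Set} (u : A → Carrier) (v : B → Carrier) xs ys →
    sumOver (λ z → u (proj₁ z) ⊗ v (proj₂ z)) (cartesianProduct xs ys) ≈ sumOver u xs ⊗ sumOver v ys
  sumOver-product u v [] ys = ≈-sym (zeroˡ _)
  sumOver-product u v (x ∷ xs) ys = begin
    sumOver w (map (x ,_) ys ++ cartesianProduct xs ys)          ≈⟨ sumOver-++ w (map (x ,_) ys) _ ⟩
    sumOver w (map (x ,_) ys) ⊕ sumOver w (cartesianProduct xs ys) ≈⟨ ⊕-cong (≈-trans (reflexive (sumOver-map w (x ,_) ys)) (sumOver-scale (u x) v ys)) (sumOver-product u v xs ys) ⟩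
    u x ⊗ sumOver v ys ⊕ sumOver u xs ⊗ sumOver v ys             ≈⟨ distribʳ _ _ _ ⟨
    (u x ⊕ sumOver u xs) ⊗ sumOver v ys                          ∎
    where w = λ z → u (proj₁ z) ⊗ v (proj₂ z)

  sumOver-convolution : ∀ {A B : Set} (u : A → Carrier) (v : B → Carrier) F G n →
    sumOver (λ z → u (proj₁ z) ⊗ v (proj₂ z)) (convolution F G n) ≈ ((λ i → sumOver u (F i)) ⊛ (λ j → sumOver v (G j))) n
  sumOver-convolution u v F G zero = ≈-trans (sumOver-product u v (F 0) (G 0))
    (≈-sym (⊛-zero (λ i → sumOver u (F i)) (λ j → sumOver v (G j))))
  sumOver-convolution u v F G (suc n) = begin
    sumOver w (cartesianProduct (F 0) (G (suc n)) ++ convolution (F ∘ suc) G n)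
      ≈⟨ sumOver-++ w (cartesianProduct (F 0) (G (suc n))) _ ⟩
    sumOver w (cartesianProduct (F 0) (G (suc n))) ⊕ sumOver w (convolution (F ∘ suc) G n)
      ≈⟨ ⊕-cong (sumOver-product u v (F 0) (G (suc n))) (sumOver-convolution u v (F ∘ suc) G n) ⟩
    sumOver u (F 0) ⊗ sumOver v (G (suc n)) ⊕ ((λ i → sumOver u (F (suc i))) ⊛ (λ j → sumOver v (G j))) n
      ≡⟨ ⊛-suc (λ i → sumOver u (F i)) (λ j → sumOver v (G j)) n ⟨
    ((λ i → sumOver u (F i)) ⊛ (λ j → sumOver v (G j))) (suc n) ∎
    where w = λ z → u (proj₁ z) ⊗ v (proj₂ z)

  forestProduct : (Tree → Carrier) → List Tree → Carrier
  forestProduct u = foldr (λ t x → u t ⊗ x) 1#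

  module _ {U : ℕ → List Tree} (sound : ∀ {k t} → t ∈ U k → IsTree k t) (u : Tree → Carrier) where

    private
      S : Series
      S i = sumOver u (U i)

    sumOver-forests : ∀ m k → sumOver (forestProduct u) (forests U m k) ≈ (S ^ₛ m) k
    sumOver-forests zero zero = ⊕-identityʳ 1#
    sumOver-forests zero (suc k) = ≈-refl
    sumOver-forests (suc m) k = begin
      sumOver (forestProduct u) (map (uncurry _∷_) (convolution U (forests U m) k))
        ≡⟨ sumOver-map (forestProduct u) (uncurry _∷_) (convolution U (forests U m) k) ⟩
      sumOver (λ z → u (proj₁ z) ⊗ forestProduct u (proj₂ z)) (convolution U (forests U m) k)
        ≈⟨ sumOver-convolution u (forestProduct u) U (forests U m) k ⟩
      (S ⊛ (λ j → sumOver (forestProduct u) (forests U m j))) k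
        ≈⟨ ⊛-congˡ k S (sumOver-forests m) ⟩
      (S ⊛ (S ^ₛ m)) k ∎

    module _ (g : ℕ → Carrier) where

      private
        weight : List Tree → Carrier
        weight ts = g (length ts) ⊗ forestProduct u ts

      sumOver-forests-weighted : ∀ m k → sumOver weight (forests U m k) ≈ g m ⊗ (S ^ₛ m) k
      sumOver-forests-weighted m k = begin
        sumOver weight (forests U m k)                          ≈⟨ sumOver-cong (forests U m k) (λ ts∈ →
          reflexive (cong (λ l → g l ⊗ _) (IsForest.length≡ (forests-sound sound m ts∈)))) ⟩
        sumOver (λ ts → g m ⊗ forestProduct u ts) (forests U m k) ≈⟨ sumOver-scale (g m) (forestProduct u) (forests U m k) ⟩
        g m ⊗ sumOver (forestProduct u) (forests U m k)          ≈⟨ ⊗-congˡ (sumOver-forests m k) ⟩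
        g m ⊗ (S ^ₛ m) k                                         ∎

      -- The offset `j` follows the recursion of `children`; the theorem on series uses `j = 0`,
      -- where `i * d` is the number of children.
      sumOver-children : ∀ j k → sumOver weight (children U j k) ≈ Σ≤ k (λ i → g ((j + i) * d) ⊗ (S ^ₛ ((j + i) * d)) (k ∸ i))
      sumOver-children j zero = begin
        sumOver weight (forests U (j * d) 0)                  ≈⟨ sumOver-forests-weighted (j * d) 0 ⟩
        term j                                                ≡⟨ cong term (+-identityʳ j) ⟨
        term (j + 0)                                          ≈⟨ ⊕-identityʳ _ ⟨
        Σ≤ 0 (λ i → g ((j + i) * d) ⊗ (S ^ₛ ((j + i) * d)) (0 ∸ i)) ∎
        where
        term : ℕ → Carrier
        term i = g (i * d) ⊗ (S ^ₛ (i * d)) 0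
      sumOver-children j (suc k) = begin
        sumOver weight (forests U (j * d) (suc k) ++ children U (suc j) k)
          ≈⟨ sumOver-++ weight (forests U (j * d) (suc k)) _ ⟩
        sumOver weight (forests U (j * d) (suc k)) ⊕ sumOver weight (children U (suc j) k)
          ≈⟨ ⊕-cong (sumOver-forests-weighted (j * d) (suc k)) (sumOver-children (suc j) k) ⟩
        term j (suc k) ⊕ Σ≤ k (λ i → term (suc (j + i)) (k ∸ i))
          ≈⟨ ⊕-cong (reflexive (cong (λ i → term i (suc k)) (+-identityʳ j)))
                    (Σ≤-cong k (λ i _ → reflexive (cong (λ l → term l (k ∸ i)) (+-suc j i)))) ⟨
        term (j + 0) (suc k) ⊕ Σ≤ k (λ i → term (j + suc i) (k ∸ i))
          ≡⟨ Σ≤-suc k (λ i → term (j + i) (suc k ∸ i)) ⟨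
        Σ≤ (suc k) (λ i → term (j + i) (suc k ∸ i)) ∎
        where
        term : ℕ → ℕ → Carrier
        term i l = g (i * d) ⊗ (S ^ₛ (i * d)) l

  -- The bound `suc k` is the least for which the enumeration of trees of index `k` is known to be
  -- complete.
  treeSeries : (Tree → Carrier) → Series
  treeSeries u k = sumOver u (trees (suc k) k)

  -- Two sufficient depth bounds give duplicate-free lists with the same members, so the sums agree
  -- even if the orders differ.
  sumOver-trees : ∀ u f {k} → k < f → sumOver u (trees f k) ≈ treeSeries u k
  sumOver-trees u f {k} k<f = Bijection.foldMap-unique +-commutativeMonoid u (trees-unique f k) (trees-unique (suc k) k)
    (trees-complete (suc k) ≤-refl ∘ trees-sound f) (trees-complete f k<f ∘ trees-sound (suc k))

  treeSeries-equation : ∀ {w u : Tree → Carrier} (g : ℕ → Carrier) (α : Series) →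
    (∀ us → w (node us) ≈ g (length us) ⊗ forestProduct u us) → (∀ j → g (j * d) ≈ α j) →
    ∀ n → treeSeries w n ≈ Σ≤ n (λ j → α j ⊗ (treeSeries u ^ₛ (j * d)) (n ∸ j))
  treeSeries-equation {w} {u} g α w≈ g≈α n = begin
    sumOver w (map node (children (trees n) 0 n))
      ≡⟨ sumOver-map w node (children (trees n) 0 n) ⟩
    sumOver (w ∘ node) (children (trees n) 0 n)
      ≈⟨ sumOver-cong (children (trees n) 0 n) (λ {us} _ → w≈ us) ⟩
    sumOver (λ us → g (length us) ⊗ forestProduct u us) (children (trees n) 0 n)
      ≈⟨ sumOver-children (trees-sound n) u g 0 n ⟩
    Σ≤ n (λ j → g (j * d) ⊗ ((λ i → sumOver u (trees n i)) ^ₛ (j * d)) (n ∸ j))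
      -- One level down, the bound `n` is sufficient only for indices below `n`, and these are the
      -- only coefficients on which the sum depends.
      ≈⟨ Σ-power-cong (λ j → g (j * d)) d n (λ i i<n → sumOver-trees u n i<n) ⟩
    Σ≤ n (λ j → g (j * d) ⊗ (treeSeries u ^ₛ (j * d)) (n ∸ j))
      ≈⟨ Σ≤-cong n (λ j _ → ⊗-congʳ (g≈α j)) ⟩
    Σ≤ n (λ j → α j ⊗ (treeSeries u ^ₛ (j * d)) (n ∸ j)) ∎

  sumOver-treePairs : ∀ u v f {k} → k < f →
    sumOver (λ z → u (proj₁ z) ⊗ v (proj₂ z)) (treePairs f k) ≈ (treeSeries u ⊛ treeSeries v) k
  sumOver-treePairs u v f {k} k<f = ≈-trans (sumOver-convolution u v (trees f) (trees f) k)
    (⊛-cong k (λ i i≤k → sumOver-trees u f (≤-<-trans i≤k k<f)) (λ j j≤k → sumOver-trees v f (≤-<-trans j≤k k<f)))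

  -- This weight admits only the tree with a single edge, so its series is 1. Put in place of one of
  -- the two tree weights, it selects the partitions in which the block of 1, or of 1′, is a
  -- singleton.
  leaf : Tree → Carrier
  leaf (node [])      = 1#
  leaf (node (_ ∷ _)) = 0#

  treeSeries-leaf : ∀ k → treeSeries leaf k ≈ oneS k
  treeSeries-leaf zero = ⊕-identityʳ 1#
  treeSeries-leaf (suc k) = ≈-trans (sumOver-cong (trees (suc (suc k)) (suc k)) (λ {t} t∈ → not-leaf t (trees-sound (suc (suc k)) t∈)))
    (none (trees (suc (suc k)) (suc k)))
    where
    not-leaf : ∀ t → IsTree (suc k) t → leaf t ≈ 0#
    not-leaf (node []) (isTree _ e) with () ← *-cancelʳ-≡ 0 (suc k) d (suc-injective e)
    not-leaf (node (_ ∷ _)) _ = ≈-refl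
    none : ∀ (ts : List Tree) → sumOver (λ _ → 0#) ts ≈ 0#
    none [] = ≈-refl
    none (_ ∷ ts) = ≈-trans (⊕-identityˡ _) (none ts)

  pow-+ : ∀ x j k → pow x (j + k) ≈ pow x j ⊗ pow x k
  pow-+ x zero k = ≈-sym (⊗-identityˡ _)
  pow-+ x (suc j) k = ≈-trans (⊗-congˡ (pow-+ x j k)) (≈-sym (⊗-assoc _ _ _))

  module Weights (a a* : ℕ → Carrier) (s t : Carrier) where

    private
      q : ℕ → ℕ
      q = quotient d

    -- The factors pow s 0 and pow t 0 are there so that both functions split into the same three parts.
    blackFactor whiteFactor : ℕ → Carrier
    blackFactor m = (a (q m) ⊗ pow s 0) ⊗ pow t (q m)
    whiteFactor m = (a* (q m) ⊗ pow s (q m)) ⊗ pow t 0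

    open TreeFold *-commutativeMonoid blackFactor whiteFactor

    whiteWeight blackWeight : Tree → Carrier
    whiteWeight (node us) = whiteFactor (suc (length us)) ⊗ foldBlack us
    blackWeight (node us) = blackFactor (suc (length us)) ⊗ foldWhite us

    foldWhite≡product : ∀ ts → foldWhite ts ≡ forestProduct whiteWeight ts
    foldWhite≡product [] = refl
    foldWhite≡product (node us ∷ ts) = cong (whiteWeight (node us) ⊗_) (foldWhite≡product ts)

    foldBlack≡product : ∀ ts → foldBlack ts ≡ forestProduct blackWeight ts
    foldBlack≡product [] = refl
    foldBlack≡product (node us ∷ ts) = cong (blackWeight (node us) ⊗_) (foldBlack≡product ts)

    whiteSeries blackSeries : Series
    whiteSeries = treeSeries whiteWeight
    blackSeries = treeSeries blackWeight

    whiteSeries-equation : ∀ n → whiteSeries n ≈ composeExpanded a* s d blackSeries n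
    whiteSeries-equation = treeSeries-equation (whiteFactor ∘ suc) (λ j → a* j ⊗ pow s j)
      (λ us → ⊗-congˡ (reflexive (foldBlack≡product us)))
      (λ j → ≈-trans (⊗-identityʳ _) (reflexive (cong (λ m → a* m ⊗ pow s m) (quotient-suc d j))))

    blackSeries-equation : ∀ n → blackSeries n ≈ composeExpanded a t d whiteSeries n
    blackSeries-equation = treeSeries-equation (blackFactor ∘ suc) (λ j → a j ⊗ pow t j)
      (λ us → ⊗-congˡ (reflexive (foldWhite≡product us)))
      (λ j → ≈-trans (⊗-congʳ (⊗-identityʳ _)) (reflexive (cong (λ m → a m ⊗ pow t m) (quotient-suc d j))))

    module _ {n : ℕ} (0<n : 0 < n) {π σ : Labelling n} where

      -- The product over blocks and the powers of s and t are each a product over vertices;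
      -- regrouping them vertex by vertex gives the two local factors.
      wt-encodes : ∀ {ts} → 0 < length ts → Encodes (π , σ) ts → DivisibleForest d ts →
        wt d a a* s t (π , σ) ≈ blackFactor (length ts) ⊗ foldWhite ts
      wt-encodes {ts} 0<len E D = begin
        wt d a a* s t (π , σ)
          ≈⟨ ⊗-cong (⊗-cong (blocks-fold 0<n E *-commutativeMonoid (a ∘ q) (a* ∘ q))
                            (reflexive (cong (pow s) (numBlocks-quotient d 0<n E D))))
                    (reflexive (cong (pow t) (dual-numBlocks-quotient d 0<n E D 0<len))) ⟩
        ((aₗ ⊗ F) ⊗ pow s (WhiteQuotients.foldWhite d ts)) ⊗ pow t (q (length ts) + BlackQuotients.foldWhite d ts)
          ≈⟨ ⊗-cong (⊗-congˡ (foldWhite-hom *-commutativeMonoid (pow s) ≈-refl (pow-+ s) (λ _ → 0) q ts))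
                    (≈-trans (pow-+ t (q (length ts)) _) (⊗-congˡ (foldWhite-hom *-commutativeMonoid (pow t) ≈-refl (pow-+ t) q (λ _ → 0) ts))) ⟩
        ((aₗ ⊗ F) ⊗ Fₛ) ⊗ (pow t (q (length ts)) ⊗ Fₜ)
          -- The inserted `1#` is `pow s 0`, the middle part of `blackFactor` at the root.
          ≈⟨ ⊗-congʳ (≈-trans (⊗-assoc _ _ _) (⊗-congʳ (≈-sym (⊗-identityʳ aₗ)))) ⟩
        ((aₗ ⊗ 1#) ⊗ (F ⊗ Fₛ)) ⊗ (pow t (q (length ts)) ⊗ Fₜ)
          ≈⟨ ⊗-interchange _ _ _ _ ⟩
        blackFactor (length ts) ⊗ ((F ⊗ Fₛ) ⊗ Fₜ)
          ≈⟨ ⊗-congˡ (≈-trans (foldWhite-∙ *-commutativeMonoid _ _ _ _ ts) (⊗-congʳ (foldWhite-∙ *-commutativeMonoid _ _ _ _ ts))) ⟨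
        blackFactor (length ts) ⊗ foldWhite ts ∎
        where
        aₗ = a (q (length ts))
        F  = TreeFold.foldWhite *-commutativeMonoid (a ∘ q) (a* ∘ q) ts
        Fₛ = TreeFold.foldWhite *-commutativeMonoid (λ _ → pow s 0) (pow s ∘ q) ts
        Fₜ = TreeFold.foldWhite *-commutativeMonoid (pow t ∘ q) (λ _ → pow t 0) ts

      -- After the cut, the edge 1-1′ acts as parent edge of both roots. So the old root keeps its
      -- degree `suc (length right)` and its factor in `blackWeight`.
      wt-represents : ∀ {y} → Represents (π , σ) y → wt d a a* s t (π , σ) ≈ whiteWeight (proj₁ y) ⊗ blackWeight (proj₂ y)
      wt-represents (represents {node ts} {us} refl E D) = ≈-trans (wt-encodes (s≤s z≤n) E D) (x⊗yz≈y⊗xz _ _ _)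

    private
      if-true : ∀ {b} {x y : Carrier} → b ≡ true → (if b then x else y) ≡ x
      if-true refl = refl
      if-false : ∀ {b} {x y : Carrier} → b ≡ false → (if b then x else y) ≡ y
      if-false refl = refl

    module _ (a0 : a 0 ≈ 1#) (a*0 : a* 0 ≈ 1#) where

      -- Here the normalisation a(0) = 1 enters: the singleton block that `leaf` selects must have
      -- weight 1.
      blackWeight-leaf : blackWeight (node []) ≈ 1#
      blackWeight-leaf = begin
        ((a (q 1) ⊗ 1#) ⊗ pow t (q 1)) ⊗ 1# ≈⟨ ≈-trans (⊗-identityʳ _) (⊗-congʳ (⊗-identityʳ _)) ⟩
        a (q 1) ⊗ pow t (q 1)               ≡⟨ cong (λ m → a m ⊗ pow t m) (quotient-suc d 0) ⟩
        a 0 ⊗ 1#                            ≈⟨ ⊗-identityʳ _ ⟩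
        a 0                                 ≈⟨ a0 ⟩
        1#                                  ∎

      whiteWeight-leaf : whiteWeight (node []) ≈ 1#
      whiteWeight-leaf = begin
        ((a* (q 1) ⊗ pow s (q 1)) ⊗ 1#) ⊗ 1# ≈⟨ ≈-trans (⊗-identityʳ _) (⊗-identityʳ _) ⟩
        a* (q 1) ⊗ pow s (q 1)               ≡⟨ cong (λ m → a* m ⊗ pow s m) (quotient-suc d 0) ⟩
        a* 0 ⊗ 1#                            ≈⟨ ⊗-identityʳ _ ⟩
        a* 0                                 ≈⟨ a*0 ⟩
        1#                                   ∎

      module _ {n : ℕ} {π σ : Labelling (suc n)} where

        wt-singleton : ∀ {y} → Represents (π , σ) y →
          (if blockSize π Fin.zero ≡ᵇ 1 then wt d a a* s t (π , σ) else 0#) ≈ whiteWeight (proj₁ y) ⊗ leaf (proj₂ y)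
        wt-singleton r@(represents {_} {[]} refl E _) = ≈-trans
          (reflexive (if-true (cong (_≡ᵇ 1) (root-degree E))))
          (≈-trans (wt-represents (s≤s z≤n) r) (⊗-congˡ blackWeight-leaf))
        wt-singleton (represents {_} {_ ∷ _} refl E _) = ≈-trans
          (reflexive (if-false (cong (_≡ᵇ 1) (root-degree E)))) (≈-sym (zeroʳ _))

        wt-dual-singleton : ∀ {y} → Represents (π , σ) y →
          (if blockSize σ Fin.zero ≡ᵇ 1 then wt d a a* s t (π , σ) else 0#) ≈ leaf (proj₁ y) ⊗ blackWeight (proj₂ y)
        wt-dual-singleton r@(represents {node []} refl E _) = ≈-trans
          (reflexive (if-true (cong (_≡ᵇ 1) (dual-root-degree E))))
          (≈-trans (wt-represents (s≤s z≤n) r) (⊗-congʳ whiteWeight-leaf))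
        wt-dual-singleton (represents {node (_ ∷ _)} refl E _) = ≈-trans
          (reflexive (if-false (cong (_≡ᵇ 1) (dual-root-degree E)))) (≈-sym (zeroˡ _))

      module _ (k n : ℕ) (n≡ : n ≡ k * d) where

        private
          sum-pairs : ∀ {w : Labelling (suc n) × Labelling (suc n) → Carrier} (u v : Tree → Carrier) →
            (∀ {x y} → Represents x y → w x ≈ u (proj₁ y) ⊗ v (proj₂ y)) →
            sumOver w (NCdPairs d (suc n)) ≈ (treeSeries u ⊛ treeSeries v) k
          sum-pairs u v w≈ = ≈-trans
            (foldMap-NCdPairs (suc k) k (suc n) ≤-refl (cong suc n≡) +-commutativeMonoid w≈)
            (sumOver-treePairs u v (suc k) ≤-refl)

        sum-wt : sumOver (wt d a a* s t) (NCdPairs d (suc n)) ≈ (whiteSeries ⊛ blackSeries) k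
        sum-wt = sum-pairs whiteWeight blackWeight (wt-represents (s≤s z≤n))

        sum-wt-singleton :
          sumOver (wt d a a* s t) (keep (λ p → blockSize (proj₁ p) Fin.zero ≡ᵇ 1) (NCdPairs d (suc n))) ≈ whiteSeries k
        sum-wt-singleton = ≈-trans (sumOver-keep _ _ (NCdPairs d (suc n)))
          (≈-trans (sum-pairs whiteWeight leaf wt-singleton)
            (≈-trans (⊛-congˡ k whiteSeries treeSeries-leaf) (⊛-identityʳ whiteSeries k)))

        sum-wt-dual-singleton :
          sumOver (wt d a a* s t) (keep (λ p → blockSize (proj₂ p) Fin.zero ≡ᵇ 1) (NCdPairs d (suc n))) ≈ blackSeries k
        sum-wt-dual-singleton = ≈-trans (sumOver-keep _ _ (NCdPairs d (suc n)))
          (≈-trans (sum-pairs leaf blackWeight wt-dual-singleton)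
            (≈-trans (⊛-congʳ k blackSeries treeSeries-leaf) (⊛-identityˡ blackSeries k)))

      bSeq≈ : ∀ k → bSeq d a a* s t k ≈ (whiteSeries ⊛ blackSeries) k
      -- The partitions have `suc (d * k)` points while the trees are measured by `k * d`;
      -- commutativity supplies the equation between the two.
      bSeq≈ k = sum-wt k (d * k) (*-comm d k)

      cSeq≈ : ∀ k → cSeq d a a* s t k ≈ whiteSeries k
      cSeq≈ k = sum-wt-singleton k (d * k) (*-comm d k)

      c*Seq≈ : ∀ k → c*Seq d a a* s t k ≈ blackSeries k
      c*Seq≈ k = sum-wt-dual-singleton k (d * k) (*-comm d k)

theorem4p1 : ∀ {c ℓ} (R : CommutativeRing c ℓ) (d : ℕ) .{{_ : NonZero d}}
    (a a* : ℕ → CommutativeRing.Carrier R) (s t : CommutativeRing.Carrier R) →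
    let open CommutativeRing R
        open WithRing R
        A  = a
        A* = a*
        B  = bSeq d a a* s t
        C  = cSeq d a a* s t
        C* = c*Seq d a a* s t
    in a 0 ≈ 1# → a* 0 ≈ 1# →
       (∀ n → C n ≈ compose A* (xTimes (scale s (C* ^ₛ d))) n)
       × (∀ n → C* n ≈ compose A (xTimes (scale t (C ^ₛ d))) n)
       × (∀ n → B n ≈ (C ⊛ C*) n)
       × ((F G : Series) →
          (∀ n → F n ≈ compose A* (xTimes (scale s (G ^ₛ d))) n) →
          (∀ n → G n ≈ compose A (xTimes (scale t (F ^ₛ d))) n) →
          ∀ n → (F n ≈ C n) × (G n ≈ C* n))
theorem4p1 R d a a* s t a0 a*0 =
  (λ n → ≈-trans (C≈ n) (≈-sym (compose-expand a* s d _ n))) ,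
  (λ n → ≈-trans (C*≈ n) (≈-sym (compose-expand a t d _ n))) ,
  (λ n → ≈-trans (bSeq≈ a0 a*0 n) (≈-sym (⊛-cong n (λ i _ → cSeq≈ a0 a*0 i) (λ i _ → c*Seq≈ a0 a*0 i)))) ,
  λ F G F≈ G≈ → solution-unique a a* s t d
    (λ n → ≈-trans (F≈ n) (compose-expand a* s d G n))
    (λ n → ≈-trans (G≈ n) (compose-expand a t d F n)) C≈ C*≈
  where
  open CommutativeRing R using (_≈_) renaming (sym to ≈-sym; trans to ≈-trans)
  open WithRing R
  open PowerSeries R
  open GeneratingFunctions R d
  open Weights a a* s t
  C≈ : ∀ n → cSeq d a a* s t n ≈ composeExpanded a* s d (c*Seq d a a* s t) n
  C≈ n = ≈-trans (cSeq≈ a0 a*0 n) (≈-trans (whiteSeries-equation n)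
    (Σ-power-cong _ d n (λ i _ → ≈-sym (c*Seq≈ a0 a*0 i))))
  C*≈ : ∀ n → c*Seq d a a* s t n ≈ composeExpanded a t d (cSeq d a a* s t) n
  C*≈ n = ≈-trans (c*Seq≈ a0 a*0 n) (≈-trans (blackSeries-equation n)
    (Σ-power-cong _ d n (λ i _ → ≈-sym (cSeq≈ a0 a*0 i))))
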